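{- Let $n\ge 1$, $m=\lceil n/2\rceil$, and let $x,k_1,\ldots,k_m$ be integers with $k_1<\cdots<k_m\le x$. Let $\gamma(n,x;k_1,\ldots,k_m)$ be the number of halved monotone triangles with $n$ rows, bottom row $(k_1,\ldots,k_m)$ and no entry exceeding $x$. If $n$ is odd then $$\gamma(n,x;k_1,\ldots,k_m)=\left(\prod_{1\le p<q\le (n+1)/2}(\mathrm{id}+E_{k_q}\Delta_{k_p})^{ -1}E_{k_p}(\mathrm{id}+E^{ -1}_{k_q}\Delta_{k_p})^{ -1}\right)\prod_{1\le i<j\le (n+1)/2}\frac{(k_j-k_i)(2x+1-k_i-k_j)}{(j-i)(j+i-1)},$$ and if $n$ is even then $$\gamma(n,x;k_1,\ldots,k_m)=\left(\prod_{1\le p<q\le n/2}(\mathrm{id}+E_{k_q}\Delta_{k_p})^{ -1}E_{k_p}(\mathrm{id}+E^{ -1}_{k_q}\Delta_{k_p})^{ -1}\right)\prod_{1\le i<j\le n/2}\frac{(k_j-k_i)(2x+2-k_i-k_j)}{(j-i)(j+i)}\prod_{i=1}^{n/2}\frac{x+1-k_i}{i}.$$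
   Context: A halved monotone triangle with $n$ rows is a triangular array of integers $(a_{i,j})_{1\le i\le n,\,1\le j\le\lceil i/2\rceil}$ with $a_{i+1,j}\le a_{i,j}$, $a_{i,j}\le a_{i+1,j+1}$ and $a_{i,j}<a_{i,j+1}$ whenever the entries are defined; its bottom row is row $n$. $E_y p(y)=p(y+1)$ is the shift operator, $E_y^{ -1}p(y)=p(y-1)$, and $\Delta_y=E_y-\mathrm{id}$ is the difference operator, acting on polynomials in $k_1,\ldots,k_m$ (with $x$ a parameter). The operators $\mathrm{id}+E_{k_q}\Delta_{k_p}$ and $\mathrm{id}+E^{ -1}_{k_q}\Delta_{k_p}$ are of the form $P(\Delta_{k_1},\ldots,\Delta_{k_m})$ for a formal power series $P$ with constant term $1$ (using $E=\mathrm{id}+\Delta$, $E^{ -1}=\sum_{r\ge0}(-\Delta)^r$), which acts on polynomials as a finite sum; such operators are invertible on the polynomial ring, the inverse being given by the inverse formal power series. Products of operators mean composition; the resulting polynomial is evaluated at the given integers. -}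

module Defs where

open import Data.Nat as ℕ using (ℕ; zero; suc; _∸_; ⌈_/2⌉; _<ᵇ_)
open import Data.Integer as ℤ using (ℤ; +_; -[1+_])
open import Data.Rational as ℚ using (ℚ; 0ℚ; 1ℚ; _/_)
open import Data.Fin as Fin using (Fin; toℕ)
open import Data.List as List using (List; []; _∷_; upTo; allFin; concatMap; foldr; length)
open import Data.List.Membership.Propositional using (_∈_)
open import Data.List.Relation.Unary.All using (All)
open import Data.List.Relation.Unary.Unique.Propositional using (Unique)
open import Data.Maybe using (Maybe; just; nothing; _>>=_)
open import Data.Product using (Σ; _×_; _,_)
open import Data.Bool using (if_then_else_)
open import Data.Vec.Functional using (Vector; updateAt; toList)
open import Relation.Binary.PropositionalEquality using (_≡_)
open import Function using (_∘_; id)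

HasCount : {A : Set} → (A → Set) → ℕ → Set
HasCount {A} P c =
  Σ (List A) λ l → Unique l × (∀ a → (a ∈ l → P a) × (P a → a ∈ l)) × length l ≡ c

-- Halved monotone triangles, stored as the list of rows (top row first).
-- Row i (1-indexed) has ⌈ i/2 ⌉ entries. Indices below are 0-indexed.

nth : {A : Set} → List A → ℕ → Maybe A
nth []       _       = nothing
nth (a ∷ as) zero    = just a
nth (a ∷ as) (suc i) = nth as i

entry : List (List ℤ) → ℕ → ℕ → Maybe ℤ
entry t i j = nth t i >>= λ row → nth row j

IsHMT : (n : ℕ) (x : ℤ) → Vector ℤ ⌈ n /2⌉ → List (List ℤ) → Set
IsHMT n x k t =
    List.map length t ≡ List.map (λ i → ⌈ suc i /2⌉) (upTo n)
  × nth t (n ∸ 1) ≡ just (toList k)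
  × All (All (ℤ._≤ x)) t
  × (∀ i j a b → entry t i j ≡ just a → entry t (suc i) j ≡ just b → b ℤ.≤ a)
  × (∀ i j a b → entry t i j ≡ just a → entry t (suc i) (suc j) ≡ just b → a ℤ.≤ b)
  × (∀ i j a b → entry t i j ≡ just a → entry t i (suc j) ≡ just b → a ℤ.< b)

Fun : ℕ → Set
Fun m = Vector ℤ m → ℚ

shift : {m : ℕ} → Fin m → ℤ → Fun m → Fun m
shift j d f k = f (updateAt k j (ℤ._+ d))

E : {m : ℕ} → Fin m → Fun m → Fun m
E j = shift j (+ 1)

Einv : {m : ℕ} → Fin m → Fun m → Fun m
Einv j = shift j -[1+ 0 ]

Δ : {m : ℕ} → Fin m → Fun m → Fun m
Δ j f k = E j f k ℚ.- f k

-- Truncated inverse of (id + T):  Σ_{r=0}^{N} (-T)^r, written in Horner form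
--   geom 0 T f = f,  geom (N+1) T f = f - T (geom N T f).
-- On polynomials of degree < N this equals the action of the inverse formal
-- power series (id + T)^{-1} (T has no constant term in the Δ's).
geom : {m : ℕ} → ℕ → (Fun m → Fun m) → Fun m → Fun m
geom zero    T f = f
geom (suc N) T f = λ k → f k ℚ.- T (geom N T f) k

pairs : (m : ℕ) → List (Fin m × Fin m)
pairs m = concatMap (λ p → concatMap (λ q →
            if toℕ p <ᵇ toℕ q then (p , q) ∷ [] else []) (allFin m)) (allFin m)

factor : {m : ℕ} → ℕ → Fin m × Fin m → Fun m → Fun m
factor N (p , q) = geom N (E q ∘ Δ p) ∘ E p ∘ geom N (Einv q ∘ Δ p)

opProd : (m : ℕ) → ℕ → Fun m → Fun m
opProd m N = foldr (λ pq g → factor N pq ∘ g) id (pairs m)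

-- The polynomials to which the operator is applied (0-indexed i < j;
-- with 1-indexed I = i+1, J = j+1: J - I = suc (j ∸ i ∸ 1),
-- J + I - 1 = suc (i + j), J + I = suc (suc (i + j)), I = suc i).

prodℚ : {A : Set} → (A → ℚ) → List A → ℚ
prodℚ g = foldr (λ a r → g a ℚ.* r) 1ℚ

Fodd : (m : ℕ) → ℤ → Fun m
Fodd m x k = prodℚ (λ { (i , j) →
    ((k j ℤ.- k i) / suc (toℕ j ∸ toℕ i ∸ 1))
    ℚ.* ((ℤ.+ 2 ℤ.* x ℤ.+ ℤ.+ 1 ℤ.- k i ℤ.- k j) / suc (toℕ i ℕ.+ toℕ j)) })
  (pairs m)

Feven : (m : ℕ) → ℤ → Fun m
Feven m x k =
  prodℚ (λ { (i , j) →
    ((k j ℤ.- k i) / suc (toℕ j ∸ toℕ i ∸ 1))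
    ℚ.* ((ℤ.+ 2 ℤ.* x ℤ.+ ℤ.+ 2 ℤ.- k i ℤ.- k j) / suc (suc (toℕ i ℕ.+ toℕ j))) })
    (pairs m)
  ℚ.* prodℚ (λ i → (x ℤ.+ ℤ.+ 1 ℤ.- k i) / suc (toℕ i)) (allFin m)

-- "γ equals the operator applied to F and evaluated at k": the truncated
-- operator stabilises (as it does on polynomials) at the value c.
OpValue : (m : ℕ) → Fun m → Vector ℤ m → ℚ → Set
OpValue m F k v = Σ ℕ λ N₀ → ∀ N → N₀ ℕ.≤ N → opProd m N F k ≡ v

{-# OPTIONS --safe #-}
module Submission where

-- Write X_p for the shift E_{k_p}. The operator is ∏_{p<q} X_p X_q / ((1 − X_q + X_p X_q)(X_p + X_q − 1)),
-- and the polynomials it is applied to are, up to sign, det C(x − k_i + j, 2j) for odd n and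
-- det C(x − k_i + j + 1, 2j + 1) for even n (a Vandermonde determinant in (x + 1/2 − k)²,
-- resp. in (x + 1 − k)²). Consecutive families of columns are obtained from one another by
-- differencing, so the polynomial for n − 1 is a mixed difference of an antisymmetric
-- polynomial G, and γ(n − 1, ·) that of C = (operator) G. Since X_p + X_q − 1 is symmetric,
-- (1 − X_{i+1} + X_i X_{i+1}) C is antisymmetric in k_i, k_{i+1} and vanishes for k_i = k_{i+1};
-- with this relation the sum over the strict rows interlacing k telescopes.
--   From even to odd the result is an alternating sum of C with one entry deleted. The first
-- column of the new determinant is constant, so expanding along it gives the same sum, because
-- a factor of the operator with X_p = 1 or X_q = 1 reduces to a power of a shift.
--   From odd to even every term but one contains C with last entry x + 1. There C vanishes: its
-- polynomial is odd about x + 1 in the last variable, and the operator is invariant under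
-- inverting the last shift.

open import Defs
open import Algebra.Bundles using (CommutativeMonoid)
open import Data.Bool using (true; false; if_then_else_)
open import Data.Empty using (⊥; ⊥-elim)
open import Data.Fin as Fin using (Fin; toℕ)
open import Data.Integer as ℤ using (ℤ; -[1+_])
import Data.Integer.Properties as ℤₚ
open import Data.Integer.Solver using () renaming (module +-*-Solver to ℤ-Solver)
open import Data.List
  using (List; []; _∷_; _∷ʳ_; length; map; _++_; concatMap; foldr; allFin; upTo; initLast; _∷ʳ′_)
open import Data.List.Membership.Propositional using (_∈_)
open import Data.List.Membership.Propositional.Properties
  using (∈-map⁺; ∈-map⁻; ∈-++⁺ˡ; ∈-++⁺ʳ; ∈-++⁻)
import Data.List.Properties as Listₚ
open import Data.List.Relation.Unary.All as All using (All; []; _∷_)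
import Data.List.Relation.Unary.All.Properties as Allₚ
open import Data.List.Relation.Unary.AllPairs using ([]; _∷_)
open import Data.List.Relation.Unary.Any using (here; there)
open import Data.List.Relation.Unary.Unique.Propositional using (Unique)
import Data.List.Relation.Unary.Unique.Propositional.Properties as Uniqueₚ
open import Data.Maybe using (just)
open import Data.Maybe.Properties using (just-injective)
open import Data.Nat as ℕ using (ℕ; zero; suc; ⌈_/2⌉)
import Data.Nat.Properties as ℕₚ
open import Data.Product using (Σ; ∃; _×_; _,_; proj₁; proj₂)
import Data.Rational.Properties as ℚₚ
open import Data.Rational.Solver using (module +-*-Solver)
open import Data.Rational.Unnormalised as ℚᵘ using (mkℚᵘ; *≡*)
import Data.Rational.Unnormalised.Properties as ℚᵘₚ
open import Data.Sum using (_⊎_; inj₁; inj₂)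
open import Data.Unit using (⊤; tt)
open import Data.Vec.Functional using (Vector; updateAt; toList)
open import Function using (_∘_; id)
import Relation.Binary.Reasoning.Setoid as SetoidReasoning
open import Relation.Binary.PropositionalEquality hiding (setoid)
open import Relation.Nullary using (yes; no; ¬_)

-- No polynomial is ever represented: functions send integer lists of any length to rationals, and
-- all that is used of polynomiality is membership in `V`, being killed by a fixed power of every
-- difference. There the truncated series are exact inverses. Operators are kept as syntax, so that
-- exchanging two shifts, inverting one or setting one to 1 is a substitution.
--
-- The obstacle is strictness. If the entries of the row above ranged over independent intervals,
-- the sum of a mixed difference would be an alternating sum over the corners of a box. Strictness
-- excludes the rows with two neighbours equal to the entry of k between them: a first neighbour
-- equal to k raises the lower limit of the second to k + 1. The diagonal relation compensates for
-- exactly this.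
--
-- For an odd number of rows, G has its columns moved by one. After telescoping, the entries behind
-- the deleted one are upper limits k + 1 and those before it lower limits k, whereas setting X_r =
-- 1 in the operator lowers the entries before r; the two differ by a shift of all entries at once.

module ShiftOperators where

  -- The commutative algebra of shift operators and truncated geometric series.

  open import Data.Rational using (ℚ; 0ℚ; 1ℚ; _+_; _-_; _*_; -_)
  open +-*-Solver using (solve; _:+_; _:*_; _:-_; :-_; _:=_; con)
  open ≡-Reasoning

  +-interchange : ∀ a b c d → (a + b) + (c + d) ≡ (a + c) + (b + d)
  +-interchange = solve 4 (λ a b c d → (a :+ b) :+ (c :+ d) := (a :+ c) :+ (b :+ d)) refl

  sub-interchange : ∀ a b c d → (a + b) - (c + d) ≡ (a - c) + (b - d)
  sub-interchange = solve 4 (λ a b c d → (a :+ b) :- (c :+ d) := (a :- c) :+ (b :- d)) refl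

  *-distribˡ-sub : ∀ a b c → a * b - a * c ≡ a * (b - c)
  *-distribˡ-sub = solve 3 (λ a b c → a :* b :- a :* c := a :* (b :- c)) refl

  -- Lists rather than vectors of a fixed length, because deleting an entry, fixing the first one
  -- and passing from m to m + 1 variables then need no change of type. A shift beyond the end of
  -- the list does nothing.
  LFun : Set
  LFun = List ℤ → ℚ

  sh : ℕ → ℤ → List ℤ → List ℤ
  sh i       d []      = []
  sh zero    d (a ∷ v) = a ℤ.+ d ∷ v
  sh (suc i) d (a ∷ v) = a ∷ sh i d v

  length-sh : ∀ i d v → length (sh i d v) ≡ length v
  length-sh zero    d []      = refl
  length-sh (suc i) d []      = refl
  length-sh zero    d (a ∷ v) = refl
  length-sh (suc i) d (a ∷ v) = cong suc (length-sh i d v)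

  sh-comm : ∀ i d j e v → sh i d (sh j e v) ≡ sh j e (sh i d v)
  sh-comm zero    d zero    e []      = refl
  sh-comm zero    d (suc j) e []      = refl
  sh-comm (suc i) d zero    e []      = refl
  sh-comm (suc i) d (suc j) e []      = refl
  sh-comm zero    d zero    e (a ∷ v) = cong (_∷ v) (begin
    a ℤ.+ e ℤ.+ d    ≡⟨ ℤₚ.+-assoc a e d ⟩
    a ℤ.+ (e ℤ.+ d)  ≡⟨ cong (λ c → a ℤ.+ c) (ℤₚ.+-comm e d) ⟩
    a ℤ.+ (d ℤ.+ e)  ≡⟨ ℤₚ.+-assoc a d e ⟨
    a ℤ.+ d ℤ.+ e    ∎)
  sh-comm zero    d (suc j) e (a ∷ v) = refl
  sh-comm (suc i) d zero    e (a ∷ v) = refl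
  sh-comm (suc i) d (suc j) e (a ∷ v) = cong (a ∷_) (sh-comm i d j e v)

  sh-[] : ∀ i d → sh i d [] ≡ []
  sh-[] zero    d = refl
  sh-[] (suc i) d = refl

  infixl 6 _⊕_ _⊖_
  infixr 7 _⊗_

  -- Polynomials in the shifts, with composition as product; X i d shifts the i-th entry by d.
  data Op : Set where
    I           : Op
    X           : ℕ → ℤ → Op
    _⊕_ _⊖_ _⊗_ : Op → Op → Op

  ⟦_⟧ : Op → LFun → LFun
  ⟦ I ⟧     f   = f
  ⟦ X i d ⟧ f v = f (sh i d v)
  ⟦ P ⊕ Q ⟧ f v = ⟦ P ⟧ f v + ⟦ Q ⟧ f v
  ⟦ P ⊖ Q ⟧ f v = ⟦ P ⟧ f v - ⟦ Q ⟧ f v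
  ⟦ P ⊗ Q ⟧ f   = ⟦ P ⟧ (⟦ Q ⟧ f)

  Closed : (List ℤ → Set) → Set
  Closed R = ∀ i d v → R v → R (sh i d v)

  -- An operator reads its argument only at shifts of the given list, so agreement on a set of lists
  -- closed under shifts is enough. The typical set is that of the lists of one length.
  ⟦⟧-cong-on : ∀ {R} → Closed R → ∀ P {f g} → (∀ v → R v → f v ≡ g v) →
               ∀ v → R v → ⟦ P ⟧ f v ≡ ⟦ P ⟧ g v
  ⟦⟧-cong-on c I       e v r = e v r
  ⟦⟧-cong-on c (X i d) e v r = e (sh i d v) (c i d v r)
  ⟦⟧-cong-on c (P ⊕ Q) e v r = cong₂ _+_ (⟦⟧-cong-on c P e v r) (⟦⟧-cong-on c Q e v r)
  ⟦⟧-cong-on c (P ⊖ Q) e v r = cong₂ _-_ (⟦⟧-cong-on c P e v r) (⟦⟧-cong-on c Q e v r)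
  ⟦⟧-cong-on c (P ⊗ Q) e v r = ⟦⟧-cong-on c P (⟦⟧-cong-on c Q e) v r

  ⟦⟧-cong : ∀ P {f g} → f ≗ g → ⟦ P ⟧ f ≗ ⟦ P ⟧ g
  ⟦⟧-cong P e v = ⟦⟧-cong-on {λ _ → ⊤} _ P (λ w _ → e w) v tt

  OfLength : ℕ → List ℤ → Set
  OfLength n v = length v ≡ n

  OfLength-closed : ∀ n → Closed (OfLength n)
  OfLength-closed n i d v e = trans (length-sh i d v) e

  ⟦⟧-cong-length : ∀ {n} P {f g} → (∀ v → length v ≡ n → f v ≡ g v) →
                   ∀ v → length v ≡ n → ⟦ P ⟧ f v ≡ ⟦ P ⟧ g v
  ⟦⟧-cong-length {n} = ⟦⟧-cong-on (OfLength-closed n)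

  ⟦⟧-0 : ∀ P {f} → (∀ v → f v ≡ 0ℚ) → ∀ v → ⟦ P ⟧ f v ≡ 0ℚ
  ⟦⟧-0 I       e v = e v
  ⟦⟧-0 (X i d) e v = e (sh i d v)
  ⟦⟧-0 (P ⊕ Q) e v = cong₂ _+_ (⟦⟧-0 P e v) (⟦⟧-0 Q e v)
  ⟦⟧-0 (P ⊖ Q) e v = cong₂ _-_ (⟦⟧-0 P e v) (⟦⟧-0 Q e v)
  ⟦⟧-0 (P ⊗ Q) e v = ⟦⟧-0 P (⟦⟧-0 Q e) v

  ⟦⟧-+ : ∀ P f g v → ⟦ P ⟧ (λ w → f w + g w) v ≡ ⟦ P ⟧ f v + ⟦ P ⟧ g v
  ⟦⟧-+ I       f g v = refl
  ⟦⟧-+ (X i d) f g v = refl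
  ⟦⟧-+ (P ⊕ Q) f g v = trans (cong₂ _+_ (⟦⟧-+ P f g v) (⟦⟧-+ Q f g v))
    (+-interchange (⟦ P ⟧ f v) (⟦ P ⟧ g v) (⟦ Q ⟧ f v) (⟦ Q ⟧ g v))
  ⟦⟧-+ (P ⊖ Q) f g v = trans (cong₂ _-_ (⟦⟧-+ P f g v) (⟦⟧-+ Q f g v))
    (sub-interchange (⟦ P ⟧ f v) (⟦ P ⟧ g v) (⟦ Q ⟧ f v) (⟦ Q ⟧ g v))
  ⟦⟧-+ (P ⊗ Q) f g v = trans (⟦⟧-cong P (⟦⟧-+ Q f g) v) (⟦⟧-+ P _ _ v)

  ⟦⟧-* : ∀ P c f v → ⟦ P ⟧ (λ w → c * f w) v ≡ c * ⟦ P ⟧ f v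
  ⟦⟧-* I       c f v = refl
  ⟦⟧-* (X i d) c f v = refl
  ⟦⟧-* (P ⊕ Q) c f v = trans (cong₂ _+_ (⟦⟧-* P c f v) (⟦⟧-* Q c f v)) (sym (ℚₚ.*-distribˡ-+ c _ _))
  ⟦⟧-* (P ⊖ Q) c f v = trans (cong₂ _-_ (⟦⟧-* P c f v) (⟦⟧-* Q c f v))
    (*-distribˡ-sub c (⟦ P ⟧ f v) (⟦ Q ⟧ f v))
  ⟦⟧-* (P ⊗ Q) c f v = trans (⟦⟧-cong P (⟦⟧-* Q c f) v) (⟦⟧-* P c _ v)

  ⟦⟧-neg : ∀ P f v → ⟦ P ⟧ (λ w → - f w) v ≡ - ⟦ P ⟧ f v
  ⟦⟧-neg P f v = begin
    ⟦ P ⟧ (λ w → - f w) v         ≡⟨ ⟦⟧-cong P (λ w → neg≡ (f w)) v ⟩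
    ⟦ P ⟧ (λ w → (- 1ℚ) * f w) v  ≡⟨ ⟦⟧-* P (- 1ℚ) f v ⟩
    (- 1ℚ) * ⟦ P ⟧ f v            ≡⟨ neg≡ (⟦ P ⟧ f v) ⟨
    - ⟦ P ⟧ f v                   ∎
    where
    neg≡ : ∀ a → - a ≡ (- 1ℚ) * a
    neg≡ = solve 1 (λ a → :- a := (:- con 1ℚ) :* a) refl

  ⟦⟧-sub : ∀ P f g v → ⟦ P ⟧ (λ w → f w - g w) v ≡ ⟦ P ⟧ f v - ⟦ P ⟧ g v
  ⟦⟧-sub P f g v = trans (⟦⟧-+ P f (λ w → - g w) v) (cong (⟦ P ⟧ f v +_) (⟦⟧-neg P g v))

  ⟦⟧-sh : ∀ P i d f v → ⟦ P ⟧ f (sh i d v) ≡ ⟦ P ⟧ (f ∘ sh i d) v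
  ⟦⟧-sh I       i d f v = refl
  ⟦⟧-sh (X j e) i d f v = cong f (sh-comm j e i d v)
  ⟦⟧-sh (P ⊕ Q) i d f v = cong₂ _+_ (⟦⟧-sh P i d f v) (⟦⟧-sh Q i d f v)
  ⟦⟧-sh (P ⊖ Q) i d f v = cong₂ _-_ (⟦⟧-sh P i d f v) (⟦⟧-sh Q i d f v)
  ⟦⟧-sh (P ⊗ Q) i d f v = trans (⟦⟧-sh P i d _ v) (⟦⟧-cong P (⟦⟧-sh Q i d f) v)

  -- Induction on `P` alone: a single shift passes through `Q` by `⟦⟧-sh`, and sums and differences
  -- by linearity of `Q`.
  ⟦⟧-comm : ∀ P Q f v → ⟦ P ⟧ (⟦ Q ⟧ f) v ≡ ⟦ Q ⟧ (⟦ P ⟧ f) v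
  ⟦⟧-comm I       Q f v = refl
  ⟦⟧-comm (X i d) Q f v = ⟦⟧-sh Q i d f v
  ⟦⟧-comm (P ⊕ P′) Q f v = trans (cong₂ _+_ (⟦⟧-comm P Q f v) (⟦⟧-comm P′ Q f v)) (sym (⟦⟧-+ Q _ _ v))
  ⟦⟧-comm (P ⊖ P′) Q f v = trans (cong₂ _-_ (⟦⟧-comm P Q f v) (⟦⟧-comm P′ Q f v)) (sym (⟦⟧-sub Q _ _ v))
  ⟦⟧-comm (P ⊗ P′) Q f v = trans (⟦⟧-cong P (⟦⟧-comm P′ Q f) v) (⟦⟧-comm P Q _ v)

  substOp : (ℕ → ℤ → Op) → Op → Op
  substOp θ I       = I
  substOp θ (X i d) = θ i d
  substOp θ (P ⊕ Q) = substOp θ P ⊕ substOp θ Q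
  substOp θ (P ⊖ Q) = substOp θ P ⊖ substOp θ Q
  substOp θ (P ⊗ Q) = substOp θ P ⊗ substOp θ Q

  -- The common form of the changes of variables: if composing with `h` turns each single shift into
  -- the operator `θ i d`, it turns `P` into `P` with `θ` substituted. It serves for prepending an
  -- entry, exchanging neighbours, deleting an entry, reflecting an entry and raising all entries.
  ⟦⟧-subst : ∀ {R} → Closed R → ∀ θ (h : List ℤ → List ℤ) →
             (∀ i d v → R v → ∀ g → g (h (sh i d v)) ≡ ⟦ θ i d ⟧ g (h v)) →
             ∀ P g v → R v → ⟦ P ⟧ (g ∘ h) v ≡ ⟦ substOp θ P ⟧ g (h v)
  ⟦⟧-subst c θ h e I       g v r = refl
  ⟦⟧-subst c θ h e (X i d) g v r = e i d v r g
  ⟦⟧-subst c θ h e (P ⊕ Q) g v r = cong₂ _+_ (⟦⟧-subst c θ h e P g v r) (⟦⟧-subst c θ h e Q g v r)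
  ⟦⟧-subst c θ h e (P ⊖ Q) g v r = cong₂ _-_ (⟦⟧-subst c θ h e P g v r) (⟦⟧-subst c θ h e Q g v r)
  ⟦⟧-subst c θ h e (P ⊗ Q) g v r = trans
    (⟦⟧-cong-on c P (⟦⟧-subst c θ h e Q g) v r) (⟦⟧-subst c θ h e P _ v r)

  rename : (ℕ → ℕ) → Op → Op
  rename π = substOp (λ i → X (π i))

  lift : Op → Op
  lift = rename suc

  ⟦lift⟧ : ∀ P f a v → ⟦ lift P ⟧ f (a ∷ v) ≡ ⟦ P ⟧ (f ∘ (a ∷_)) v
  ⟦lift⟧ P f a v = sym (⟦⟧-subst {λ _ → ⊤} _ _ (a ∷_) (λ i d w _ g → refl) P f v tt)

  ⟦lift⟧-[] : ∀ P f → ⟦ lift P ⟧ f [] ≡ ⟦ P ⟧ f []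
  ⟦lift⟧-[] P f = sym (⟦⟧-subst {_≡ []} (λ { i d v refl → sh-[] i d }) _ id
    (λ { i d v refl g → cong g (sh-[] i d) }) P f [] refl)

  D : ℕ → Op
  D p = X p (ℤ.+ 1) ⊖ I

  pow : Op → ℕ → Op
  pow P zero    = I
  pow P (suc n) = pow P n ⊗ P

  substOp-pow : ∀ θ P n → substOp θ (pow P n) ≡ pow (substOp θ P) n
  substOp-pow θ P zero    = refl
  substOp-pow θ P (suc n) = cong (_⊗ substOp θ P) (substOp-pow θ P n)

  pow-⊗ : ∀ P Q n f v → ⟦ pow (P ⊗ Q) n ⟧ f v ≡ ⟦ pow P n ⟧ (⟦ pow Q n ⟧ f) v
  pow-⊗ P Q zero    f v = refl
  pow-⊗ P Q (suc n) f v = begin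
    ⟦ pow (P ⊗ Q) n ⟧ (⟦ P ⟧ (⟦ Q ⟧ f)) v      ≡⟨ pow-⊗ P Q n _ v ⟩
    ⟦ pow P n ⟧ (⟦ pow Q n ⟧ (⟦ P ⟧ (⟦ Q ⟧ f))) v  ≡⟨ ⟦⟧-cong (pow P n) (⟦⟧-comm (pow Q n) P _) v ⟩
    ⟦ pow P n ⟧ (⟦ P ⟧ (⟦ pow Q n ⟧ (⟦ Q ⟧ f))) v  ∎

  geomO : ℕ → Op → Op
  geomO zero    T = I
  geomO (suc n) T = I ⊖ (T ⊗ geomO n T)

  substOp-geomO : ∀ θ n T → substOp θ (geomO n T) ≡ geomO n (substOp θ T)
  substOp-geomO θ zero    T = refl
  substOp-geomO θ (suc n) T = cong (λ P → I ⊖ (substOp θ T ⊗ P)) (substOp-geomO θ n T)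

  -- The induction hypothesis is applied to `⟦ T ⟧ f`, which is killed by one power less. `pow` puts
  -- its new factor innermost, so that the hypothesis needed there is `z` itself.
  geomO-inverse : ∀ n T f → (∀ v → ⟦ pow T (suc n) ⟧ f v ≡ 0ℚ) →
                  ∀ v → ⟦ (I ⊕ T) ⊗ geomO n T ⟧ f v ≡ f v
  geomO-inverse zero    T f z v = trans (cong (f v +_) (z v)) (ℚₚ.+-identityʳ (f v))
  geomO-inverse (suc n) T f z v = begin
    (f v - Tg) + ⟦ T ⟧ (λ w → f w - ⟦ T ⟧ g w) v
      ≡⟨ cong ((f v - Tg) +_) (⟦⟧-sub T f _ v) ⟩
    (f v - Tg) + (⟦ T ⟧ f v - TTg)
      ≡⟨ cong (λ c → (f v - Tg) + (c - TTg)) ih ⟨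
    (f v - Tg) + ((Tg + TTg) - TTg)
      ≡⟨ solve 3 (λ a b c → (a :- b) :+ ((b :+ c) :- c) := a) refl (f v) Tg TTg ⟩
    f v ∎
    where
    g = ⟦ geomO n T ⟧ f
    Tg = ⟦ T ⟧ g v
    TTg = ⟦ T ⟧ (⟦ T ⟧ g) v
    ih : Tg + TTg ≡ ⟦ T ⟧ f v
    ih = trans (⟦⟧-cong (I ⊕ T) (⟦⟧-comm T (geomO n T) f) v)
               (geomO-inverse n T (⟦ T ⟧ f) z v)

  prodTo : ℕ → (ℕ → Op) → Op
  prodTo zero    g = I
  prodTo (suc m) g = g 0 ⊗ prodTo m (g ∘ suc)

  prodTo-cong≡ : ∀ m {g h} → g ≗ h → prodTo m g ≡ prodTo m h
  prodTo-cong≡ zero    e = refl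
  prodTo-cong≡ (suc m) e = cong₂ _⊗_ (e 0) (prodTo-cong≡ m (e ∘ suc))

  substOp-prodTo : ∀ θ m g → substOp θ (prodTo m g) ≡ prodTo m (substOp θ ∘ g)
  substOp-prodTo θ zero    g = refl
  substOp-prodTo θ (suc m) g = cong (substOp θ (g 0) ⊗_) (substOp-prodTo θ m (g ∘ suc))

  module Truncated (N : ℕ) where

    -- On V the truncated series geomO N (Q ⊗ D p) is the exact inverse of I ⊕ Q ⊗ D p.
    V : LFun → Set
    V f = ∀ p v → ⟦ pow (D p) (suc N) ⟧ f v ≡ 0ℚ

    V-closed : ∀ P {f} → V f → V (⟦ P ⟧ f)
    V-closed P {f} vf p v = trans (⟦⟧-comm (pow (D p) (suc N)) P f v) (⟦⟧-0 P (vf p) v)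

    V-∷ : ∀ {f} a → V f → V (f ∘ (a ∷_))
    V-∷ {f} a vf p v = begin
      ⟦ pow (D p) (suc N) ⟧ (f ∘ (a ∷_)) v         ≡⟨ ⟦lift⟧ (pow (D p) (suc N)) f a v ⟨
      ⟦ lift (pow (D p) (suc N)) ⟧ f (a ∷ v)       ≡⟨ cong (λ P → ⟦ P ⟧ f (a ∷ v)) (substOp-pow _ (D p) (suc N)) ⟩
      ⟦ pow (D (suc p)) (suc N) ⟧ f (a ∷ v)        ≡⟨ vf (suc p) (a ∷ v) ⟩
      0ℚ                                           ∎

    infix 4 _≈_
    -- Equality of operators as they act on `V`. It is a record so that `P` and `Q` can be recovered
    -- from the type, which the bare statement about `⟦_⟧` would not allow.
    record _≈_ (P Q : Op) : Set where
      constructor mk≈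
      field at : ∀ f → V f → ∀ v → ⟦ P ⟧ f v ≡ ⟦ Q ⟧ f v
    open _≈_ public

    ≈-refl : ∀ {P} → P ≈ P
    ≈-refl = mk≈ λ _ _ _ → refl

    ≈-sym : ∀ {P Q} → P ≈ Q → Q ≈ P
    ≈-sym e = mk≈ λ f vf v → sym (at e f vf v)

    ≈-trans : ∀ {P Q R} → P ≈ Q → Q ≈ R → P ≈ R
    ≈-trans e e′ = mk≈ λ f vf v → trans (at e f vf v) (at e′ f vf v)

    ≈-reflexive : ∀ {P Q} → P ≡ Q → P ≈ Q
    ≈-reflexive refl = ≈-refl

    ⊗-cong : ∀ {P P′ Q Q′} → P ≈ P′ → Q ≈ Q′ → P ⊗ Q ≈ P′ ⊗ Q′
    ⊗-cong {P} {P′} {Q} {Q′} e e′ = mk≈ λ f vf v →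
      trans (at e (⟦ Q ⟧ f) (V-closed Q vf) v) (⟦⟧-cong P′ (at e′ f vf) v)

    ⊗-comm : ∀ P Q → P ⊗ Q ≈ Q ⊗ P
    ⊗-comm P Q = mk≈ λ f _ → ⟦⟧-comm P Q f

    ⊗-commutativeMonoid : CommutativeMonoid _ _
    ⊗-commutativeMonoid = record
      { Carrier = Op ; _≈_ = _≈_ ; _∙_ = _⊗_ ; ε = I
      ; isCommutativeMonoid = record
        { isMonoid = record
          { isSemigroup = record
            { isMagma = record
              { isEquivalence = record { refl = ≈-refl ; sym = ≈-sym ; trans = ≈-trans }
              ; ∙-cong = ⊗-cong }
            ; assoc = λ _ _ _ → mk≈ λ _ _ _ → refl }
          ; identity = (λ _ → mk≈ λ _ _ _ → refl) , (λ _ → mk≈ λ _ _ _ → refl) }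
        ; comm = ⊗-comm } }

    lift-cong : ∀ {P Q} → P ≈ Q → lift P ≈ lift Q
    lift-cong {P} {Q} e = mk≈ λ
      { f vf []      → trans (⟦lift⟧-[] P f) (trans (at e f vf []) (sym (⟦lift⟧-[] Q f)))
      ; f vf (a ∷ v) → trans (⟦lift⟧ P f a v)
          (trans (at e (f ∘ (a ∷_)) (V-∷ {f} a vf) v) (sym (⟦lift⟧ Q f a v))) }

    prodTo-cong : ∀ m {g h} → (∀ i → i ℕ.< m → g i ≈ h i) → prodTo m g ≈ prodTo m h
    prodTo-cong zero    e = ≈-refl
    prodTo-cong (suc m) e = ⊗-cong (e 0 (ℕ.s≤s ℕ.z≤n)) (prodTo-cong m (λ i l → e (suc i) (ℕ.s≤s l)))

    -- As a power series this is X_p X_q / (X_p + X_q - 1), the part of the factor that is symmetric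
    -- in `p` and `q`.
    facʳ : ℕ → ℕ → Op
    facʳ p q = X p (ℤ.+ 1) ⊗ geomO N (X q -[1+ 0 ] ⊗ D p)

    fac : ℕ → ℕ → Op
    fac p q = geomO N (X q (ℤ.+ 1) ⊗ D p) ⊗ facʳ p q

    -- The factors with p = 0 among those of opP (suc m), the product over all p < q ≤ m.
    row : ℕ → Op
    row m = prodTo m (λ q → fac 0 (suc q))

    opP : ℕ → Op
    opP zero    = I
    opP (suc m) = row m ⊗ lift (opP m)

    rename-facʳ : ∀ π p q → rename π (facʳ p q) ≡ facʳ (π p) (π q)
    rename-facʳ π p q = cong (X (π p) (ℤ.+ 1) ⊗_) (substOp-geomO _ N _)

    rename-fac : ∀ π p q → rename π (fac p q) ≡ fac (π p) (π q)
    rename-fac π p q = cong₂ _⊗_ (substOp-geomO _ N _) (rename-facʳ π p q)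

-- Symmetries and specialisations of the product of all factors.

module OperatorProduct where

  open ShiftOperators
  open import Data.Rational using (ℚ; 0ℚ; 1ℚ; ½; _+_; _-_; _*_; -_)
  open +-*-Solver using (solve; _:+_; _:*_; _:-_; :-_; _:=_; con)

  substOp-cong : ∀ {θ θ′} → (∀ i d → θ i d ≡ θ′ i d) → ∀ P → substOp θ P ≡ substOp θ′ P
  substOp-cong e I       = refl
  substOp-cong e (X i d) = e i d
  substOp-cong e (P ⊕ Q) = cong₂ _⊕_ (substOp-cong e P) (substOp-cong e Q)
  substOp-cong e (P ⊖ Q) = cong₂ _⊖_ (substOp-cong e P) (substOp-cong e Q)
  substOp-cong e (P ⊗ Q) = cong₂ _⊗_ (substOp-cong e P) (substOp-cong e Q)

  substOp-∘ : ∀ θ θ′ P → substOp θ (substOp θ′ P) ≡ substOp (λ i d → substOp θ (θ′ i d)) P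
  substOp-∘ θ θ′ I       = refl
  substOp-∘ θ θ′ (X i d) = refl
  substOp-∘ θ θ′ (P ⊕ Q) = cong₂ _⊕_ (substOp-∘ θ θ′ P) (substOp-∘ θ θ′ Q)
  substOp-∘ θ θ′ (P ⊖ Q) = cong₂ _⊖_ (substOp-∘ θ θ′ P) (substOp-∘ θ θ′ Q)
  substOp-∘ θ θ′ (P ⊗ Q) = cong₂ _⊗_ (substOp-∘ θ θ′ P) (substOp-∘ θ θ′ Q)

  substOp-X : ∀ P → substOp X P ≡ P
  substOp-X I       = refl
  substOp-X (X i d) = refl
  substOp-X (P ⊕ Q) = cong₂ _⊕_ (substOp-X P) (substOp-X Q)
  substOp-X (P ⊖ Q) = cong₂ _⊖_ (substOp-X P) (substOp-X Q)
  substOp-X (P ⊗ Q) = cong₂ _⊗_ (substOp-X P) (substOp-X Q)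

  substOp-lift : ∀ {θ θ′} → (∀ i d → θ (suc i) d ≡ lift (θ′ i d)) →
                 ∀ P → substOp θ (lift P) ≡ lift (substOp θ′ P)
  substOp-lift {θ} {θ′} e P =
    trans (substOp-∘ _ _ P) (trans (substOp-cong e P) (sym (substOp-∘ _ θ′ P)))

  sh-inverse : ∀ i v → sh i -[1+ 0 ] (sh i (ℤ.+ 1) v) ≡ v
  sh-inverse zero    []      = refl
  sh-inverse (suc i) []      = refl
  sh-inverse zero    (a ∷ v) = cong (_∷ v) (trans (ℤₚ.+-assoc a (ℤ.+ 1) -[1+ 0 ]) (ℤₚ.+-identityʳ a))
  sh-inverse (suc i) (a ∷ v) = cong (a ∷_) (sh-inverse i v)

  sh-++ : ∀ pre a d v → sh (length pre) d (pre ++ a ∷ v) ≡ pre ++ a ℤ.+ d ∷ v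
  sh-++ []        a d v = refl
  sh-++ (b ∷ pre) a d v = cong (b ∷_) (sh-++ pre a d v)

  sh-suc-++ : ∀ pre a b d v → sh (suc (length pre)) d (pre ++ a ∷ b ∷ v) ≡ pre ++ a ∷ b ℤ.+ d ∷ v
  sh-suc-++ []        a b d v = refl
  sh-suc-++ (c ∷ pre) a b d v = cong (c ∷_) (sh-suc-++ pre a b d v)

  ≡-neg⇒≡0 : ∀ {a} → a ≡ - a → a ≡ 0ℚ
  ≡-neg⇒≡0 {a} e = begin
    a              ≡⟨ solve 1 (λ a → a := con ½ :* (a :+ a)) refl a ⟩
    ½ * (a + a)    ≡⟨ cong (λ b → ½ * (a + b)) e ⟩
    ½ * (a + - a)  ≡⟨ solve 1 (λ a → con ½ :* (a :+ :- a) := con 0ℚ) refl a ⟩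
    0ℚ             ∎
    where open ≡-Reasoning

  swapIx : ℕ → ℕ → ℕ
  swapIx zero    zero          = 1
  swapIx zero    (suc zero)    = 0
  swapIx zero    (suc (suc j)) = suc (suc j)
  swapIx (suc i) zero          = 0
  swapIx (suc i) (suc j)       = suc (swapIx i j)

  swapAt : ℕ → List ℤ → List ℤ
  swapAt zero    (a ∷ b ∷ v) = b ∷ a ∷ v
  swapAt (suc i) (a ∷ v)     = a ∷ swapAt i v
  swapAt _       v           = v

  swapAt-++ : ∀ pre a b v → swapAt (length pre) (pre ++ a ∷ b ∷ v) ≡ pre ++ b ∷ a ∷ v
  swapAt-++ []        a b v = refl
  swapAt-++ (c ∷ pre) a b v = cong (c ∷_) (swapAt-++ pre a b v)

  swapAt-sh : ∀ i j d v → suc i ℕ.< length v → swapAt i (sh j d v) ≡ sh (swapIx i j) d (swapAt i v)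
  swapAt-sh i       j             d []          ()
  swapAt-sh zero    j             d (a ∷ [])    (ℕ.s≤s ())
  swapAt-sh zero    zero          d (a ∷ b ∷ v) l = refl
  swapAt-sh zero    (suc zero)    d (a ∷ b ∷ v) l = refl
  swapAt-sh zero    (suc (suc j)) d (a ∷ b ∷ v) l = refl
  swapAt-sh (suc i) zero          d (a ∷ v)     l = refl
  swapAt-sh (suc i) (suc j)       d (a ∷ v)     (ℕ.s≤s l) = cong (a ∷_) (swapAt-sh i j d v l)

  del : ℕ → List ℤ → List ℤ
  del r       []      = []
  del zero    (a ∷ v) = v
  del (suc r) (a ∷ v) = a ∷ del r v

  -- On functions of del r v, the shift X r acts as the identity.
  delθ : ℕ → ℕ → ℤ → Op
  delθ zero    zero    d = I
  delθ zero    (suc i) d = X i d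
  delθ (suc r) zero    d = X 0 d
  delθ (suc r) (suc i) d = lift (delθ r i d)

  del-sh : ∀ r i d v g → g (del r (sh i d v)) ≡ ⟦ delθ r i d ⟧ g (del r v)
  del-sh zero    zero    d []      g = refl
  del-sh zero    (suc i) d []      g = cong g (sym (sh-[] i d))
  del-sh (suc r) zero    d []      g = refl
  del-sh (suc r) (suc i) d []      g = begin
    g (del (suc r) (sh (suc i) d []))  ≡⟨⟩
    g []                               ≡⟨ cong g (lemma r) ⟨
    g (del r [])                       ≡⟨ cong (g ∘ del r) (sh-[] i d) ⟨
    g (del r (sh i d []))              ≡⟨ del-sh r i d [] g ⟩
    ⟦ delθ r i d ⟧ g (del r [])        ≡⟨ cong (⟦ delθ r i d ⟧ g) (lemma r) ⟩
    ⟦ delθ r i d ⟧ g []                ≡⟨ ⟦lift⟧-[] (delθ r i d) g ⟨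
    ⟦ lift (delθ r i d) ⟧ g []         ∎
    where
    open ≡-Reasoning
    lemma : ∀ r → del r [] ≡ []
    lemma zero    = refl
    lemma (suc r) = refl
  del-sh zero    zero    d (a ∷ v) g = refl
  del-sh zero    (suc i) d (a ∷ v) g = refl
  del-sh (suc r) zero    d (a ∷ v) g = refl
  del-sh (suc r) (suc i) d (a ∷ v) g =
    trans (del-sh r i d v (g ∘ (a ∷_))) (sym (⟦lift⟧ (delθ r i d) g a (del r v)))

  delθ-same : ∀ r d → delθ r r d ≡ I
  delθ-same zero    d = refl
  delθ-same (suc r) d = cong lift (delθ-same r d)

  -- The increasing enumeration of the indices other than `r`.
  skip : ℕ → ℕ → ℕ
  skip zero    q       = suc q
  skip (suc r) zero    = zero
  skip (suc r) (suc q) = suc (skip r q)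

  delθ-skip : ∀ r q d → delθ r (skip r q) d ≡ X q d
  delθ-skip zero    q       d = refl
  delθ-skip (suc r) zero    d = refl
  delθ-skip (suc r) (suc q) d = cong lift (delθ-skip r q d)

  reflectAt : ℤ → ℕ → List ℤ → List ℤ
  reflectAt c i       []      = []
  reflectAt c zero    (a ∷ v) = c ℤ.- a ∷ v
  reflectAt c (suc i) (a ∷ v) = a ∷ reflectAt c i v

  reflθ : ℕ → ℕ → ℤ → Op
  reflθ zero    zero    d = X 0 (ℤ.- d)
  reflθ zero    (suc j) d = X (suc j) d
  reflθ (suc i) zero    d = X 0 d
  reflθ (suc i) (suc j) d = lift (reflθ i j d)

  reflectAt-[] : ∀ c i → reflectAt c i [] ≡ []
  reflectAt-[] c zero    = refl
  reflectAt-[] c (suc i) = refl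

  reflectAt-sh : ∀ c i j d v g → g (reflectAt c i (sh j d v)) ≡ ⟦ reflθ i j d ⟧ g (reflectAt c i v)
  reflectAt-sh c zero    zero    d []      g = refl
  reflectAt-sh c zero    (suc j) d []      g = refl
  reflectAt-sh c (suc i) zero    d []      g = refl
  reflectAt-sh c (suc i) (suc j) d []      g = begin
    g []                                    ≡⟨ cong g (reflectAt-[] c i) ⟨
    g (reflectAt c i [])                    ≡⟨ cong (g ∘ reflectAt c i) (sh-[] j d) ⟨
    g (reflectAt c i (sh j d []))           ≡⟨ reflectAt-sh c i j d [] g ⟩
    ⟦ reflθ i j d ⟧ g (reflectAt c i [])    ≡⟨ cong (⟦ reflθ i j d ⟧ g) (reflectAt-[] c i) ⟩
    ⟦ reflθ i j d ⟧ g []                    ≡⟨ ⟦lift⟧-[] (reflθ i j d) g ⟨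
    ⟦ lift (reflθ i j d) ⟧ g []             ∎
    where open ≡-Reasoning
  reflectAt-sh c zero    zero    d (a ∷ v) g = cong (λ b → g (b ∷ v)) (begin
    c ℤ.- (a ℤ.+ d)              ≡⟨ cong (λ e → c ℤ.+ e) (ℤₚ.neg-distrib-+ a d) ⟩
    c ℤ.+ (ℤ.- a ℤ.+ ℤ.- d)      ≡⟨ ℤₚ.+-assoc c (ℤ.- a) (ℤ.- d) ⟨
    c ℤ.- a ℤ.+ ℤ.- d            ∎)
    where open ≡-Reasoning
  reflectAt-sh c zero    (suc j) d (a ∷ v) g = refl
  reflectAt-sh c (suc i) zero    d (a ∷ v) g = refl
  reflectAt-sh c (suc i) (suc j) d (a ∷ v) g =
    trans (reflectAt-sh c i j d v (g ∘ (a ∷_))) (sym (⟦lift⟧ (reflθ i j d) g a (reflectAt c i v)))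

  -- The alternative is decided by the indices and not by `d`, so the two series of a factor, with
  -- opposite shifts, fall under the same case.
  reflθ-cases : ∀ i j → (∀ d → reflθ i j d ≡ X j d) ⊎ (∀ d → reflθ i j d ≡ X j (ℤ.- d))
  reflθ-cases zero    zero    = inj₂ λ _ → refl
  reflθ-cases zero    (suc j) = inj₁ λ _ → refl
  reflθ-cases (suc i) zero    = inj₁ λ _ → refl
  reflθ-cases (suc i) (suc j) with reflθ-cases i j
  ... | inj₁ e = inj₁ λ d → cong lift (e d)
  ... | inj₂ e = inj₂ λ d → cong lift (e d)

  mapSuc : List ℤ → List ℤ
  mapSuc = map (ℤ._+ ℤ.+ 1)

  sh-mapSuc : ∀ i d v → mapSuc (sh i d v) ≡ sh i d (mapSuc v)
  sh-mapSuc zero    d []      = refl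
  sh-mapSuc (suc i) d []      = refl
  sh-mapSuc zero    d (a ∷ v) = cong (_∷ mapSuc v) (begin
    a ℤ.+ d ℤ.+ ℤ.+ 1    ≡⟨ ℤₚ.+-assoc a d (ℤ.+ 1) ⟩
    a ℤ.+ (d ℤ.+ ℤ.+ 1)  ≡⟨ cong (λ c → a ℤ.+ c) (ℤₚ.+-comm d (ℤ.+ 1)) ⟩
    a ℤ.+ (ℤ.+ 1 ℤ.+ d)  ≡⟨ ℤₚ.+-assoc a (ℤ.+ 1) d ⟨
    a ℤ.+ ℤ.+ 1 ℤ.+ d    ∎)
    where open ≡-Reasoning
  sh-mapSuc (suc i) d (a ∷ v) = cong (a ℤ.+ ℤ.+ 1 ∷_) (sh-mapSuc i d v)

  ⟦⟧-mapSuc : ∀ P f v → ⟦ P ⟧ (f ∘ mapSuc) v ≡ ⟦ P ⟧ f (mapSuc v)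
  ⟦⟧-mapSuc P f v = trans
    (⟦⟧-subst {λ _ → ⊤} _ X mapSuc (λ i d w _ g → cong g (sh-mapSuc i d w)) P f v tt)
    (cong (λ Q → ⟦ Q ⟧ f (mapSuc v)) (substOp-X P))

  -- (id + E_{k_{i+1}} Δ_{k_i}) C vanishes on the diagonal k_i = k_{i+1}.
  Adjacent : ℕ → LFun → Set
  Adjacent n C = ∀ pre a v → length pre ℕ.+ suc (suc (length v)) ≡ n →
    (C (pre ++ a ∷ a ∷ v) - C (pre ++ a ∷ a ℤ.+ ℤ.+ 1 ∷ v))
      + C (pre ++ a ℤ.+ ℤ.+ 1 ∷ a ℤ.+ ℤ.+ 1 ∷ v) ≡ 0ℚ

  Antisymmetric : ℕ → LFun → Set
  Antisymmetric n f = ∀ i v → length v ≡ n → suc i ℕ.< n → f (swapAt i v) ≡ - f v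

  -- ∏_{p<r} X_p⁻¹
  shiftBack : ℕ → Op
  shiftBack zero    = I
  shiftBack (suc r) = X 0 -[1+ 0 ] ⊗ lift (shiftBack r)

  module Products (N : ℕ) where
    open Truncated N
    open CommutativeMonoid ⊗-commutativeMonoid using () renaming (setoid to ≈-setoid)
    module ≈-Reasoning = SetoidReasoning ≈-setoid

    ⊗-congˡ : ∀ P {Q Q′} → Q ≈ Q′ → P ⊗ Q ≈ P ⊗ Q′
    ⊗-congˡ P = ⊗-cong {P} ≈-refl

    ⊗-congʳ : ∀ Q {P P′} → P ≈ P′ → P ⊗ Q ≈ P′ ⊗ Q
    ⊗-congʳ Q e = ⊗-cong {Q = Q} e ≈-refl

    ⊗-exchange : ∀ P Q R → P ⊗ (Q ⊗ R) ≈ Q ⊗ (P ⊗ R)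
    ⊗-exchange P Q R = mk≈ λ f _ → ⟦⟧-comm P Q (⟦ R ⟧ f)

    I⊗ : ∀ {P Q} → P ≈ I → Q ≈ I → P ⊗ Q ≈ I
    I⊗ e e′ = ≈-trans (⊗-cong e e′) (mk≈ λ _ _ _ → refl)

    ⊗-assoc : ∀ P Q R → (P ⊗ Q) ⊗ R ≈ P ⊗ (Q ⊗ R)
    ⊗-assoc P Q R = mk≈ λ _ _ _ → refl

    -- Operators commute, so a power of `Q ⊗ D p` contains the same power of `D p`; the series
    -- terminates on `V` whatever `Q` is.
    geomO-unit : ∀ Q p → (I ⊕ (Q ⊗ D p)) ⊗ geomO N (Q ⊗ D p) ≈ I
    geomO-unit Q p = mk≈ λ f vf v → geomO-inverse N (Q ⊗ D p) f
      (λ w → trans (pow-⊗ Q (D p) (suc N) f w) (⟦⟧-0 (pow Q (suc N)) (vf p) w)) v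

    -- Multiplying `I ⊕ T` by X_q clears the X_q⁻¹ in `T` and leaves X_p + X_q - 1.
    facʳ-defining : ∀ p q → (X p (ℤ.+ 1) ⊕ (X q (ℤ.+ 1) ⊖ I)) ⊗ facʳ p q ≈ X p (ℤ.+ 1) ⊗ X q (ℤ.+ 1)
    facʳ-defining p q = begin
      (X p (ℤ.+ 1) ⊕ (X q (ℤ.+ 1) ⊖ I)) ⊗ facʳ p q
        ≈⟨ ⊗-congʳ (facʳ p q) step ⟩
      (X q (ℤ.+ 1) ⊗ (I ⊕ T)) ⊗ (X p (ℤ.+ 1) ⊗ geomO N T)
        ≈⟨ ⊗-assoc (X q (ℤ.+ 1)) (I ⊕ T) _ ⟩
      X q (ℤ.+ 1) ⊗ ((I ⊕ T) ⊗ (X p (ℤ.+ 1) ⊗ geomO N T))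
        ≈⟨ ⊗-congˡ (X q (ℤ.+ 1)) (⊗-exchange (I ⊕ T) (X p (ℤ.+ 1)) (geomO N T)) ⟩
      X q (ℤ.+ 1) ⊗ (X p (ℤ.+ 1) ⊗ ((I ⊕ T) ⊗ geomO N T))
        ≈⟨ ⊗-congˡ (X q (ℤ.+ 1)) (⊗-congˡ (X p (ℤ.+ 1)) (geomO-unit (X q -[1+ 0 ]) p)) ⟩
      X q (ℤ.+ 1) ⊗ X p (ℤ.+ 1) ⊗ I
        ≈⟨ mk≈ (λ _ _ _ → refl) ⟩
      X q (ℤ.+ 1) ⊗ X p (ℤ.+ 1)
        ≈⟨ ⊗-comm (X q (ℤ.+ 1)) (X p (ℤ.+ 1)) ⟩
      X p (ℤ.+ 1) ⊗ X q (ℤ.+ 1) ∎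
      where
      open ≈-Reasoning
      T = X q -[1+ 0 ] ⊗ D p
      step : X p (ℤ.+ 1) ⊕ (X q (ℤ.+ 1) ⊖ I) ≈ X q (ℤ.+ 1) ⊗ (I ⊕ T)
      step = mk≈ λ f _ v → trans
        (solve 3 (λ a b c → a :+ (b :- c) := b :+ (a :- c)) refl
           (f (sh p (ℤ.+ 1) v)) (f (sh q (ℤ.+ 1) v)) (f v))
        (cong (λ w → f (sh q (ℤ.+ 1) v) + (f (sh p (ℤ.+ 1) w) - f w)) (sym (sh-inverse q v)))

    X-cancel : ∀ p {P Q} → X p (ℤ.+ 1) ⊗ P ≈ X p (ℤ.+ 1) ⊗ Q → P ≈ Q
    X-cancel p {P} {Q} e = begin
      P                                    ≈⟨ inverse P ⟩
      X p (ℤ.+ 1) ⊗ X p -[1+ 0 ] ⊗ P       ≈⟨ ⊗-exchange (X p (ℤ.+ 1)) (X p -[1+ 0 ]) P ⟩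
      X p -[1+ 0 ] ⊗ X p (ℤ.+ 1) ⊗ P       ≈⟨ ⊗-congˡ (X p -[1+ 0 ]) e ⟩
      X p -[1+ 0 ] ⊗ X p (ℤ.+ 1) ⊗ Q       ≈⟨ ⊗-exchange (X p -[1+ 0 ]) (X p (ℤ.+ 1)) Q ⟩
      X p (ℤ.+ 1) ⊗ X p -[1+ 0 ] ⊗ Q       ≈⟨ inverse Q ⟨
      Q                                    ∎
      where
      open ≈-Reasoning
      inverse : ∀ R → R ≈ X p (ℤ.+ 1) ⊗ X p -[1+ 0 ] ⊗ R
      inverse R = mk≈ λ f _ v → cong (⟦ R ⟧ f) (sym (sh-inverse p v))

    -- Both sides are the inverse of X_p + X_q − 1, up to the factor X_p X_q.
    facʳ-sym : ∀ p q → facʳ p q ≈ facʳ q p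
    facʳ-sym p q = X-cancel q (X-cancel p (begin
      X p (ℤ.+ 1) ⊗ X q (ℤ.+ 1) ⊗ facʳ p q   ≈⟨ ⊗-exchange (X p (ℤ.+ 1)) (X q (ℤ.+ 1)) (facʳ p q) ⟩
      X q (ℤ.+ 1) ⊗ X p (ℤ.+ 1) ⊗ facʳ p q   ≈⟨ ⊗-assoc (X q (ℤ.+ 1)) (X p (ℤ.+ 1)) (facʳ p q) ⟨
      (X q (ℤ.+ 1) ⊗ X p (ℤ.+ 1)) ⊗ facʳ p q ≈⟨ ⊗-congʳ (facʳ p q) (facʳ-defining q p) ⟨
      (Z q p ⊗ facʳ q p) ⊗ facʳ p q          ≈⟨ ⊗-assoc (Z q p) (facʳ q p) (facʳ p q) ⟩
      Z q p ⊗ facʳ q p ⊗ facʳ p q            ≈⟨ ⊗-cong Z-sym (⊗-comm (facʳ q p) (facʳ p q)) ⟩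
      Z p q ⊗ facʳ p q ⊗ facʳ q p            ≈⟨ ⊗-assoc (Z p q) (facʳ p q) (facʳ q p) ⟨
      (Z p q ⊗ facʳ p q) ⊗ facʳ q p          ≈⟨ ⊗-congʳ (facʳ q p) (facʳ-defining p q) ⟩
      (X p (ℤ.+ 1) ⊗ X q (ℤ.+ 1)) ⊗ facʳ q p ≈⟨ ⊗-assoc (X p (ℤ.+ 1)) (X q (ℤ.+ 1)) (facʳ q p) ⟩
      X p (ℤ.+ 1) ⊗ X q (ℤ.+ 1) ⊗ facʳ q p   ∎))
      where
      open ≈-Reasoning
      Z : ℕ → ℕ → Op
      Z p q = X p (ℤ.+ 1) ⊕ (X q (ℤ.+ 1) ⊖ I)
      Z-sym : Z q p ≈ Z p q
      Z-sym = mk≈ λ f _ v → solve 3 (λ a b c → a :+ (b :- c) := b :+ (a :- c)) refl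
        (f (sh q (ℤ.+ 1) v)) (f (sh p (ℤ.+ 1) v)) (f v)

    prodTo-swap : ∀ m i g → suc i ℕ.< m → prodTo m (g ∘ swapIx i) ≈ prodTo m g
    prodTo-swap (suc (suc m)) zero    g l = ⊗-exchange (g 1) (g 0) _
    prodTo-swap (suc m)       (suc i) g (ℕ.s≤s l) = ⊗-congˡ (g 0) (prodTo-swap m i (g ∘ suc) l)
    prodTo-swap (suc zero)    zero    g (ℕ.s≤s ())

    -- Transposing `i` and `i + 1` exchanges the factors (p , i) and (p , i + 1) for p < i, and (i ,
    -- q) and (i + 1 , q) for q > i + 1. Only the pair (i , i + 1) would have its order reversed;
    -- since `fac` is not symmetric, that factor is split off.
    opP-adjacent : ∀ m i → suc i ℕ.< m →
      Σ Op λ R → (opP m ≈ fac i (suc i) ⊗ R) × (rename (swapIx i) R ≈ R)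
    opP-adjacent (suc zero)    zero    (ℕ.s≤s ())
    opP-adjacent (suc (suc m)) zero    l =
      A ⊗ (lift (row m) ⊗ C) , mk≈ (λ _ _ _ → refl) , (begin
      rename (swapIx 0) A ⊗ rename (swapIx 0) (lift (row m)) ⊗ rename (swapIx 0) C
        ≈⟨ ≈-reflexive (cong₂ _⊗_ A-swap (cong₂ _⊗_ (trans (cong (rename (swapIx 0)) B-explicit) B-swap) C-swap)) ⟩
      B ⊗ A ⊗ C
        ≈⟨ ⊗-exchange B A C ⟩
      A ⊗ B ⊗ C
        ≈⟨ ⊗-congˡ A (⊗-congʳ C (≈-reflexive B-explicit)) ⟨
      A ⊗ lift (row m) ⊗ C ∎)
      where
      open ≈-Reasoning
      A B C : Op
      A = prodTo m (λ q → fac 0 (suc (suc q)))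
      B = prodTo m (λ q → fac 1 (suc (suc q)))
      C = lift (lift (opP m))
      B-explicit : lift (row m) ≡ B
      B-explicit = trans (substOp-prodTo _ m _) (prodTo-cong≡ m (λ q → rename-fac suc 0 (suc q)))
      A-swap : rename (swapIx 0) A ≡ B
      A-swap = trans (substOp-prodTo _ m _) (prodTo-cong≡ m (λ q → rename-fac (swapIx 0) 0 (suc (suc q))))
      B-swap : rename (swapIx 0) B ≡ A
      B-swap = trans (substOp-prodTo _ m _) (prodTo-cong≡ m (λ q → rename-fac (swapIx 0) 1 (suc (suc q))))
      C-swap : rename (swapIx 0) C ≡ C
      C-swap = trans (substOp-∘ _ _ (lift (opP m))) (trans (substOp-∘ _ _ (opP m)) (sym (substOp-∘ _ _ (opP m))))
    opP-adjacent (suc m) (suc i) (ℕ.s≤s l) with opP-adjacent m i l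
    ... | R , split , invariant = row m ⊗ lift R , (begin
        row m ⊗ lift (opP m)                      ≈⟨ ⊗-congˡ (row m) (lift-cong split) ⟩
        row m ⊗ lift (fac i (suc i)) ⊗ lift R     ≈⟨ ⊗-exchange (row m) (lift (fac i (suc i))) (lift R) ⟩
        lift (fac i (suc i)) ⊗ row m ⊗ lift R     ≈⟨ ⊗-congʳ (row m ⊗ lift R) (≈-reflexive (rename-fac suc i (suc i))) ⟩
        fac (suc i) (suc (suc i)) ⊗ row m ⊗ lift R ∎)
      , ⊗-cong
          (≈-trans (≈-reflexive (trans (substOp-prodTo _ m _)
                     (prodTo-cong≡ m (λ q → rename-fac (swapIx (suc i)) 0 (suc q)))))
                   (prodTo-swap m i (λ q → fac 0 (suc q)) l))
          (≈-trans (≈-reflexive (substOp-lift (λ _ _ → refl) R)) (lift-cong invariant))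
      where open ≈-Reasoning

    opP-Adjacent : ∀ n f → V f → Antisymmetric n f → Adjacent n (⟦ opP n ⟧ f)
    opP-Adjacent n f vf anti pre a v len = begin
      (A w - A (pre ++ a ∷ a ℤ.+ ℤ.+ 1 ∷ v)) + A (pre ++ a ℤ.+ ℤ.+ 1 ∷ a ℤ.+ ℤ.+ 1 ∷ v)
        ≡⟨ cong₂ (λ x y → (A w - A x) + A y) (sym (sh-suc-++ pre a a (ℤ.+ 1) v)) (sym both) ⟩
      (A w - A (sh (suc i) (ℤ.+ 1) w)) + A (sh i (ℤ.+ 1) (sh (suc i) (ℤ.+ 1) w))
        ≡⟨ solve 3 (λ a b c → (a :- b) :+ c := a :+ (c :- b)) refl (A w) _ _ ⟩
      ⟦ (I ⊕ T) ⊗ opP n ⟧ f w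
        ≡⟨ at to-Q f vf w ⟩
      ⟦ Q ⟧ f w
        -- The exchange of the two equal entries fixes `w`, so the value there of an antisymmetric
        -- function equals its own negative.
        ≡⟨ ≡-neg⇒≡0 Q-odd ⟩
      0ℚ ∎
      where
      open ≡-Reasoning
      i = length pre
      w = pre ++ a ∷ a ∷ v
      A = ⟦ opP n ⟧ f
      T = X (suc i) (ℤ.+ 1) ⊗ D i
      i<n : suc i ℕ.< n
      i<n = subst (suc (suc i) ℕ.≤_)
        (trans (sym (ℕₚ.+-suc (suc i) (length v)))
          (trans (sym (ℕₚ.+-suc i (suc (length v)))) len))
        (ℕ.s≤s (ℕ.s≤s (ℕₚ.m≤m+n i (length v))))
      R = proj₁ (opP-adjacent n i i<n)
      split = proj₁ (proj₂ (opP-adjacent n i i<n))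
      invariant = proj₂ (proj₂ (opP-adjacent n i i<n))
      Q = facʳ i (suc i) ⊗ R
      length-w : length w ≡ n
      length-w = trans (length-++ pre) len
        where open import Data.List.Properties using (length-++)
      both : sh i (ℤ.+ 1) (sh (suc i) (ℤ.+ 1) w) ≡ pre ++ a ℤ.+ ℤ.+ 1 ∷ a ℤ.+ ℤ.+ 1 ∷ v
      both = trans (cong (sh i (ℤ.+ 1)) (sh-suc-++ pre a a (ℤ.+ 1) v)) (sh-++ pre a (ℤ.+ 1) _)
      to-Q : (I ⊕ T) ⊗ opP n ≈ Q
      to-Q = ≈-trans (⊗-congˡ (I ⊕ T) split)
        (mk≈ λ g vg → at (geomO-unit (X (suc i) (ℤ.+ 1)) i) (⟦ Q ⟧ g) (V-closed Q vg))
      Q-invariant : rename (swapIx i) Q ≈ Q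
      Q-invariant = ⊗-cong
        (≈-trans (≈-reflexive (trans (rename-facʳ (swapIx i) i (suc i)) (cong₂ facʳ (ix i) (ix′ i))))
                 (facʳ-sym (suc i) i))
        invariant
        where
        ix : ∀ i → swapIx i i ≡ suc i
        ix zero    = refl
        ix (suc i) = cong suc (ix i)
        ix′ : ∀ i → swapIx i (suc i) ≡ i
        ix′ zero    = refl
        ix′ (suc i) = cong suc (ix′ i)
      Q-odd : ⟦ Q ⟧ f w ≡ - ⟦ Q ⟧ f w
      Q-odd = begin
        ⟦ Q ⟧ f w                                     ≡⟨ at Q-invariant f vf w ⟨
        ⟦ rename (swapIx i) Q ⟧ f w                   ≡⟨ cong (⟦ rename (swapIx i) Q ⟧ f) (swapAt-++ pre a a v) ⟨
        -- On lists too short for the exchange `swapAt i` does nothing and the shifts are not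
        -- permuted; hence the restriction to lists of length `n`.
        ⟦ rename (swapIx i) Q ⟧ f (swapAt i w)        ≡⟨ ⟦⟧-subst (OfLength-closed n) (λ j → X (swapIx i j)) (swapAt i)
             (λ j d u l g → cong g (swapAt-sh i j d u (subst (suc i ℕ.<_) (sym l) i<n))) Q f w length-w ⟨
        ⟦ Q ⟧ (f ∘ swapAt i) w                        ≡⟨ ⟦⟧-cong-length Q (λ u l → anti i u l i<n) w length-w ⟩
        ⟦ Q ⟧ (λ u → - f u) w                         ≡⟨ ⟦⟧-neg Q f w ⟩
        - ⟦ Q ⟧ f w                                   ∎

    geomO-zero : ∀ n T → (∀ f v → ⟦ T ⟧ f v ≡ 0ℚ) → geomO n T ≈ I
    geomO-zero zero    T z = ≈-refl
    geomO-zero (suc n) T z = mk≈ λ f _ v → trans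
      (cong (λ a → f v - a) (z (⟦ geomO n T ⟧ f) v))
      (solve 1 (λ a → a :- con 0ℚ := a) refl (f v))

    prodTo-I : ∀ m g → (∀ i → g i ≈ I) → prodTo m g ≈ I
    prodTo-I zero    g e = ≈-refl
    prodTo-I (suc m) g e = I⊗ (e 0) (prodTo-I m (g ∘ suc) (e ∘ suc))

    prodTo-extract : ∀ m r g → r ℕ.≤ m → prodTo (suc m) g ≈ g r ⊗ prodTo m (g ∘ skip r)
    prodTo-extract m       zero    g l = ≈-refl
    prodTo-extract (suc m) (suc r) g (ℕ.s≤s l) = ≈-trans
      (⊗-congˡ (g 0) (prodTo-extract m r (g ∘ suc) l))
      (⊗-exchange (g 0) (g (suc r)) _)

    -- Setting X_r = 1 turns each factor (p , r) into X_p⁻¹ and each factor (r , q) into I.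
    opP-del : ∀ m r → r ℕ.≤ m → substOp (delθ r) (opP (suc m)) ≈ shiftBack r ⊗ opP m
    opP-del m zero l = ⊗-cong
      (≈-trans (≈-reflexive (substOp-prodTo (delθ 0) m _)) (prodTo-I m _ trivial))
      (≈-reflexive (trans (substOp-∘ _ _ (opP m)) (substOp-X (opP m))))
      where
      -- With `X 0` replaced by `I` the difference `D 0` becomes `I ⊖ I`, and both series of each
      -- factor (0 , q) reduce to their constant term.
      zero-op : ∀ Q f v → ⟦ Q ⊗ (I ⊖ I) ⟧ f v ≡ 0ℚ
      zero-op Q f v = ⟦⟧-0 Q (λ w → ℚₚ.+-inverseʳ (f w)) v
      trivial : ∀ q → substOp (delθ 0) (fac 0 (suc q)) ≈ I
      trivial q = I⊗
        (≈-trans (≈-reflexive (substOp-geomO _ N _)) (geomO-zero N _ (zero-op (X q (ℤ.+ 1)))))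
        (I⊗ ≈-refl (≈-trans (≈-reflexive (substOp-geomO _ N _)) (geomO-zero N _ (zero-op (X q -[1+ 0 ])))))
    opP-del (suc m) (suc r) (ℕ.s≤s l) = begin
      substOp θ (row (suc m)) ⊗ substOp θ (lift (opP (suc m)))
        ≈⟨ ⊗-cong row-part lift-part ⟩
      (X 0 -[1+ 0 ] ⊗ row m) ⊗ (lift (shiftBack r) ⊗ lift (opP m))
        ≈⟨ ⊗-assoc (X 0 -[1+ 0 ]) (row m) _ ⟩
      X 0 -[1+ 0 ] ⊗ (row m ⊗ (lift (shiftBack r) ⊗ lift (opP m)))
        ≈⟨ ⊗-congˡ (X 0 -[1+ 0 ]) (⊗-exchange (row m) (lift (shiftBack r)) (lift (opP m))) ⟩
      X 0 -[1+ 0 ] ⊗ (lift (shiftBack r) ⊗ (row m ⊗ lift (opP m)))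
        ≈⟨ ⊗-assoc (X 0 -[1+ 0 ]) (lift (shiftBack r)) _ ⟨
      shiftBack (suc r) ⊗ opP (suc m) ∎
      where
      open ≈-Reasoning
      θ = delθ (suc r)
      -- With X_r = 1 both series of the factor become the inverse of 1 + (X_0 - 1), that is X_0⁻¹;
      -- the factor is then X_0⁻¹ X_0 X_0⁻¹.
      G = geomO N (I ⊗ D 0)
      X⊗G : X 0 (ℤ.+ 1) ⊗ G ≈ I
      X⊗G = ≈-trans (⊗-congʳ G (mk≈ λ f _ v →
        solve 2 (λ a b → a := b :+ (a :- b)) refl (f (sh 0 (ℤ.+ 1) v)) (f v))) (geomO-unit I 0)
      G≈ : G ≈ X 0 -[1+ 0 ]
      G≈ = X-cancel 0 (≈-trans X⊗G (mk≈ λ f _ v → cong f (sym (sh-inverse 0 v))))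
      fac-same : substOp θ (fac 0 (suc r)) ≡ G ⊗ X 0 (ℤ.+ 1) ⊗ G
      fac-same = cong₂ (λ P Q → P ⊗ X 0 (ℤ.+ 1) ⊗ Q)
        (trans (substOp-geomO θ N _) (cong (λ P → geomO N (P ⊗ D 0)) (cong lift (delθ-same r (ℤ.+ 1)))))
        (trans (substOp-geomO θ N _) (cong (λ P → geomO N (P ⊗ D 0)) (cong lift (delθ-same r -[1+ 0 ]))))
      fac-skip : ∀ q → substOp θ (fac 0 (suc (skip r q))) ≡ fac 0 (suc q)
      fac-skip q = cong₂ (λ P Q → P ⊗ X 0 (ℤ.+ 1) ⊗ Q)
        (trans (substOp-geomO θ N _) (cong (λ P → geomO N (P ⊗ D 0)) (cong lift (delθ-skip r q (ℤ.+ 1)))))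
        (trans (substOp-geomO θ N _) (cong (λ P → geomO N (P ⊗ D 0)) (cong lift (delθ-skip r q -[1+ 0 ]))))
      row-part : substOp θ (row (suc m)) ≈ X 0 -[1+ 0 ] ⊗ row m
      row-part = begin
        substOp θ (row (suc m))
          ≈⟨ ≈-reflexive (substOp-prodTo θ (suc m) (λ q → fac 0 (suc q))) ⟩
        prodTo (suc m) (λ q → substOp θ (fac 0 (suc q)))
          ≈⟨ prodTo-extract m r (λ q → substOp θ (fac 0 (suc q))) l ⟩
        substOp θ (fac 0 (suc r)) ⊗ prodTo m (λ q → substOp θ (fac 0 (suc (skip r q))))
          ≈⟨ ≈-reflexive (cong₂ _⊗_ fac-same (prodTo-cong≡ m fac-skip)) ⟩
        (G ⊗ X 0 (ℤ.+ 1) ⊗ G) ⊗ row m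
          ≈⟨ ⊗-congʳ (row m) (≈-trans (⊗-cong G≈ X⊗G) (mk≈ λ _ _ _ → refl)) ⟩
        X 0 -[1+ 0 ] ⊗ row m ∎
      lift-part : substOp θ (lift (opP (suc m))) ≈ lift (shiftBack r) ⊗ lift (opP m)
      lift-part = ≈-trans (≈-reflexive (substOp-lift (λ _ _ → refl) (opP (suc m))))
                          (lift-cong (opP-del m r l))

    -- X_m ↦ X_m⁻¹ exchanges the two series in each factor (p , m).
    opP-reflect : ∀ m → substOp (reflθ m) (opP (suc m)) ≈ opP (suc m)
    opP-reflect zero    = ≈-refl
    opP-reflect (suc m) = ⊗-cong
      (≈-trans (≈-reflexive (substOp-prodTo θ (suc m) (λ q → fac 0 (suc q)))) (prodTo-cong (suc m) (λ q _ → factor-reflect q)))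
      (≈-trans (≈-reflexive (substOp-lift (λ _ _ → refl) (opP (suc m)))) (lift-cong (opP-reflect m)))
      where
      θ = reflθ (suc m)
      G : Op → Op
      G P = geomO N (P ⊗ D 0)
      expand : ∀ q → substOp θ (fac 0 (suc q)) ≡
                     G (lift (reflθ m q (ℤ.+ 1))) ⊗ X 0 (ℤ.+ 1) ⊗ G (lift (reflθ m q -[1+ 0 ]))
      expand q = cong₂ (λ P Q → P ⊗ X 0 (ℤ.+ 1) ⊗ Q) (substOp-geomO θ N _) (substOp-geomO θ N _)
      factor-reflect : ∀ q → substOp θ (fac 0 (suc q)) ≈ fac 0 (suc q)
      factor-reflect q with reflθ-cases m q
      ... | inj₁ e = ≈-reflexive (trans (expand q)
        (cong₂ (λ P Q → G (lift P) ⊗ X 0 (ℤ.+ 1) ⊗ G (lift Q)) (e (ℤ.+ 1)) (e -[1+ 0 ])))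
      ... | inj₂ e = begin
        substOp θ (fac 0 (suc q))
          ≈⟨ ≈-reflexive (trans (expand q)
               (cong₂ (λ P Q → G (lift P) ⊗ X 0 (ℤ.+ 1) ⊗ G (lift Q)) (e (ℤ.+ 1)) (e -[1+ 0 ]))) ⟩
        G⁻ ⊗ X 0 (ℤ.+ 1) ⊗ G⁺
          ≈⟨ ⊗-exchange G⁻ (X 0 (ℤ.+ 1)) G⁺ ⟩
        X 0 (ℤ.+ 1) ⊗ G⁻ ⊗ G⁺
          ≈⟨ ⊗-congˡ (X 0 (ℤ.+ 1)) (⊗-comm G⁻ G⁺) ⟩
        X 0 (ℤ.+ 1) ⊗ G⁺ ⊗ G⁻
          ≈⟨ ⊗-exchange (X 0 (ℤ.+ 1)) G⁺ G⁻ ⟩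
        fac 0 (suc q) ∎
        where
        open ≈-Reasoning
        G⁺ = G (X (suc q) (ℤ.+ 1))
        G⁻ = G (X (suc q) -[1+ 0 ])

-- Determinants as iterated exterior products of one-variable functions.

module Determinants where

  open ShiftOperators
  open OperatorProduct
  open import Data.Rational using (ℚ; 0ℚ; 1ℚ; _+_; _-_; _*_; -_)
  open +-*-Solver using (solve; _:+_; _:*_; _:-_; :-_; _:=_; con)
  open ≡-Reasoning

  *-0-sub-0 : ∀ {a b c} → a ≡ 0ℚ → c ≡ 0ℚ → a * b - c ≡ 0ℚ
  *-0-sub-0 {b = b} refl refl = solve 1 (λ b → con 0ℚ :* b :- con 0ℚ := con 0ℚ) refl b

  *-sub-0 : ∀ a {b c} → b ≡ 0ℚ → c ≡ 0ℚ → a * b - c ≡ 0ℚ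
  *-sub-0 a refl refl = solve 1 (λ b → b :* con 0ℚ :- con 0ℚ := con 0ℚ) refl a

  -- The exterior product of the one-variable function φ with G, both seen as (alternating)
  -- functions of the entries.
  wedge : (ℤ → ℚ) → LFun → LFun
  wedge φ G []      = 0ℚ
  wedge φ G (a ∷ v) = φ a * G v - wedge φ (G ∘ (a ∷_)) v

  -- The empty exterior product. Its vanishing on nonempty lists makes `det m φ` vanish on every
  -- list whose length is not `m`.
  unit : LFun
  unit []      = 1ℚ
  unit (_ ∷ _) = 0ℚ

  det : ℕ → (ℕ → ℤ → ℚ) → LFun
  det zero    φ = unit
  det (suc m) φ = wedge (φ 0) (det m (φ ∘ suc))

  wedge-cong : ∀ {φ ψ} → φ ≗ ψ → ∀ {G H} → G ≗ H → wedge φ G ≗ wedge ψ H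
  wedge-cong e e′ []      = refl
  wedge-cong e e′ (a ∷ v) = cong₂ _-_ (cong₂ _*_ (e a) (e′ v)) (wedge-cong e (e′ ∘ (a ∷_)) v)

  wedge-congʳ : ∀ φ {G H} → G ≗ H → wedge φ G ≗ wedge φ H
  wedge-congʳ φ = wedge-cong λ _ → refl

  det-cong : ∀ m {φ ψ} → (∀ j → φ j ≗ ψ j) → det m φ ≗ det m ψ
  det-cong zero    e v = refl
  det-cong (suc m) e v = wedge-cong (e 0) (det-cong m (e ∘ suc)) v

  wedge-0 : ∀ φ {G} → (∀ v → G v ≡ 0ℚ) → ∀ v → wedge φ G v ≡ 0ℚ
  wedge-0 φ z []      = refl
  wedge-0 φ z (a ∷ v) = *-sub-0 (φ a) (z v) (wedge-0 φ (z ∘ (a ∷_)) v)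

  wedge-+ : ∀ φ G H v → wedge φ (λ w → G w + H w) v ≡ wedge φ G v + wedge φ H v
  wedge-+ φ G H []      = refl
  wedge-+ φ G H (a ∷ v) = trans (cong (λ x → φ a * (G v + H v) - x) (wedge-+ φ _ _ v))
    (solve 5 (λ p g h x y → p :* (g :+ h) :- (x :+ y) := (p :* g :- x) :+ (p :* h :- y)) refl
      (φ a) (G v) (H v) (wedge φ (G ∘ (a ∷_)) v) (wedge φ (H ∘ (a ∷_)) v))

  wedge-* : ∀ φ c G v → wedge φ (λ w → c * G w) v ≡ c * wedge φ G v
  wedge-* φ c G []      = sym (ℚₚ.*-zeroʳ c)
  wedge-* φ c G (a ∷ v) = trans (cong (λ x → φ a * (c * G v) - x) (wedge-* φ c _ v))
    (solve 4 (λ p c g x → p :* (c :* g) :- c :* x := c :* (p :* g :- x)) refl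
      (φ a) c (G v) (wedge φ (G ∘ (a ∷_)) v))

  wedge-neg : ∀ φ G v → wedge φ (λ w → - G w) v ≡ - wedge φ G v
  wedge-neg φ G []      = refl
  wedge-neg φ G (a ∷ v) = trans (cong (λ x → φ a * (- G v) - x) (wedge-neg φ _ v))
    (solve 3 (λ p g x → p :* (:- g) :- (:- x) := :- (p :* g :- x)) refl
      (φ a) (G v) (wedge φ (G ∘ (a ∷_)) v))

  wedge-sub : ∀ φ G H v → wedge φ (λ w → G w - H w) v ≡ wedge φ G v - wedge φ H v
  wedge-sub φ G H v = trans (wedge-+ φ G (λ w → - H w) v) (cong (wedge φ G v +_) (wedge-neg φ H v))

  wedge-linearˡ : ∀ φ c ψ G v →
                  wedge (λ a → φ a + c * ψ a) G v ≡ wedge φ G v + c * wedge ψ G v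
  wedge-linearˡ φ c ψ G []      = solve 1 (λ c → con 0ℚ := con 0ℚ :+ c :* con 0ℚ) refl c
  wedge-linearˡ φ c ψ G (a ∷ v) =
    trans (cong (λ x → (φ a + c * ψ a) * G v - x) (wedge-linearˡ φ c ψ (G ∘ (a ∷_)) v))
    (solve 6 (λ p c q g x y → (p :+ c :* q) :* g :- (x :+ c :* y) :=
                              (p :* g :- x) :+ c :* (q :* g :- y)) refl
      (φ a) c (ψ a) (G v) (wedge φ (G ∘ (a ∷_)) v) (wedge ψ (G ∘ (a ∷_)) v))

  wedge-*ˡ : ∀ c φ G v → wedge (λ a → c * φ a) G v ≡ c * wedge φ G v
  wedge-*ˡ c φ G []      = sym (ℚₚ.*-zeroʳ c)
  wedge-*ˡ c φ G (a ∷ v) = trans (cong (λ x → (c * φ a) * G v - x) (wedge-*ˡ c φ (G ∘ (a ∷_)) v))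
    (solve 4 (λ c p g x → (c :* p) :* g :- c :* x := c :* (p :* g :- x)) refl
      c (φ a) (G v) (wedge φ (G ∘ (a ∷_)) v))

  prodTo-ℚ : ℕ → (ℕ → ℚ) → ℚ
  prodTo-ℚ zero    c = 1ℚ
  prodTo-ℚ (suc m) c = c 0 * prodTo-ℚ m (c ∘ suc)

  det-scale : ∀ m c φ v → det m (λ j a → c j * φ j a) v ≡ prodTo-ℚ m c * det m φ v
  det-scale zero    c φ v = sym (ℚₚ.*-identityˡ (unit v))
  det-scale (suc m) c φ v = begin
    wedge (λ a → c 0 * φ 0 a) (det m (λ j a → c (suc j) * φ (suc j) a)) v
      ≡⟨ wedge-*ˡ (c 0) (φ 0) _ v ⟩
    c 0 * wedge (φ 0) (det m (λ j a → c (suc j) * φ (suc j) a)) v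
      ≡⟨ cong (c 0 *_) (wedge-congʳ (φ 0) (det-scale m (c ∘ suc) (φ ∘ suc)) v) ⟩
    c 0 * wedge (φ 0) (λ w → prodTo-ℚ m (c ∘ suc) * det m (φ ∘ suc) w) v
      ≡⟨ cong (c 0 *_) (wedge-* (φ 0) (prodTo-ℚ m (c ∘ suc)) (det m (φ ∘ suc)) v) ⟩
    c 0 * (prodTo-ℚ m (c ∘ suc) * wedge (φ 0) (det m (φ ∘ suc)) v)
      ≡⟨ ℚₚ.*-assoc (c 0) (prodTo-ℚ m (c ∘ suc)) _ ⟨
    c 0 * prodTo-ℚ m (c ∘ suc) * wedge (φ 0) (det m (φ ∘ suc)) v ∎

  -- The determinant is only ever expanded along its first column; this law supplies the alternating
  -- behaviour in the columns.
  wedge-anticomm : ∀ φ ψ G v → wedge φ (wedge ψ G) v + wedge ψ (wedge φ G) v ≡ 0ℚ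
  wedge-anticomm φ ψ G []      = refl
  wedge-anticomm φ ψ G (a ∷ v) = begin
    (φ a * ψG - wedge φ (λ w → ψ a * G w - wedge ψ Gₐ w) v)
      + (ψ a * φG - wedge ψ (λ w → φ a * G w - wedge φ Gₐ w) v)
      ≡⟨ cong₂ (λ x y → (φ a * ψG - x) + (ψ a * φG - y)) (expand φ ψ) (expand ψ φ) ⟩
    (φ a * ψG - (ψ a * φG - φψ)) + (ψ a * φG - (φ a * ψG - ψφ))
      ≡⟨ solve 6 (λ p x q y s t →
           (p :* x :- (q :* y :- s)) :+ (q :* y :- (p :* x :- t)) := s :+ t) refl
           (φ a) ψG (ψ a) φG φψ ψφ ⟩
    φψ + ψφ
      ≡⟨ wedge-anticomm φ ψ Gₐ v ⟩
    0ℚ ∎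
    where
    Gₐ = G ∘ (a ∷_)
    φG = wedge φ G v
    ψG = wedge ψ G v
    φψ = wedge φ (wedge ψ Gₐ) v
    ψφ = wedge ψ (wedge φ Gₐ) v
    expand : ∀ φ ψ → wedge φ (λ w → ψ a * G w - wedge ψ Gₐ w) v ≡
                     ψ a * wedge φ G v - wedge φ (wedge ψ Gₐ) v
    expand φ ψ = trans (wedge-sub φ (λ w → ψ a * G w) (wedge ψ Gₐ) v)
      (cong (λ x → x - wedge φ (wedge ψ Gₐ) v) (wedge-* φ (ψ a) G v))

  wedge-self : ∀ φ G v → wedge φ (wedge φ G) v ≡ 0ℚ
  wedge-self φ G v = ≡-neg⇒≡0 (begin
    x              ≡⟨ solve 1 (λ x → x := (x :+ x) :- x) refl x ⟩
    (x + x) - x    ≡⟨ cong (λ y → y - x) (wedge-anticomm φ φ G v) ⟩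
    0ℚ - x         ≡⟨ ℚₚ.+-identityˡ (- x) ⟩
    - x            ∎)
    where x = wedge φ (wedge φ G) v

  -- Columns are cleaned from left to right: with `ψ 0` in front, the multiple of `ψ 0` in the next
  -- column dies by `wedge-self`, after which `ψ 1` stands in front of the rest.
  det-column-ops : ∀ m (ψ : ℕ → ℤ → ℚ) (e : ℕ → ℚ) v →
    wedge (ψ 0) (det m (λ j a → ψ (suc j) a + e j * ψ j a)) v ≡ det (suc m) ψ v
  det-column-ops zero    ψ e v = refl
  det-column-ops (suc m) ψ e v = begin
    wedge (ψ 0) (wedge (λ a → ψ 1 a + e 0 * ψ 0 a) R) v
      ≡⟨ wedge-congʳ (ψ 0) (wedge-linearˡ (ψ 1) (e 0) (ψ 0) R) v ⟩
    wedge (ψ 0) (λ w → wedge (ψ 1) R w + e 0 * wedge (ψ 0) R w) v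
      ≡⟨ trans (wedge-+ (ψ 0) (wedge (ψ 1) R) (λ w → e 0 * wedge (ψ 0) R w) v)
           (cong (wedge (ψ 0) (wedge (ψ 1) R) v +_) (wedge-* (ψ 0) (e 0) (wedge (ψ 0) R) v)) ⟩
    wedge (ψ 0) (wedge (ψ 1) R) v + e 0 * wedge (ψ 0) (wedge (ψ 0) R) v
      ≡⟨ cong₂ (λ x y → x + e 0 * y)
           (wedge-congʳ (ψ 0) (det-column-ops m (ψ ∘ suc) (e ∘ suc)) v) (wedge-self (ψ 0) R v) ⟩
    det (suc (suc m)) ψ v + e 0 * 0ℚ
      ≡⟨ solve 2 (λ x c → x :+ c :* con 0ℚ := x) refl (det (suc (suc m)) ψ v) (e 0) ⟩
    det (suc (suc m)) ψ v ∎
    where R = det m (λ j a → ψ (suc (suc j)) a + e (suc j) * ψ (suc j) a)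

  prodOver : (ℤ → ℚ) → LFun
  prodOver χ []      = 1ℚ
  prodOver χ (a ∷ v) = χ a * prodOver χ v

  wedge-rows : ∀ χ φ G v →
               wedge (λ a → χ a * φ a) (λ w → prodOver χ w * G w) v ≡ prodOver χ v * wedge φ G v
  wedge-rows χ φ G []      = refl
  wedge-rows χ φ G (a ∷ v) = begin
    (χ a * φ a) * (Π * G v) - wedge (λ b → χ b * φ b) (λ w → (χ a * prodOver χ w) * Gₐ w) v
      ≡⟨ cong (λ x → (χ a * φ a) * (Π * G v) - x)
           (trans (wedge-congʳ _ (λ w → ℚₚ.*-assoc (χ a) (prodOver χ w) (Gₐ w)) v)
           (trans (wedge-* _ (χ a) _ v) (cong (χ a *_) (wedge-rows χ φ Gₐ v)))) ⟩
    (χ a * φ a) * (Π * G v) - χ a * (Π * wedge φ Gₐ v)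
      ≡⟨ solve 5 (λ c p x g y → (c :* p) :* (x :* g) :- c :* (x :* y) := (c :* x) :* (p :* g :- y))
           refl (χ a) (φ a) Π (G v) (wedge φ Gₐ v) ⟩
    (χ a * Π) * (φ a * G v - wedge φ Gₐ v) ∎
    where
    Π = prodOver χ v
    Gₐ = G ∘ (a ∷_)

  det-rows : ∀ m χ φ v → det m (λ j a → χ a * φ j a) v ≡ prodOver χ v * det m φ v
  det-rows zero    χ φ []      = refl
  det-rows zero    χ φ (a ∷ v) = sym (ℚₚ.*-zeroʳ (prodOver χ (a ∷ v)))
  det-rows (suc m) χ φ v = trans
    (wedge-congʳ _ (det-rows m χ (φ ∘ suc)) v) (wedge-rows χ (φ 0) (det m (φ ∘ suc)) v)

  det-first-row-0 : ∀ m φ a → (∀ j → φ j a ≡ 0ℚ) → ∀ v → det m φ (a ∷ v) ≡ 0ℚ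
  det-first-row-0 zero    φ a z v = refl
  det-first-row-0 (suc m) φ a z v =
    *-0-sub-0 (z 0) (wedge-0 (φ 0) (det-first-row-0 m (φ ∘ suc) a (z ∘ suc)) v)

  newton : (ℕ → ℚ) → ℕ → ℚ → ℚ
  newton c zero    t = 1ℚ
  newton c (suc j) t = newton c j t * (t - c j)

  vandermonde : (ℤ → ℚ) → LFun
  vandermonde s []      = 1ℚ
  vandermonde s (a ∷ v) = prodOver (λ b → s b - s a) v * vandermonde s v

  -- The columns (t − s₁) newton c j t differ from newton c (j + 1) t by multiples of the
  -- preceding columns, and all but the first vanish in the first row.
  det-newton : ∀ m c s v → length v ≡ m → det m (λ j a → newton c j (s a)) v ≡ vandermonde s v
  det-newton zero    c s []      l = refl
  det-newton (suc m) c s (a ∷ v) l = begin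
    det (suc m) p (a ∷ v)
      ≡⟨ det-column-ops m p (λ j → c j - s a) (a ∷ v) ⟨
    wedge (p 0) (det m (λ j b → p (suc j) b + (c j - s a) * p j b)) (a ∷ v)
      ≡⟨ wedge-congʳ (p 0) (det-cong m column) (a ∷ v) ⟩
    wedge (p 0) (det m q) (a ∷ v)
      ≡⟨⟩
    1ℚ * det m q v - wedge (p 0) (det m q ∘ (a ∷_)) v
      ≡⟨ cong (λ x → 1ℚ * det m q v - x) (wedge-0 (p 0) (det-first-row-0 m q a q-vanishes) v) ⟩
    1ℚ * det m q v - 0ℚ
      ≡⟨ solve 1 (λ x → con 1ℚ :* x :- con 0ℚ := x) refl (det m q v) ⟩
    det m q v
      ≡⟨ det-rows m (λ b → s b - s a) p v ⟩
    prodOver (λ b → s b - s a) v * det m p v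
      ≡⟨ cong (prodOver (λ b → s b - s a) v *_) (det-newton m c s v (ℕₚ.suc-injective l)) ⟩
    prodOver (λ b → s b - s a) v * vandermonde s v ∎
    where
    p q : ℕ → ℤ → ℚ
    p j b = newton c j (s b)
    q j b = (s b - s a) * p j b
    column : ∀ j b → p (suc j) b + (c j - s a) * p j b ≡ q j b
    column j b = solve 4 (λ n t c a → n :* (t :- c) :+ (c :- a) :* n := (t :- a) :* n) refl
      (p j b) (s b) (c j) (s a)
    q-vanishes : ∀ j → q j a ≡ 0ℚ
    q-vanishes j = trans (cong (_* p j a) (ℚₚ.+-inverseʳ (s a))) (ℚₚ.*-zeroˡ (p j a))

  AntisymmetricAll : LFun → Set
  AntisymmetricAll f = ∀ i v → suc i ℕ.< length v → f (swapAt i v) ≡ - f v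

  wedge-antisymmetric : ∀ φ G → AntisymmetricAll G → AntisymmetricAll (wedge φ G)
  wedge-antisymmetric φ G anti zero    (a ∷ [])    (ℕ.s≤s ())
  wedge-antisymmetric φ G anti zero    (a ∷ b ∷ v) l = begin
    φ b * G (a ∷ v) - (φ a * G (b ∷ v) - wedge φ (λ w → G (b ∷ a ∷ w)) v)
      ≡⟨ cong (λ x → φ b * G (a ∷ v) - (φ a * G (b ∷ v) - x))
           (trans (wedge-congʳ φ (λ w → anti 0 (a ∷ b ∷ w) (ℕ.s≤s (ℕ.s≤s ℕ.z≤n))) v)
                  (wedge-neg φ (λ w → G (a ∷ b ∷ w)) v)) ⟩
    φ b * G (a ∷ v) - (φ a * G (b ∷ v) - - wedge φ (λ w → G (a ∷ b ∷ w)) v)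
      ≡⟨ solve 3 (λ x y z → x :- (y :- (:- z)) := :- (y :- (x :- z))) refl
           (φ b * G (a ∷ v)) (φ a * G (b ∷ v)) (wedge φ (λ w → G (a ∷ b ∷ w)) v) ⟩
    - (φ a * G (b ∷ v) - (φ b * G (a ∷ v) - wedge φ (λ w → G (a ∷ b ∷ w)) v)) ∎
  wedge-antisymmetric φ G anti (suc i) (a ∷ v) (ℕ.s≤s l) = begin
    φ a * G (swapAt i v) - wedge φ (G ∘ (a ∷_)) (swapAt i v)
      ≡⟨ cong₂ (λ x y → φ a * x - y) (anti i v l)
           (wedge-antisymmetric φ (G ∘ (a ∷_)) (λ j w l′ → anti (suc j) (a ∷ w) (ℕ.s≤s l′)) i v l) ⟩
    φ a * (- G v) - (- wedge φ (G ∘ (a ∷_)) v)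
      ≡⟨ solve 3 (λ p g x → p :* (:- g) :- (:- x) := :- (p :* g :- x)) refl
           (φ a) (G v) (wedge φ (G ∘ (a ∷_)) v) ⟩
    - (φ a * G v - wedge φ (G ∘ (a ∷_)) v) ∎

  det-antisymmetric : ∀ m φ → AntisymmetricAll (det m φ)
  det-antisymmetric zero    φ zero    (a ∷ [])    (ℕ.s≤s ())
  det-antisymmetric zero    φ zero    (a ∷ b ∷ v) l = refl
  det-antisymmetric zero    φ (suc i) (a ∷ v)     l = refl
  det-antisymmetric (suc m) φ i v l =
    wedge-antisymmetric (φ 0) _ (det-antisymmetric m (φ ∘ suc)) i v l

  -- `c` is twice the centre of the reflection.
  OddAt : ℤ → LFun → Set
  OddAt c f = ∀ i v → i ℕ.< length v → f (reflectAt c i v) ≡ - f v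

  wedge-odd : ∀ c φ G → (∀ a → φ (c ℤ.- a) ≡ - φ a) → OddAt c G → OddAt c (wedge φ G)
  wedge-odd c φ G oddφ oddG zero (a ∷ v) l = begin
    φ (c ℤ.- a) * G v - wedge φ (G ∘ (c ℤ.- a ∷_)) v
      ≡⟨ cong₂ (λ x y → x * G v - y) (oddφ a)
           (trans (wedge-congʳ φ (λ w → oddG 0 (a ∷ w) (ℕ.s≤s ℕ.z≤n)) v)
                  (wedge-neg φ (G ∘ (a ∷_)) v)) ⟩
    (- φ a) * G v - (- wedge φ (G ∘ (a ∷_)) v)
      ≡⟨ solve 3 (λ p g x → (:- p) :* g :- (:- x) := :- (p :* g :- x)) refl
           (φ a) (G v) (wedge φ (G ∘ (a ∷_)) v) ⟩
    - (φ a * G v - wedge φ (G ∘ (a ∷_)) v) ∎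
  wedge-odd c φ G oddφ oddG (suc i) (a ∷ v) (ℕ.s≤s l) = begin
    φ a * G (reflectAt c i v) - wedge φ (G ∘ (a ∷_)) (reflectAt c i v)
      ≡⟨ cong₂ (λ x y → φ a * x - y) (oddG i v l)
           (wedge-odd c φ (G ∘ (a ∷_)) oddφ (λ j w l′ → oddG (suc j) (a ∷ w) (ℕ.s≤s l′)) i v l) ⟩
    φ a * (- G v) - (- wedge φ (G ∘ (a ∷_)) v)
      ≡⟨ solve 3 (λ p g x → p :* (:- g) :- (:- x) := :- (p :* g :- x)) refl
           (φ a) (G v) (wedge φ (G ∘ (a ∷_)) v) ⟩
    - (φ a * G v - wedge φ (G ∘ (a ∷_)) v) ∎

  det-odd : ∀ c m φ → (∀ j a → φ j (c ℤ.- a) ≡ - φ j a) → OddAt c (det m φ)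
  det-odd c zero    φ odd zero    (a ∷ v) l = refl
  det-odd c zero    φ odd (suc i) (a ∷ v) l = refl
  det-odd c (suc m) φ odd i v l = wedge-odd c (φ 0) _ (odd 0) (det-odd c m (φ ∘ suc) (odd ∘ suc)) i v l

  -- Differences of determinants.

  diff : (ℤ → ℚ) → ℤ → ℚ
  diff φ a = φ (a ℤ.+ ℤ.+ 1) - φ a

  diffAll : LFun → LFun
  diffAll C []      = C []
  diffAll C (a ∷ v) = diffAll (λ w → C (a ℤ.+ ℤ.+ 1 ∷ w) - C (a ∷ w)) v

  diffOp : ℕ → Op
  diffOp zero    = I
  diffOp (suc m) = lift (diffOp m) ⊗ D 0

  diffAll≡diffOp : ∀ f v → diffAll f v ≡ ⟦ diffOp (length v) ⟧ f v
  diffAll≡diffOp f []      = refl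
  diffAll≡diffOp f (a ∷ v) = trans (diffAll≡diffOp _ v) (sym (⟦lift⟧ (diffOp (length v)) _ a v))

  -- The number of differences taken by `diffAll` depends on the list, but on lists of one length it
  -- is the operator `diffOp`, and shifts preserve the length.
  diffAll-comm : ∀ P f v → diffAll (⟦ P ⟧ f) v ≡ ⟦ P ⟧ (diffAll f) v
  diffAll-comm P f v = begin
    diffAll (⟦ P ⟧ f) v                   ≡⟨ diffAll≡diffOp (⟦ P ⟧ f) v ⟩
    ⟦ diffOp (length v) ⟧ (⟦ P ⟧ f) v     ≡⟨ ⟦⟧-comm (diffOp (length v)) P f v ⟩
    ⟦ P ⟧ (⟦ diffOp (length v) ⟧ f) v     ≡⟨ ⟦⟧-cong-length P (λ { w l → trans (cong (λ n → ⟦ diffOp n ⟧ f w) (sym l)) (sym (diffAll≡diffOp f w)) }) v refl ⟩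
    ⟦ P ⟧ (diffAll f) v                   ∎

  diffAll-cong : ∀ {f g} → f ≗ g → diffAll f ≗ diffAll g
  diffAll-cong e []      = e []
  diffAll-cong e (a ∷ v) = diffAll-cong (λ w → cong₂ _-_ (e _) (e _)) v

  diffAll-linear : ∀ c f g v → diffAll (λ w → c * f w - g w) v ≡ c * diffAll f v - diffAll g v
  diffAll-linear c f g []      = refl
  diffAll-linear c f g (a ∷ v) = trans
    (diffAll-cong (λ w → solve 5 (λ c x y s t → (c :* x :- s) :- (c :* y :- t) :=
                                                c :* (x :- y) :- (s :- t)) refl
        c (f (a ℤ.+ ℤ.+ 1 ∷ w)) (f (a ∷ w)) (g (a ℤ.+ ℤ.+ 1 ∷ w)) (g (a ∷ w))) v)
    (diffAll-linear c _ _ v)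

  -- In each term of the expansion every entry is the argument either of `φ` or of `G`, never of
  -- both, so one difference in every entry distributes over the two.
  diffAll-wedge : ∀ φ G v → diffAll (wedge φ G) v ≡ wedge (diff φ) (diffAll G) v
  diffAll-wedge φ G []      = refl
  diffAll-wedge φ G (a ∷ v) = begin
    diffAll (λ w → (φ a⁺ * G w - wedge φ (G ∘ (a⁺ ∷_)) w) - (φ a * G w - wedge φ (G ∘ (a ∷_)) w)) v
      ≡⟨ diffAll-cong (λ w → trans
           (solve 5 (λ p q g x y → (p :* g :- x) :- (q :* g :- y) := (p :- q) :* g :- (x :- y)) refl
              (φ a⁺) (φ a) (G w) (wedge φ (G ∘ (a⁺ ∷_)) w) (wedge φ (G ∘ (a ∷_)) w))
           (cong (λ x → diff φ a * G w - x) (sym (wedge-sub φ (G ∘ (a⁺ ∷_)) (G ∘ (a ∷_)) w)))) v ⟩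
    diffAll (λ w → diff φ a * G w - wedge φ Gₐ w) v
      ≡⟨ diffAll-linear (diff φ a) G (wedge φ Gₐ) v ⟩
    diff φ a * diffAll G v - diffAll (wedge φ Gₐ) v
      ≡⟨ cong (λ x → diff φ a * diffAll G v - x) (diffAll-wedge φ Gₐ v) ⟩
    diff φ a * diffAll G v - wedge (diff φ) (diffAll Gₐ) v ∎
    where
    a⁺ = a ℤ.+ ℤ.+ 1
    Gₐ : LFun
    Gₐ w = G (a⁺ ∷ w) - G (a ∷ w)

  diffAll-0 : ∀ f → (∀ v → f v ≡ 0ℚ) → ∀ v → diffAll f v ≡ 0ℚ
  diffAll-0 f z []      = z []
  diffAll-0 f z (a ∷ v) = diffAll-0 _ (λ w → cong₂ _-_ (z _) (z _)) v

  diffAll-det : ∀ m φ v → diffAll (det m φ) v ≡ det m (diff ∘ φ) v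
  diffAll-det zero    φ []      = refl
  diffAll-det zero    φ (a ∷ v) = diffAll-0 _ (λ _ → refl) v
  diffAll-det (suc m) φ v = trans (diffAll-wedge (φ 0) _ v)
    (wedge-congʳ (diff (φ 0)) (diffAll-det m (φ ∘ suc)) v)

  -- Takes the place of "polynomial of degree less than n".
  Nilpotent : ℕ → (ℤ → ℚ) → Set
  Nilpotent zero    φ = ∀ a → φ a ≡ 0ℚ
  Nilpotent (suc n) φ = Nilpotent n (diff φ)

  module _ (N : ℕ) where
    open Truncated N

    private
      -- The shape of `H` is chosen to be stable under `D 0`: a difference in the first entry acts
      -- on `ψ` and on `K`, while `φ` and `G`, which do not see that entry, stay fixed. Initially
      -- `ψ` is `φ` and `K` is `G`.
      first-entry : ∀ n φ (G : LFun) ψ H K → Nilpotent n ψ →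
        (∀ v → ⟦ pow (D 0) n ⟧ K v ≡ 0ℚ) →
        (∀ a v → H (a ∷ v) ≡ ψ a * G v - wedge φ (K ∘ (a ∷_)) v) →
        ∀ a v → ⟦ pow (D 0) n ⟧ H (a ∷ v) ≡ 0ℚ
      first-entry zero    φ G ψ H K nil zK e a v =
        trans (e a v) (*-0-sub-0 (nil a) (wedge-0 φ (zK ∘ (a ∷_)) v))
      first-entry (suc n) φ G ψ H K nil zK e =
        first-entry n φ G (diff ψ) (⟦ D 0 ⟧ H) (⟦ D 0 ⟧ K) nil zK λ a v → begin
          H (a ℤ.+ ℤ.+ 1 ∷ v) - H (a ∷ v)
            ≡⟨ cong₂ _-_ (e _ v) (e a v) ⟩
          (ψ (a ℤ.+ ℤ.+ 1) * G v - wedge φ (K ∘ (a ℤ.+ ℤ.+ 1 ∷_)) v)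
            - (ψ a * G v - wedge φ (K ∘ (a ∷_)) v)
            ≡⟨ solve 5 (λ p q g x y → (p :* g :- x) :- (q :* g :- y) := (p :- q) :* g :- (x :- y)) refl
                 (ψ (a ℤ.+ ℤ.+ 1)) (ψ a) (G v) (wedge φ (K ∘ (a ℤ.+ ℤ.+ 1 ∷_)) v)
                 (wedge φ (K ∘ (a ∷_)) v) ⟩
          diff ψ a * G v - (wedge φ (K ∘ (a ℤ.+ ℤ.+ 1 ∷_)) v - wedge φ (K ∘ (a ∷_)) v)
            ≡⟨ cong (λ x → diff ψ a * G v - x) (wedge-sub φ (K ∘ (a ℤ.+ ℤ.+ 1 ∷_)) (K ∘ (a ∷_)) v) ⟨
          diff ψ a * G v - wedge φ (⟦ D 0 ⟧ K ∘ (a ∷_)) v ∎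

    wedge-V : ∀ φ G → Nilpotent (suc N) φ → V G → V (wedge φ G)
    wedge-V φ G nil vG p []            = trans
      (⟦⟧-cong-on {_≡ []} (λ { i d v refl → sh-[] i d }) (pow (D p) (suc N)) {wedge φ G} {λ _ → 0ℚ}
         (λ { v refl → refl }) [] refl)
      (⟦⟧-0 (pow (D p) (suc N)) (λ _ → refl) [])
    wedge-V φ G nil vG zero    (a ∷ v) = first-entry (suc N) φ G φ (wedge φ G) G nil (vG 0) (λ _ _ → refl) a v
    wedge-V φ G nil vG (suc p) (a ∷ v) = begin
      ⟦ pow (D (suc p)) (suc N) ⟧ (wedge φ G) (a ∷ v)
        ≡⟨ cong (λ P → ⟦ P ⟧ (wedge φ G) (a ∷ v)) (substOp-pow (λ i → X (suc i)) (D p) (suc N)) ⟨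
      ⟦ lift (pow (D p) (suc N)) ⟧ (wedge φ G) (a ∷ v)
        ≡⟨ ⟦lift⟧ (pow (D p) (suc N)) (wedge φ G) a v ⟩
      ⟦ pow (D p) (suc N) ⟧ (λ w → φ a * G w - wedge φ (G ∘ (a ∷_)) w) v
        ≡⟨ ⟦⟧-sub (pow (D p) (suc N)) (λ w → φ a * G w) (wedge φ (G ∘ (a ∷_))) v ⟩
      ⟦ pow (D p) (suc N) ⟧ (λ w → φ a * G w) v - ⟦ pow (D p) (suc N) ⟧ (wedge φ (G ∘ (a ∷_))) v
        ≡⟨ cong (λ x → x - ⟦ pow (D p) (suc N) ⟧ (wedge φ (G ∘ (a ∷_))) v) (⟦⟧-* (pow (D p) (suc N)) (φ a) G v) ⟩
      φ a * ⟦ pow (D p) (suc N) ⟧ G v - ⟦ pow (D p) (suc N) ⟧ (wedge φ (G ∘ (a ∷_))) v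
        ≡⟨ *-sub-0 (φ a) (vG p v) (wedge-V φ (G ∘ (a ∷_)) nil (V-∷ {G} a vG) p v) ⟩
      0ℚ ∎

    unit-V : V unit
    unit-V p v = ⟦⟧-0 (pow (D p) N) (λ w → trans (cong (λ x → x - unit w) (unit-sh p w)) (ℚₚ.+-inverseʳ (unit w))) v
      where
      unit-sh : ∀ p w → unit (sh p (ℤ.+ 1) w) ≡ unit w
      unit-sh zero    []      = refl
      unit-sh (suc p) []      = refl
      unit-sh zero    (a ∷ w) = refl
      unit-sh (suc p) (a ∷ w) = refl

    det-V : ∀ m φ → (∀ j → j ℕ.< m → Nilpotent (suc N) (φ j)) → V (det m φ)
    det-V zero    φ nil = unit-V
    det-V (suc m) φ nil = wedge-V (φ 0) _ (nil 0 (ℕ.s≤s ℕ.z≤n))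
      (det-V m (φ ∘ suc) (λ j l → nil (suc j) (ℕ.s≤s l)))

-- Alternating sums from expansion along a constant column, and vanishing at the centre of
-- reflection.

module RowSums where

  open ShiftOperators
  open OperatorProduct
  open Determinants
  open import Data.Rational using (ℚ; 0ℚ; 1ℚ; _+_; _-_; _*_; -_)
  open +-*-Solver using (solve; _:+_; _:*_; _:-_; :-_; _:=_; con)
  open ≡-Reasoning

  altSum : ℕ → (ℕ → ℚ) → ℚ
  altSum zero    g = 0ℚ
  altSum (suc n) g = g 0 - altSum n (g ∘ suc)

  altSum-cong : ∀ n {g h} → (∀ r → r ℕ.< n → g r ≡ h r) → altSum n g ≡ altSum n h
  altSum-cong zero    e = refl
  altSum-cong (suc n) e = cong₂ _-_ (e 0 (ℕ.s≤s ℕ.z≤n)) (altSum-cong n (λ r l → e (suc r) (ℕ.s≤s l)))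

  ⟦⟧-altSum : ∀ P n (g : ℕ → LFun) v →
              ⟦ P ⟧ (λ w → altSum n (λ r → g r w)) v ≡ altSum n (λ r → ⟦ P ⟧ (g r) v)
  ⟦⟧-altSum P zero    g v = ⟦⟧-0 P (λ _ → refl) v
  ⟦⟧-altSum P (suc n) g v = trans (⟦⟧-sub P (g 0) (λ w → altSum n (λ r → g (suc r) w)) v)
    (cong (λ x → ⟦ P ⟧ (g 0) v - x) (⟦⟧-altSum P n (g ∘ suc) v))

  -- Laplace expansion along a constant column. Each term ignores one entry, which is what allows
  -- the shift of that entry to be set to 1 in the operator.
  wedge-1 : ∀ G v → wedge (λ _ → 1ℚ) G v ≡ altSum (length v) (λ r → G (del r v))
  wedge-1 G []      = refl
  wedge-1 G (a ∷ v) = cong₂ _-_ (ℚₚ.*-identityˡ (G v)) (wedge-1 (G ∘ (a ∷_)) v)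

  -- The alternating sum over the deleted entry, with all later entries raised by 1. The later
  -- entries are upper limits of half-open intervals of summation, the earlier ones are lower
  -- limits.
  alternate : LFun → LFun
  alternate C []      = 0ℚ
  alternate C (a ∷ v) = C (mapSuc v) - alternate (C ∘ (a ∷_)) v

  delShift : ℕ → List ℤ → List ℤ
  delShift r       []      = []
  delShift zero    (a ∷ v) = mapSuc v
  delShift (suc r) (a ∷ v) = a ∷ delShift r v

  alternate≡altSum : ∀ C v → alternate C v ≡ altSum (length v) (λ r → C (delShift r v))
  alternate≡altSum C []      = refl
  alternate≡altSum C (a ∷ v) = cong (λ x → C (mapSuc v) - x) (alternate≡altSum (C ∘ (a ∷_)) v)

  pred-suc : ∀ a → a ℤ.+ -[1+ 0 ] ℤ.+ ℤ.+ 1 ≡ a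
  pred-suc a = trans (ℤₚ.+-assoc a -[1+ 0 ] (ℤ.+ 1)) (ℤₚ.+-identityʳ a)

  -- Raising all entries cancels the lowering before position `r`, so only the entries behind `r`
  -- end up raised, as the telescoping sums require.
  shiftBack-del : ∀ r v C → r ℕ.< length v → ⟦ shiftBack r ⟧ (C ∘ mapSuc) (del r v) ≡ C (delShift r v)
  shiftBack-del zero    (a ∷ v) C l = refl
  shiftBack-del (suc r) (a ∷ v) C (ℕ.s≤s l) = begin
    ⟦ lift (shiftBack r) ⟧ (C ∘ mapSuc) (a ℤ.+ -[1+ 0 ] ∷ del r v)
      ≡⟨ ⟦lift⟧ (shiftBack r) (C ∘ mapSuc) _ (del r v) ⟩
    ⟦ shiftBack r ⟧ (C ∘ (a ℤ.+ -[1+ 0 ] ℤ.+ ℤ.+ 1 ∷_) ∘ mapSuc) (del r v)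
      ≡⟨ shiftBack-del r v (C ∘ (a ℤ.+ -[1+ 0 ] ℤ.+ ℤ.+ 1 ∷_)) l ⟩
    C (a ℤ.+ -[1+ 0 ] ℤ.+ ℤ.+ 1 ∷ delShift r v)
      ≡⟨ cong (λ b → C (b ∷ delShift r v)) (pred-suc a) ⟩
    C (a ∷ delShift r v) ∎

  module _ (N : ℕ) where
    open Truncated N
    open Products N

    V-mapSuc : ∀ {f} → V f → V (f ∘ mapSuc)
    V-mapSuc {f} vf p v = trans (⟦⟧-mapSuc (pow (D p) (suc N)) f v) (vf p (mapSuc v))

    opP-wedge-1 : ∀ m G → V G → ∀ v → length v ≡ suc m →
      ⟦ opP (suc m) ⟧ (wedge (λ _ → 1ℚ) (G ∘ mapSuc)) v ≡ alternate (⟦ opP m ⟧ G) v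
    opP-wedge-1 m G vG v len = begin
      ⟦ P ⟧ (wedge (λ _ → 1ℚ) G′) v
        ≡⟨ ⟦⟧-cong-length P (λ w l → trans (wedge-1 G′ w) (cong (λ n → altSum n (λ r → G′ (del r w))) l)) v len ⟩
      ⟦ P ⟧ (λ w → altSum (suc m) (λ r → G′ (del r w))) v
        ≡⟨ ⟦⟧-altSum P (suc m) (λ r w → G′ (del r w)) v ⟩
      altSum (suc m) (λ r → ⟦ P ⟧ (G′ ∘ del r) v)
        ≡⟨ altSum-cong (suc m) (λ { r (ℕ.s≤s l) → term r l }) ⟩
      altSum (suc m) (λ r → ⟦ opP m ⟧ G (delShift r v))
        ≡⟨ cong (λ n → altSum n (λ r → ⟦ opP m ⟧ G (delShift r v))) len ⟨
      altSum (length v) (λ r → ⟦ opP m ⟧ G (delShift r v))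
        ≡⟨ alternate≡altSum (⟦ opP m ⟧ G) v ⟨
      alternate (⟦ opP m ⟧ G) v ∎
      where
      P = opP (suc m)
      G′ = G ∘ mapSuc
      term : ∀ r → r ℕ.≤ m → ⟦ P ⟧ (G′ ∘ del r) v ≡ ⟦ opP m ⟧ G (delShift r v)
      term r l = begin
        ⟦ P ⟧ (G′ ∘ del r) v
          ≡⟨ ⟦⟧-subst {λ _ → ⊤} _ (delθ r) (del r) (λ i d w _ g → del-sh r i d w g) P G′ v tt ⟩
        ⟦ substOp (delθ r) P ⟧ G′ (del r v)
          ≡⟨ at (opP-del m r l) G′ (V-mapSuc {G} vG) (del r v) ⟩
        ⟦ shiftBack r ⟧ (⟦ opP m ⟧ G′) (del r v)
          ≡⟨ ⟦⟧-cong (shiftBack r) (⟦⟧-mapSuc (opP m) G) (del r v) ⟩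
        ⟦ shiftBack r ⟧ (⟦ opP m ⟧ G ∘ mapSuc) (del r v)
          ≡⟨ shiftBack-del r v (⟦ opP m ⟧ G) (subst (r ℕ.<_) (sym len) (ℕ.s≤s l)) ⟩
        ⟦ opP m ⟧ G (delShift r v) ∎

    opP-vanishes : ∀ c b m f → V f → OddAt c f → c ℤ.- b ≡ b → ∀ v → length v ≡ m →
                   ⟦ opP (suc m) ⟧ f (v ++ b ∷ []) ≡ 0ℚ
    opP-vanishes c b m f vf odd fixed v len = ≡-neg⇒≡0 (begin
      ⟦ P ⟧ f w                                     ≡⟨ at (opP-reflect m) f vf w ⟨
      ⟦ substOp (reflθ m) P ⟧ f w                   ≡⟨ cong (⟦ substOp (reflθ m) P ⟧ f) (w-fixed v m len) ⟨
      ⟦ substOp (reflθ m) P ⟧ f (reflectAt c m w)   ≡⟨ ⟦⟧-subst {λ _ → ⊤} _ (reflθ m) (reflectAt c m)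
                                                         (λ i d u _ g → reflectAt-sh c m i d u g) P f w tt ⟨
      ⟦ P ⟧ (f ∘ reflectAt c m) w                   ≡⟨ ⟦⟧-cong-length P (λ u l → odd m u (ℕₚ.≤-reflexive (sym l))) w (w-length v m len) ⟩
      ⟦ P ⟧ (λ u → - f u) w                         ≡⟨ ⟦⟧-neg P f w ⟩
      - ⟦ P ⟧ f w                                   ∎)
      where
      P = opP (suc m)
      w = v ++ b ∷ []
      w-length : ∀ v m → length v ≡ m → length (v ++ b ∷ []) ≡ suc m
      w-length []      zero    l = refl
      w-length (a ∷ v) (suc m) l = cong suc (w-length v m (ℕₚ.suc-injective l))
      w-fixed : ∀ v m → length v ≡ m → reflectAt c m (v ++ b ∷ []) ≡ v ++ b ∷ []
      w-fixed []      zero    l = cong (_∷ []) fixed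
      w-fixed (a ∷ v) (suc m) l = cong (a ∷_) (w-fixed v m (ℕₚ.suc-injective l))

  -- Sums over the strict rows interlacing a given row.

  sumOver : {A : Set} → (A → ℚ) → List A → ℚ
  sumOver f []       = 0ℚ
  sumOver f (l ∷ ls) = f l + sumOver f ls

  module _ {A : Set} where

    sumOver-cong : {f g : A → ℚ} → f ≗ g → ∀ ls → sumOver f ls ≡ sumOver g ls
    sumOver-cong e []       = refl
    sumOver-cong e (l ∷ ls) = cong₂ _+_ (e l) (sumOver-cong e ls)

    sumOver-++ : ∀ (f : A → ℚ) ls ms → sumOver f (ls ++ ms) ≡ sumOver f ls + sumOver f ms
    sumOver-++ f []       ms = sym (ℚₚ.+-identityˡ _)
    sumOver-++ f (l ∷ ls) ms = trans (cong (f l +_) (sumOver-++ f ls ms)) (sym (ℚₚ.+-assoc (f l) _ _))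

    sumOver-map : ∀ {B : Set} (f : A → ℚ) (h : B → A) ls → sumOver f (map h ls) ≡ sumOver (f ∘ h) ls
    sumOver-map f h []       = refl
    sumOver-map f h (l ∷ ls) = cong (f (h l) +_) (sumOver-map f h ls)

    sumOver-concatMap : ∀ {B : Set} (f : A → ℚ) (h : B → List A) ls →
                        sumOver f (concatMap h ls) ≡ sumOver (sumOver f ∘ h) ls
    sumOver-concatMap f h []       = refl
    sumOver-concatMap f h (l ∷ ls) = trans (sumOver-++ f (h l) (concatMap h ls))
      (cong (sumOver f (h l) +_) (sumOver-concatMap f h ls))

  from : ℤ → ℕ → List ℤ
  from a zero    = []
  from a (suc n) = a ∷ from (a ℤ.+ ℤ.+ 1) n

  -- The half-open interval [a, b), meaningful for a ≤ b only.
  interval : ℤ → ℤ → List ℤ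
  interval a b = from a ℤ.∣ b ℤ.- a ∣

  a+∣b-a∣≡b : ∀ {a b} → a ℤ.≤ b → a ℤ.+ ℤ.+ ℤ.∣ b ℤ.- a ∣ ≡ b
  a+∣b-a∣≡b {a} {b} l = begin
    a ℤ.+ ℤ.+ ℤ.∣ b ℤ.- a ∣  ≡⟨ cong (λ c → a ℤ.+ c) (ℤₚ.0≤i⇒+∣i∣≡i (ℤₚ.i≤j⇒0≤j-i l)) ⟩
    a ℤ.+ (b ℤ.- a)          ≡⟨ cong (λ c → a ℤ.+ c) (ℤₚ.+-comm b (ℤ.- a)) ⟩
    a ℤ.+ (ℤ.- a ℤ.+ b)      ≡⟨ ℤₚ.+-assoc a (ℤ.- a) b ⟨
    a ℤ.- a ℤ.+ b            ≡⟨ cong (ℤ._+ b) (ℤₚ.+-inverseʳ a) ⟩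
    ℤ.+ 0 ℤ.+ b              ≡⟨ ℤₚ.+-identityˡ b ⟩
    b                        ∎

  telescope : ∀ (B : ℤ → ℚ) {a b} → a ℤ.≤ b → sumOver (diff B) (interval a b) ≡ B b - B a
  telescope B {a} {b} l = trans (go a ℤ.∣ b ℤ.- a ∣) (cong (λ c → B c - B a) (a+∣b-a∣≡b l))
    where
    go : ∀ a n → sumOver (diff B) (from a n) ≡ B (a ℤ.+ ℤ.+ n) - B a
    go a zero    = sym (trans (cong (λ c → B c - B a) (ℤₚ.+-identityʳ a)) (ℚₚ.+-inverseʳ (B a)))
    go a (suc n) = begin
      (B (a ℤ.+ ℤ.+ 1) - B a) + sumOver (diff B) (from (a ℤ.+ ℤ.+ 1) n)
        ≡⟨ cong ((B (a ℤ.+ ℤ.+ 1) - B a) +_) (go (a ℤ.+ ℤ.+ 1) n) ⟩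
      (B (a ℤ.+ ℤ.+ 1) - B a) + (B (a ℤ.+ ℤ.+ 1 ℤ.+ ℤ.+ n) - B (a ℤ.+ ℤ.+ 1))
        ≡⟨ solve 3 (λ x y z → (x :- y) :+ (z :- x) := z :- y) refl (B (a ℤ.+ ℤ.+ 1)) (B a) (B (a ℤ.+ ℤ.+ 1 ℤ.+ ℤ.+ n)) ⟩
      B (a ℤ.+ ℤ.+ 1 ℤ.+ ℤ.+ n) - B a
        ≡⟨ cong (λ c → B c - B a) (ℤₚ.+-assoc a (ℤ.+ 1) (ℤ.+ n)) ⟩
      B (a ℤ.+ ℤ.+ suc n) - B a ∎

  -- Strictly increasing lists with entries in [lo, b).
  Increasing : ℤ → ℤ → List ℤ → Set
  Increasing b lo []       = lo ℤ.≤ b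
  Increasing b lo (k ∷ ks) = lo ℤ.≤ k × Increasing b (k ℤ.+ ℤ.+ 1) ks

  Increasing-weaken : ∀ {b lo lo′} ks → lo ℤ.≤ lo′ → Increasing b lo′ ks → Increasing b lo ks
  Increasing-weaken []       l i       = ℤₚ.≤-trans l i
  Increasing-weaken (k ∷ ks) l (i , j) = ℤₚ.≤-trans l i , j

  ≤-suc : ∀ a → a ℤ.≤ a ℤ.+ ℤ.+ 1
  ≤-suc a = ℤₚ.i≤i+j a (ℤ.+ 1)

  -- The strictly increasing rows l with lo ≤ l₁ ≤ k₁ ≤ l₂ ≤ k₂ ≤ …, where `end`
  -- lists the possible continuations after the last k.
  rows : (ℤ → List (List ℤ)) → ℤ → List ℤ → List (List ℤ)
  rows end lo []       = end lo
  rows end lo (k ∷ ks) = concatMap (λ l → map (l ∷_) (rows end k ks)) (interval lo k)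
                         ++ map (k ∷_) (rows end (k ℤ.+ ℤ.+ 1) ks)

  -- The suffix is the parity of the index of the given row. Above a row of odd index no entry
  -- follows the last k; above one of even index there is one more, bounded above only by the
  -- exclusive bound `b`.
  endOdd : ℤ → List (List ℤ)
  endOdd lo = [] ∷ []

  endEven : ℤ → ℤ → List (List ℤ)
  endEven b lo = map (_∷ []) (interval lo b)

  -- A first entry below `k` leaves the rest free to start at `k`; a first entry equal to `k` forces
  -- the rest to start at k + 1.
  sumOver-rows : ∀ f end lo k ks → sumOver f (rows end lo (k ∷ ks)) ≡
    sumOver (λ l → sumOver (f ∘ (l ∷_)) (rows end k ks)) (interval lo k)
      + sumOver (f ∘ (k ∷_)) (rows end (k ℤ.+ ℤ.+ 1) ks)
  sumOver-rows f end lo k ks = trans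
    (sumOver-++ f (concatMap (λ l → map (l ∷_) (rows end k ks)) (interval lo k)) _)
    (cong₂ _+_
      (trans (sumOver-concatMap f (λ l → map (l ∷_) (rows end k ks)) (interval lo k))
             (sumOver-cong (λ l → sumOver-map f (l ∷_) (rows end k ks)) (interval lo k)))
      (sumOver-map f (k ∷_) (rows end (k ℤ.+ ℤ.+ 1) ks)))

  alternate-sub : ∀ C C′ v → alternate (λ w → C w - C′ w) v ≡ alternate C v - alternate C′ v
  alternate-sub C C′ []      = refl
  alternate-sub C C′ (a ∷ v) = trans
    (cong (λ x → (C (mapSuc v) - C′ (mapSuc v)) - x) (alternate-sub (C ∘ (a ∷_)) (C′ ∘ (a ∷_)) v))
    (solve 4 (λ x y s t → (x :- y) :- (s :- t) := (x :- s) :- (y :- t)) refl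
      (C (mapSuc v)) (C′ (mapSuc v)) (alternate (C ∘ (a ∷_)) v) (alternate (C′ ∘ (a ∷_)) v))

  length-mapSuc : ∀ v → length (mapSuc v) ≡ length v
  length-mapSuc []      = refl
  length-mapSuc (a ∷ v) = cong suc (length-mapSuc v)

  alternate-cong : ∀ {C C′} v → (∀ w → suc (length w) ≡ length v → C w ≡ C′ w) →
                   alternate C v ≡ alternate C′ v
  alternate-cong []      e = refl
  alternate-cong (a ∷ v) e = cong₂ _-_ (e (mapSuc v) (cong suc (length-mapSuc v)))
    (alternate-cong v (λ w l → e (a ∷ w) (cong suc l)))

  diffFirst : LFun → ℤ → LFun
  diffFirst C l w = C (l ℤ.+ ℤ.+ 1 ∷ w) - C (l ∷ w)

  Adjacent-diffFirst : ∀ {n} C l → Adjacent (suc n) C → Adjacent n (diffFirst C l)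
  Adjacent-diffFirst C l adj pre a v len = begin
    ((C (l⁺ ∷ u) - C (l ∷ u)) - (C (l⁺ ∷ u′) - C (l ∷ u′))) + (C (l⁺ ∷ u″) - C (l ∷ u″))
      ≡⟨ solve 6 (λ x y x′ y′ x″ y″ → ((x :- y) :- (x′ :- y′)) :+ (x″ :- y″) :=
                    ((x :- x′) :+ x″) :- ((y :- y′) :+ y″)) refl
           (C (l⁺ ∷ u)) (C (l ∷ u)) (C (l⁺ ∷ u′)) (C (l ∷ u′)) (C (l⁺ ∷ u″)) (C (l ∷ u″)) ⟩
    ((C (l⁺ ∷ u) - C (l⁺ ∷ u′)) + C (l⁺ ∷ u″)) - ((C (l ∷ u) - C (l ∷ u′)) + C (l ∷ u″))
      ≡⟨ cong₂ _-_ (adj (l⁺ ∷ pre) a v (cong suc len)) (adj (l ∷ pre) a v (cong suc len)) ⟩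
    0ℚ ∎
    where
    l⁺ = l ℤ.+ ℤ.+ 1
    u = pre ++ a ∷ a ∷ v
    u′ = pre ++ a ∷ a ℤ.+ ℤ.+ 1 ∷ v
    u″ = pre ++ a ℤ.+ ℤ.+ 1 ∷ a ℤ.+ ℤ.+ 1 ∷ v

  -- Adjacent accounts for the rows excluded by strictness, those with l_i = l_{i+1} = k.
  sum-rows-odd : ∀ b lo ks C → Increasing b lo ks → Adjacent (length ks) C →
    sumOver (diffAll C) (rows endOdd lo ks) ≡ C (mapSuc ks) - alternate (C ∘ (lo ∷_)) ks
  sum-rows-odd b lo []       C inc adj = refl
  sum-rows-odd b lo (k ∷ ks) C (lo≤k , inc) adj = begin
    sumOver (diffAll C) (rows endOdd lo (k ∷ ks))
      ≡⟨ sumOver-rows (diffAll C) endOdd lo k ks ⟩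
    sumOver (λ l → sumOver (diffAll (diffFirst C l)) (rows endOdd k ks)) (interval lo k)
      + sumOver (diffAll (diffFirst C k)) (rows endOdd k⁺ ks)
      ≡⟨ cong₂ _+_ (trans (sumOver-cong inner (interval lo k)) (telescope B lo≤k)) last ⟩
    (B k - B lo) + ((C (k⁺ ∷ mapSuc ks) - C (k ∷ mapSuc ks))
                    - (alternate (C ∘ (k⁺ ∷_) ∘ (k⁺ ∷_)) ks - alternate (C ∘ (k ∷_) ∘ (k⁺ ∷_)) ks))
      ≡⟨ solve 6 (λ ck x bl ck⁺ y z →
           ((ck :- x) :- bl) :+ ((ck⁺ :- ck) :- (y :- z)) := (ck⁺ :- bl) :- (y :- (z :- x))) refl
           (C (k ∷ mapSuc ks)) (alternate (C ∘ (k ∷_) ∘ (k ∷_)) ks) (B lo)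
           (C (k⁺ ∷ mapSuc ks)) (alternate (C ∘ (k⁺ ∷_) ∘ (k⁺ ∷_)) ks)
           (alternate (C ∘ (k ∷_) ∘ (k⁺ ∷_)) ks) ⟩
    (C (k⁺ ∷ mapSuc ks) - B lo)
      - (alternate (C ∘ (k⁺ ∷_) ∘ (k⁺ ∷_)) ks
         - (alternate (C ∘ (k ∷_) ∘ (k⁺ ∷_)) ks - alternate (C ∘ (k ∷_) ∘ (k ∷_)) ks))
      ≡⟨ cong (λ x → (C (k⁺ ∷ mapSuc ks) - B lo) - x) cancel ⟩
    (C (k⁺ ∷ mapSuc ks) - B lo) - 0ℚ
      ≡⟨ solve 1 (λ x → x :- con 0ℚ := x) refl (C (k⁺ ∷ mapSuc ks) - B lo) ⟩
    C (k⁺ ∷ mapSuc ks) - B lo ∎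
    where
    k⁺ = k ℤ.+ ℤ.+ 1
    -- The right-hand side for `ks` with the first entry fixed at `l`. Its difference in `l` is the
    -- inner sum, so the part with first entry below `k` telescopes.
    B : ℤ → ℚ
    B l = C (l ∷ mapSuc ks) - alternate (C ∘ (l ∷_) ∘ (k ∷_)) ks
    inner : ∀ l → sumOver (diffAll (diffFirst C l)) (rows endOdd k ks) ≡ diff B l
    inner l = begin
      sumOver (diffAll (diffFirst C l)) (rows endOdd k ks)
        ≡⟨ sum-rows-odd b k ks (diffFirst C l) (Increasing-weaken ks (≤-suc k) inc)
             (Adjacent-diffFirst C l adj) ⟩
      diffFirst C l (mapSuc ks) - alternate (diffFirst C l ∘ (k ∷_)) ks
        ≡⟨ cong (λ x → diffFirst C l (mapSuc ks) - x)
             (alternate-sub (C ∘ (l ℤ.+ ℤ.+ 1 ∷_) ∘ (k ∷_)) (C ∘ (l ∷_) ∘ (k ∷_)) ks) ⟩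
      diffFirst C l (mapSuc ks)
        - (alternate (C ∘ (l ℤ.+ ℤ.+ 1 ∷_) ∘ (k ∷_)) ks - alternate (C ∘ (l ∷_) ∘ (k ∷_)) ks)
        ≡⟨ solve 4 (λ x y s t → (x :- y) :- (s :- t) := (x :- s) :- (y :- t)) refl
             (C (l ℤ.+ ℤ.+ 1 ∷ mapSuc ks)) (C (l ∷ mapSuc ks))
             (alternate (C ∘ (l ℤ.+ ℤ.+ 1 ∷_) ∘ (k ∷_)) ks) (alternate (C ∘ (l ∷_) ∘ (k ∷_)) ks) ⟩
      diff B l ∎
    last : sumOver (diffAll (diffFirst C k)) (rows endOdd k⁺ ks) ≡
      (C (k⁺ ∷ mapSuc ks) - C (k ∷ mapSuc ks))
        - (alternate (C ∘ (k⁺ ∷_) ∘ (k⁺ ∷_)) ks - alternate (C ∘ (k ∷_) ∘ (k⁺ ∷_)) ks)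
    last = trans (sum-rows-odd b k⁺ ks (diffFirst C k) inc (Adjacent-diffFirst C k adj))
      (cong (λ x → diffFirst C k (mapSuc ks) - x)
        (alternate-sub (C ∘ (k⁺ ∷_) ∘ (k⁺ ∷_)) (C ∘ (k ∷_) ∘ (k⁺ ∷_)) ks))
    -- Continuing from `k⁺` instead of `k` after a first entry equal to `k` leaves these three
    -- alternating sums over; they cancel term by term by `adj` at the first two entries.
    cancel : alternate (C ∘ (k⁺ ∷_) ∘ (k⁺ ∷_)) ks
      - (alternate (C ∘ (k ∷_) ∘ (k⁺ ∷_)) ks - alternate (C ∘ (k ∷_) ∘ (k ∷_)) ks) ≡ 0ℚ
    cancel = begin
      z - (y - x)
        ≡⟨ cong (λ u → z - u) (alternate-sub (C ∘ (k ∷_) ∘ (k⁺ ∷_)) (C ∘ (k ∷_) ∘ (k ∷_)) ks) ⟨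
      z - alternate (λ w → C (k ∷ k⁺ ∷ w) - C (k ∷ k ∷ w)) ks
        ≡⟨ cong (λ u → z - u) (alternate-cong ks (λ w l → sym (begin
             C (k⁺ ∷ k⁺ ∷ w)
               ≡⟨ solve 3 (λ p q r → r := (q :- p) :+ ((p :- q) :+ r)) refl
                    (C (k ∷ k ∷ w)) (C (k ∷ k⁺ ∷ w)) (C (k⁺ ∷ k⁺ ∷ w)) ⟩
             (C (k ∷ k⁺ ∷ w) - C (k ∷ k ∷ w)) + ((C (k ∷ k ∷ w) - C (k ∷ k⁺ ∷ w)) + C (k⁺ ∷ k⁺ ∷ w))
               ≡⟨ cong (λ u → (C (k ∷ k⁺ ∷ w) - C (k ∷ k ∷ w)) + u) (adj [] k w (cong suc l)) ⟩
             (C (k ∷ k⁺ ∷ w) - C (k ∷ k ∷ w)) + 0ℚ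
               ≡⟨ ℚₚ.+-identityʳ _ ⟩
             C (k ∷ k⁺ ∷ w) - C (k ∷ k ∷ w) ∎))) ⟩
      z - z
        ≡⟨ ℚₚ.+-inverseʳ z ⟩
      0ℚ ∎
      where
      x = alternate (C ∘ (k ∷_) ∘ (k ∷_)) ks
      y = alternate (C ∘ (k ∷_) ∘ (k⁺ ∷_)) ks
      z = alternate (C ∘ (k⁺ ∷_) ∘ (k⁺ ∷_)) ks

  sgn : ℕ → ℚ
  sgn zero    = 1ℚ
  sgn (suc n) = - sgn n

  VanishesAtEnd : ℤ → ℕ → LFun → Set
  VanishesAtEnd b n C = ∀ v → suc (length v) ≡ n → C (v ++ b ∷ []) ≡ 0ℚ

  -- Only the term with the lower limit in every entry survives, hence the sign: the upper limit of
  -- the last entry is killed by vanishing at `b`, and that of an earlier entry cancels by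
  -- `Adjacent` against the rows beginning with `k`.
  sum-rows-even : ∀ b lo ks C → Increasing b lo ks →
    Adjacent (suc (length ks)) C → VanishesAtEnd b (suc (length ks)) C →
    sumOver (diffAll C) (rows (endEven b) lo ks) ≡ sgn (suc (length ks)) * C (lo ∷ ks)
  sum-rows-even b lo []       C lo≤b adj van = begin
    sumOver (diffAll C) (map (_∷ []) (interval lo b))
      ≡⟨ sumOver-map (diffAll C) (_∷ []) (interval lo b) ⟩
    sumOver (diff (λ l → C (l ∷ []))) (interval lo b)
      ≡⟨ telescope (λ l → C (l ∷ [])) lo≤b ⟩
    C (b ∷ []) - C (lo ∷ [])
      ≡⟨ cong (λ x → x - C (lo ∷ [])) (van [] refl) ⟩
    0ℚ - C (lo ∷ [])
      ≡⟨ solve 1 (λ x → con 0ℚ :- x := (:- con 1ℚ) :* x) refl (C (lo ∷ [])) ⟩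
    (- 1ℚ) * C (lo ∷ []) ∎
  sum-rows-even b lo (k ∷ ks) C (lo≤k , inc) adj van = begin
    sumOver (diffAll C) (rows (endEven b) lo (k ∷ ks))
      ≡⟨ sumOver-rows (diffAll C) (endEven b) lo k ks ⟩
    sumOver (λ l → sumOver (diffAll (diffFirst C l)) (rows (endEven b) k ks)) (interval lo k)
      + sumOver (diffAll (diffFirst C k)) (rows (endEven b) k⁺ ks)
      ≡⟨ cong₂ _+_ (trans (sumOver-cong inner (interval lo k)) (telescope B lo≤k))
           (sum-rows-even b k⁺ ks (diffFirst C k) inc (Adjacent-diffFirst C k adj) (van′ k)) ⟩
    (B k - B lo) + s * (C (k⁺ ∷ k⁺ ∷ ks) - C (k ∷ k⁺ ∷ ks))
      ≡⟨ solve 5 (λ s p l r q → ((s :* p) :- (s :* l)) :+ s :* (r :- q) :=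
                                s :* ((p :- q) :+ r) :- s :* l) refl
           s (C (k ∷ k ∷ ks)) (C (lo ∷ k ∷ ks)) (C (k⁺ ∷ k⁺ ∷ ks)) (C (k ∷ k⁺ ∷ ks)) ⟩
    s * ((C (k ∷ k ∷ ks) - C (k ∷ k⁺ ∷ ks)) + C (k⁺ ∷ k⁺ ∷ ks)) - s * C (lo ∷ k ∷ ks)
      ≡⟨ cong (λ x → s * x - s * C (lo ∷ k ∷ ks)) (adj [] k ks refl) ⟩
    s * 0ℚ - s * C (lo ∷ k ∷ ks)
      ≡⟨ solve 2 (λ s x → s :* con 0ℚ :- s :* x := (:- s) :* x) refl s (C (lo ∷ k ∷ ks)) ⟩
    (- s) * C (lo ∷ k ∷ ks) ∎
    where
    k⁺ = k ℤ.+ ℤ.+ 1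
    s = sgn (suc (length ks))
    B : ℤ → ℚ
    B l = s * C (l ∷ k ∷ ks)
    van′ : ∀ l → VanishesAtEnd b (suc (length ks)) (diffFirst C l)
    van′ l v len = cong₂ _-_ (van (_ ∷ v) (cong suc len)) (van (l ∷ v) (cong suc len))
    inner : ∀ l → sumOver (diffAll (diffFirst C l)) (rows (endEven b) k ks) ≡ diff B l
    inner l = trans
      (sum-rows-even b k ks (diffFirst C l) (Increasing-weaken ks (≤-suc k) inc)
        (Adjacent-diffFirst C l adj) (van′ l))
      (sym (*-distribˡ-sub s (C (l ℤ.+ ℤ.+ 1 ∷ k ∷ ks)) (C (l ∷ k ∷ ks))))

-- Binomial coefficients as columns of the determinants.

module ColumnFunctions where

  open ShiftOperators
  open OperatorProduct
  open Determinants
  open RowSums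
  open import Data.Rational using (ℚ; 0ℚ; 1ℚ; _+_; _-_; _*_; -_; _/_; fromℚᵘ)
  open +-*-Solver using (solve; _:+_; _:*_; _:-_; :-_; _:=_; con)
  open ≡-Reasoning

  fromℚᵘ-+ : ∀ p q → fromℚᵘ (p ℚᵘ.+ q) ≡ fromℚᵘ p + fromℚᵘ q
  fromℚᵘ-+ p q = ℚₚ.toℚᵘ-injective (ℚᵘₚ.≃-trans (ℚₚ.toℚᵘ-fromℚᵘ (p ℚᵘ.+ q)) (ℚᵘₚ.≃-sym
    (ℚᵘₚ.≃-trans (ℚₚ.toℚᵘ-homo-+ (fromℚᵘ p) (fromℚᵘ q))
      (ℚᵘₚ.+-cong (ℚₚ.toℚᵘ-fromℚᵘ p) (ℚₚ.toℚᵘ-fromℚᵘ q)))))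

  fromℚᵘ-* : ∀ p q → fromℚᵘ (p ℚᵘ.* q) ≡ fromℚᵘ p * fromℚᵘ q
  fromℚᵘ-* p q = ℚₚ.toℚᵘ-injective (ℚᵘₚ.≃-trans (ℚₚ.toℚᵘ-fromℚᵘ (p ℚᵘ.* q)) (ℚᵘₚ.≃-sym
    (ℚᵘₚ.≃-trans (ℚₚ.toℚᵘ-homo-* (fromℚᵘ p) (fromℚᵘ q))
      (ℚᵘₚ.*-cong (ℚₚ.toℚᵘ-fromℚᵘ p) (ℚₚ.toℚᵘ-fromℚᵘ q)))))

  -- Kept abstract so that the reduction of fractions to lowest terms never unfolds; only the laws
  -- listed here are used, and ring identities treat the values as atoms.
  abstract
    ι : ℤ → ℚ
    ι i = i / 1

    ι-def : ∀ i → ι i ≡ i / 1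
    ι-def i = refl

    inv : ℕ → ℚ
    inv n = ℤ.+ 1 / suc n

    ι-+ : ∀ i j → ι (i ℤ.+ j) ≡ ι i + ι j
    ι-+ i j = trans (ℚₚ.fromℚᵘ-cong {mkℚᵘ (i ℤ.+ j) 0} {mkℚᵘ i 0 ℚᵘ.+ mkℚᵘ j 0} (*≡*
        (cong (ℤ._* ℤ.+ 1) (sym (cong₂ ℤ._+_ (ℤₚ.*-identityʳ i) (ℤₚ.*-identityʳ j))))))
      (fromℚᵘ-+ (mkℚᵘ i 0) (mkℚᵘ j 0))

    ι-1 : ι (ℤ.+ 1) ≡ 1ℚ
    ι-1 = refl

    ι-0 : ι (ℤ.+ 0) ≡ 0ℚ
    ι-0 = refl

    inv-0 : inv 0 ≡ 1ℚ
    inv-0 = refl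

    /≡*inv : ∀ i n → i / suc n ≡ ι i * inv n
    /≡*inv i n = trans (ℚₚ.fromℚᵘ-cong {mkℚᵘ i n} {mkℚᵘ i 0 ℚᵘ.* mkℚᵘ (ℤ.+ 1) n} (*≡*
        (cong₂ ℤ._*_ (sym (ℤₚ.*-identityʳ i)) (cong (λ m → ℤ.+ suc m) (ℕₚ.+-identityʳ n)))))
      (fromℚᵘ-* (mkℚᵘ i 0) (mkℚᵘ (ℤ.+ 1) n))

    suc*inv : ∀ n → ι (ℤ.+ suc n) * inv n ≡ 1ℚ
    suc*inv n = trans (sym (/≡*inv (ℤ.+ suc n) n))
      (ℚₚ.fromℚᵘ-cong {mkℚᵘ (ℤ.+ suc n) n} {mkℚᵘ (ℤ.+ 1) 0} (*≡*
        (trans (ℤₚ.*-identityʳ (ℤ.+ suc n)) (sym (ℤₚ.*-identityˡ (ℤ.+ suc n))))))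

  ι-sub : ∀ i j → ι (i ℤ.- j) ≡ ι i - ι j
  ι-sub i j = begin
    ι (i ℤ.- j)                    ≡⟨ solve 2 (λ a b → a := (a :+ b) :- b) refl (ι (i ℤ.- j)) (ι j) ⟩
    (ι (i ℤ.- j) + ι j) - ι j      ≡⟨ cong (λ a → a - ι j) (ι-+ (i ℤ.- j) j) ⟨
    ι (i ℤ.- j ℤ.+ j) - ι j        ≡⟨ cong (λ a → ι a - ι j) (ℤ-Solver.solve 2
                                       (λ a b → ((a ℤ-Solver.:- b) ℤ-Solver.:+ b) ℤ-Solver.:= a) refl i j) ⟩
    ι i - ι j                      ∎

  ι-suc : ∀ i → ι (i ℤ.+ ℤ.+ 1) ≡ ι i + 1ℚ
  ι-suc i = trans (ι-+ i (ℤ.+ 1)) (cong (ι i +_) ι-1)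

  qℕ : ℕ → ℚ
  qℕ n = ι (ℤ.+ n)

  qℕ-suc : ∀ n → qℕ (suc n) ≡ qℕ n + 1ℚ
  qℕ-suc n = trans (cong ι (ℤₚ.+-comm (ℤ.+ 1) (ℤ.+ n))) (ι-suc (ℤ.+ n))

  binom : ℕ → ℚ → ℚ
  binom zero    z = 1ℚ
  binom (suc n) z = binom n z * (z - qℕ n) * inv n

  -- The definition adds a factor at the lower end of the falling product, this law one at the upper
  -- end. Comparing the two gives Pascal's rule; applying both leads from column j to column j + 1,
  -- which gains a factor at either end.
  binom-absorb : ∀ n z → binom (suc n) (z + 1ℚ) ≡ binom n z * (z + 1ℚ) * inv n
  binom-absorb zero    z = trans (cong (λ a → 1ℚ * (z + 1ℚ - a) * inv 0) ι-0)
    (solve 2 (λ z i → con 1ℚ :* (z :+ con 1ℚ :- con 0ℚ) :* i := con 1ℚ :* (z :+ con 1ℚ) :* i) refl z (inv 0))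
  binom-absorb (suc n) z = begin
    binom (suc n) (z + 1ℚ) * (z + 1ℚ - qℕ (suc n)) * inv (suc n)
      ≡⟨ cong₂ (λ a b → a * (z + 1ℚ - b) * inv (suc n)) (binom-absorb n z) (qℕ-suc n) ⟩
    (binom n z * (z + 1ℚ) * inv n) * (z + 1ℚ - (qℕ n + 1ℚ)) * inv (suc n)
      ≡⟨ solve 5 (λ b z q i j → (b :* (z :+ con 1ℚ) :* i) :* (z :+ con 1ℚ :- (q :+ con 1ℚ)) :* j :=
                                b :* (z :- q) :* i :* (z :+ con 1ℚ) :* j) refl
           (binom n z) z (qℕ n) (inv n) (inv (suc n)) ⟩
    binom (suc n) z * (z + 1ℚ) * inv (suc n) ∎

  binom-pascal : ∀ n z → binom (suc n) (z + 1ℚ) - binom (suc n) z ≡ binom n z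
  binom-pascal n z = begin
    binom (suc n) (z + 1ℚ) - binom (suc n) z
      ≡⟨ cong (λ a → a - binom (suc n) z) (binom-absorb n z) ⟩
    binom n z * (z + 1ℚ) * inv n - binom n z * (z - qℕ n) * inv n
      ≡⟨ solve 4 (λ b z q i → b :* (z :+ con 1ℚ) :* i :- b :* (z :- q) :* i :=
                              b :* ((q :+ con 1ℚ) :* i)) refl (binom n z) z (qℕ n) (inv n) ⟩
    binom n z * ((qℕ n + 1ℚ) * inv n)
      ≡⟨ cong (λ a → binom n z * (a * inv n)) (qℕ-suc n) ⟨
    binom n z * (qℕ (suc n) * inv n)
      ≡⟨ cong (binom n z *_) (suc*inv n) ⟩
    binom n z * 1ℚ
      ≡⟨ ℚₚ.*-identityʳ _ ⟩
    binom n z ∎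

  double : ℕ → ℕ
  double zero    = zero
  double (suc j) = suc (suc (double j))

  qℕ-double : ∀ j → qℕ (double j) ≡ qℕ j + qℕ j
  qℕ-double zero    = trans ι-0 (sym (cong₂ _+_ ι-0 ι-0))
  qℕ-double (suc j) = begin
    qℕ (suc (suc (double j)))      ≡⟨ trans (qℕ-suc _) (cong (_+ 1ℚ) (qℕ-suc _)) ⟩
    (qℕ (double j) + 1ℚ) + 1ℚ      ≡⟨ cong (λ a → (a + 1ℚ) + 1ℚ) (qℕ-double j) ⟩
    ((qℕ j + qℕ j) + 1ℚ) + 1ℚ      ≡⟨ solve 1 (λ a → ((a :+ a) :+ con 1ℚ) :+ con 1ℚ :=
                                         (a :+ con 1ℚ) :+ (a :+ con 1ℚ)) refl (qℕ j) ⟩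
    (qℕ j + 1ℚ) + (qℕ j + 1ℚ)      ≡⟨ cong₂ _+_ (qℕ-suc j) (qℕ-suc j) ⟨
    qℕ (suc j) + qℕ (suc j)        ∎

  Nilpotent-cong : ∀ n {φ ψ} → φ ≗ ψ → Nilpotent n φ → Nilpotent n ψ
  Nilpotent-cong zero    e nil a = trans (sym (e a)) (nil a)
  Nilpotent-cong (suc n) e nil = Nilpotent-cong n (λ a → cong₂ _-_ (e (a ℤ.+ ℤ.+ 1)) (e a)) nil

  Nilpotent-suc : ∀ n {φ} → Nilpotent n φ → Nilpotent (suc n) φ
  Nilpotent-suc zero    nil a = cong₂ _-_ (nil (a ℤ.+ ℤ.+ 1)) (nil a)
  Nilpotent-suc (suc n) {φ} nil = Nilpotent-suc n {diff φ} nil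

  Nilpotent-mono : ∀ {n m φ} → n ℕ.≤ m → Nilpotent n φ → Nilpotent m φ
  Nilpotent-mono {n} {m} {φ} l nil = go (ℕₚ.≤⇒≤′ l)
    where
    go : ∀ {m} → n ℕ.≤′ m → Nilpotent m φ
    go (ℕ.≤′-reflexive refl) = nil
    go (ℕ.≤′-step {m} l) = Nilpotent-suc m {φ} (go l)

  -- A difference in k turns C(c - k, n + 1) into -C(c - 1 - k, n); the scalar `s` is carried along
  -- to absorb the sign.
  Nilpotent-binom : ∀ n s c → Nilpotent (suc n) (λ k → s * binom n (c - ι k))
  Nilpotent-binom zero    s c a = ℚₚ.+-inverseʳ (s * 1ℚ)
  Nilpotent-binom (suc n) s c = Nilpotent-cong (suc n) step (Nilpotent-binom n (- s) (c - 1ℚ))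
    where
    step : ∀ a → (- s) * binom n ((c - 1ℚ) - ι a) ≡
                 s * binom (suc n) (c - ι (a ℤ.+ ℤ.+ 1)) - s * binom (suc n) (c - ι a)
    step a = begin
      (- s) * binom n y
        ≡⟨ cong ((- s) *_) (binom-pascal n y) ⟨
      (- s) * (binom (suc n) (y + 1ℚ) - binom (suc n) y)
        ≡⟨ solve 3 (λ s p q → (:- s) :* (p :- q) := s :* q :- s :* p) refl s _ _ ⟩
      s * binom (suc n) y - s * binom (suc n) (y + 1ℚ)
        ≡⟨ cong₂ (λ u v → s * binom (suc n) u - s * binom (suc n) v)
             (trans (solve 2 (λ c a → (c :- con 1ℚ) :- a := c :- (a :+ con 1ℚ)) refl c (ι a))
                    (cong (λ u → c - u) (sym (ι-suc a))))
             (solve 2 (λ c a → ((c :- con 1ℚ) :- a) :+ con 1ℚ := c :- a) refl c (ι a)) ⟩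
      s * binom (suc n) (c - ι (a ℤ.+ ℤ.+ 1)) - s * binom (suc n) (c - ι a) ∎
      where y = (c - 1ℚ) - ι a

  module Columns (x : ℤ) where

    -- ± C(x − k + j, 2j) and ± C(x − k + j + 1, 2j + 1): even about k = x + 1/2 and odd
    -- about k = x + 1, respectively. They occur for an odd, resp. even, number of rows.
    evenCol oddCol evenColBack : ℕ → ℤ → ℚ
    evenCol j k = sgn j * binom (double j) ((ι x + qℕ j) - ι k)
    oddCol j k = sgn j * binom (suc (double j)) (((ι x + qℕ j) + 1ℚ) - ι k)
    evenColBack j k = evenCol (suc j) (k ℤ.+ -[1+ 0 ])

    oddCol-nilpotent : ∀ j → Nilpotent (suc (suc (double j))) (oddCol j)
    oddCol-nilpotent j = Nilpotent-binom (suc (double j)) (sgn j) ((ι x + qℕ j) + 1ℚ)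

    diff-oddCol : ∀ j k → diff (oddCol j) k ≡ - evenCol j k
    diff-oddCol j k = begin
      s * binom (suc n) ((c + 1ℚ) - ι (k ℤ.+ ℤ.+ 1)) - s * binom (suc n) ((c + 1ℚ) - ι k)
        ≡⟨ cong₂ (λ u v → s * binom (suc n) u - s * binom (suc n) v)
             (trans (cong (λ u → (c + 1ℚ) - u) (ι-suc k))
               (solve 2 (λ c k → (c :+ con 1ℚ) :- (k :+ con 1ℚ) := c :- k) refl c (ι k)))
             (solve 2 (λ c k → (c :+ con 1ℚ) :- k := (c :- k) :+ con 1ℚ) refl c (ι k)) ⟩
      s * binom (suc n) (c - ι k) - s * binom (suc n) ((c - ι k) + 1ℚ)
        ≡⟨ solve 3 (λ s p q → s :* q :- s :* p := :- (s :* (p :- q))) refl s _ _ ⟩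
      - (s * (binom (suc n) ((c - ι k) + 1ℚ) - binom (suc n) (c - ι k)))
        ≡⟨ cong (λ u → - (s * u)) (binom-pascal n (c - ι k)) ⟩
      - (s * binom n (c - ι k)) ∎
      where
      s = sgn j
      n = double j
      c = ι x + qℕ j

    -- Lowering the argument by 1 has two effects: the forward difference is `oddCol j` itself and
    -- not a shift of it, and raising all entries by `mapSuc` gives back `evenCol (suc j)`.
    diff-evenColBack : ∀ j k → diff (evenColBack j) k ≡ oddCol j k
    diff-evenColBack j k = begin
      evenCol (suc j) (k ℤ.+ ℤ.+ 1 ℤ.+ -[1+ 0 ]) - evenCol (suc j) (k ℤ.+ -[1+ 0 ])
        ≡⟨ cong₂ (λ u v → (- s) * binom (suc n) u - (- s) * binom (suc n) v)
             (cong₂ (λ u v → (ι x + u) - v) (qℕ-suc j)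
               (cong ι (trans (ℤₚ.+-assoc k (ℤ.+ 1) -[1+ 0 ]) (ℤₚ.+-identityʳ k))))
             (cong₂ (λ u v → (ι x + u) - v) (qℕ-suc j) (trans (ι-sub k (ℤ.+ 1)) (cong (λ u → ι k - u) ι-1))) ⟩
      (- s) * binom (suc n) ((ι x + (qℕ j + 1ℚ)) - ι k) - (- s) * binom (suc n) ((ι x + (qℕ j + 1ℚ)) - (ι k - 1ℚ))
        ≡⟨ cong₂ (λ u v → (- s) * binom (suc n) u - (- s) * binom (suc n) v)
             (solve 3 (λ x j k → (x :+ (j :+ con 1ℚ)) :- k := ((x :+ j) :+ con 1ℚ) :- k) refl (ι x) (qℕ j) (ι k))
             (solve 3 (λ x j k → (x :+ (j :+ con 1ℚ)) :- (k :- con 1ℚ) :=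
                                 (((x :+ j) :+ con 1ℚ) :- k) :+ con 1ℚ) refl (ι x) (qℕ j) (ι k)) ⟩
      (- s) * binom (suc n) y - (- s) * binom (suc n) (y + 1ℚ)
        ≡⟨ solve 3 (λ s p q → (:- s) :* p :- (:- s) :* q := s :* (q :- p)) refl s _ _ ⟩
      s * (binom (suc n) (y + 1ℚ) - binom (suc n) y)
        ≡⟨ cong (s *_) (binom-pascal n y) ⟩
      s * binom n y ∎
      where
      s = sgn j
      n = suc (double j)
      y = ((ι x + qℕ j) + 1ℚ) - ι k

    -- `sEven k` is 1/4 - (x + 1/2 - k)² and `sOdd k` is -(x + 1 - k)². With this sign the
    -- difference of two values is (b - a)(2x + 1 - a - b), resp. (b - a)(2x + 2 - a - b), as in the
    -- product formulas; `sgn j` in the columns accounts for it.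
    zOf sEven sOdd : ℤ → ℚ
    zOf k = ι x - ι k
    sEven k = - (zOf k * (zOf k + 1ℚ))
    sOdd k = - ((zOf k + 1ℚ) * (zOf k + 1ℚ))

    -- The values of `sEven` and `sOdd` at the two zeros that column j + 1 has beyond those of
    -- column j: z = j and z = -j - 1 in the even case, z + 1 = j + 1 and z + 1 = -j - 1 in the odd
    -- case.
    cEven cOdd : ℕ → ℚ
    cEven j = - (qℕ j * (qℕ j + 1ℚ))
    cOdd j = - ((qℕ j + 1ℚ) * (qℕ j + 1ℚ))

    invFact : ℕ → ℚ
    invFact zero    = 1ℚ
    invFact (suc n) = invFact n * inv n

    evenCol-newton : ∀ j k → evenCol j k ≡ invFact (double j) * newton cEven j (sEven k)
    evenCol-newton zero    k = refl
    evenCol-newton (suc j) k = begin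
      (- s) * (binom (suc n) ((ι x + qℕ (suc j)) - ι k) * (((ι x + qℕ (suc j)) - ι k) - qℕ (suc n)) * inv (suc n))
        ≡⟨ cong₂ (λ u v → (- s) * (binom (suc n) u * (u - v) * inv (suc n)))
             (trans (cong (λ u → (ι x + u) - ι k) (qℕ-suc j))
               (solve 3 (λ x j k → (x :+ (j :+ con 1ℚ)) :- k := ((x :+ j) :- k) :+ con 1ℚ) refl (ι x) (qℕ j) (ι k)))
             (trans (qℕ-suc n) (cong (_+ 1ℚ) (qℕ-double j))) ⟩
      (- s) * (binom (suc n) (y + 1ℚ) * ((y + 1ℚ) - ((qℕ j + qℕ j) + 1ℚ)) * inv (suc n))
        ≡⟨ cong (λ u → (- s) * (u * ((y + 1ℚ) - ((qℕ j + qℕ j) + 1ℚ)) * inv (suc n))) (binom-absorb n y) ⟩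
      (- s) * ((binom n y * (y + 1ℚ) * inv n) * ((y + 1ℚ) - ((qℕ j + qℕ j) + 1ℚ)) * inv (suc n))
        ≡⟨ solve 7 (λ s b x j k i i′ →
             (:- s) :* ((b :* (((x :+ j) :- k) :+ con 1ℚ) :* i)
               :* ((((x :+ j) :- k) :+ con 1ℚ) :- ((j :+ j) :+ con 1ℚ)) :* i′) :=
             (s :* b) :* (i :* i′) :*
               ((:- ((x :- k) :* ((x :- k) :+ con 1ℚ))) :- (:- (j :* (j :+ con 1ℚ))))) refl
             s (binom n y) (ι x) (qℕ j) (ι k) (inv n) (inv (suc n)) ⟩
      evenCol j k * (inv n * inv (suc n)) * (sEven k - cEven j)
        ≡⟨ cong (λ u → u * (inv n * inv (suc n)) * (sEven k - cEven j)) (evenCol-newton j k) ⟩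
      (invFact n * newton cEven j (sEven k)) * (inv n * inv (suc n)) * (sEven k - cEven j)
        ≡⟨ solve 5 (λ f p i i′ t → (f :* p) :* (i :* i′) :* t := ((f :* i) :* i′) :* (p :* t)) refl
             (invFact n) (newton cEven j (sEven k)) (inv n) (inv (suc n)) (sEven k - cEven j) ⟩
      invFact (suc (suc n)) * newton cEven (suc j) (sEven k) ∎
      where
      s = sgn j
      n = double j
      y = (ι x + qℕ j) - ι k

    oddCol-newton : ∀ j k → oddCol j k ≡ (zOf k + 1ℚ) * (invFact (suc (double j)) * newton cOdd j (sOdd k))
    oddCol-newton zero    k = begin
      1ℚ * (1ℚ * (((ι x + ι (ℤ.+ 0)) + 1ℚ) - ι k - ι (ℤ.+ 0)) * inv 0)
        ≡⟨ cong₂ (λ u i → 1ℚ * (1ℚ * (((ι x + u) + 1ℚ) - ι k - u) * i)) ι-0 inv-0 ⟩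
      1ℚ * (1ℚ * (((ι x + 0ℚ) + 1ℚ) - ι k - 0ℚ) * 1ℚ)
        ≡⟨ solve 2 (λ x k → con 1ℚ :* (con 1ℚ :* (((x :+ con 0ℚ) :+ con 1ℚ) :- k :- con 0ℚ) :* con 1ℚ) :=
             ((x :- k) :+ con 1ℚ) :* ((con 1ℚ :* con 1ℚ) :* con 1ℚ)) refl (ι x) (ι k) ⟩
      (zOf k + 1ℚ) * ((1ℚ * 1ℚ) * 1ℚ)
        ≡⟨ cong (λ i → (zOf k + 1ℚ) * ((1ℚ * i) * 1ℚ)) inv-0 ⟨
      (zOf k + 1ℚ) * ((1ℚ * inv 0) * 1ℚ) ∎
    oddCol-newton (suc j) k = begin
      (- s) * (binom (suc n) Y * (Y - qℕ (suc n)) * inv (suc n))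
        ≡⟨ cong₂ (λ u v → (- s) * (binom (suc n) u * (u - v) * inv (suc n)))
             (trans (cong (λ u → ((ι x + u) + 1ℚ) - ι k) (qℕ-suc j))
               (solve 3 (λ x j k → ((x :+ (j :+ con 1ℚ)) :+ con 1ℚ) :- k :=
                                   (((x :+ j) :+ con 1ℚ) :- k) :+ con 1ℚ) refl (ι x) (qℕ j) (ι k)))
             (trans (qℕ-suc n) (cong (_+ 1ℚ) (trans (qℕ-suc (double j)) (cong (_+ 1ℚ) (qℕ-double j))))) ⟩
      (- s) * (binom (suc n) (y + 1ℚ) * ((y + 1ℚ) - (((qℕ j + qℕ j) + 1ℚ) + 1ℚ)) * inv (suc n))
        ≡⟨ cong (λ u → (- s) * (u * ((y + 1ℚ) - (((qℕ j + qℕ j) + 1ℚ) + 1ℚ)) * inv (suc n))) (binom-absorb n y) ⟩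
      (- s) * ((binom n y * (y + 1ℚ) * inv n) * ((y + 1ℚ) - (((qℕ j + qℕ j) + 1ℚ) + 1ℚ)) * inv (suc n))
        ≡⟨ solve 7 (λ s b x j k i i′ →
             (:- s) :* ((b :* ((((x :+ j) :+ con 1ℚ) :- k) :+ con 1ℚ) :* i)
               :* (((((x :+ j) :+ con 1ℚ) :- k) :+ con 1ℚ) :- (((j :+ j) :+ con 1ℚ) :+ con 1ℚ)) :* i′) :=
             (s :* b) :* (i :* i′) :*
               ((:- (((x :- k) :+ con 1ℚ) :* ((x :- k) :+ con 1ℚ))) :- (:- ((j :+ con 1ℚ) :* (j :+ con 1ℚ))))) refl
             s (binom n y) (ι x) (qℕ j) (ι k) (inv n) (inv (suc n)) ⟩
      oddCol j k * (inv n * inv (suc n)) * (sOdd k - cOdd j)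
        ≡⟨ cong (λ u → u * (inv n * inv (suc n)) * (sOdd k - cOdd j)) (oddCol-newton j k) ⟩
      ((zOf k + 1ℚ) * (invFact n * newton cOdd j (sOdd k))) * (inv n * inv (suc n)) * (sOdd k - cOdd j)
        ≡⟨ solve 6 (λ z f p i i′ t → (z :* (f :* p)) :* (i :* i′) :* t := z :* (((f :* i) :* i′) :* (p :* t))) refl
             (zOf k + 1ℚ) (invFact n) (newton cOdd j (sOdd k)) (inv n) (inv (suc n)) (sOdd k - cOdd j) ⟩
      (zOf k + 1ℚ) * (invFact (suc (suc n)) * newton cOdd (suc j) (sOdd k)) ∎
      where
      s = sgn j
      n = suc (double j)
      y = ((ι x + qℕ j) + 1ℚ) - ι k
      Y = ((ι x + qℕ (suc j)) + 1ℚ) - ι k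

    -- Twice the centre x + 1 of antisymmetry of the odd columns.
    centre : ℤ
    centre = (x ℤ.+ ℤ.+ 1) ℤ.+ (x ℤ.+ ℤ.+ 1)

    -- In the Newton form everything but the first factor x + 1 - k is a function of its square.
    oddCol-odd : ∀ j k → oddCol j (centre ℤ.- k) ≡ - oddCol j k
    oddCol-odd j k = begin
      oddCol j k′
        ≡⟨ oddCol-newton j k′ ⟩
      Z k′ * (invFact (suc (double j)) * newton cOdd j (- (Z k′ * Z k′)))
        ≡⟨ cong (λ z → z * (invFact (suc (double j)) * newton cOdd j (- (z * z)))) flip ⟩
      (- Z k) * (invFact (suc (double j)) * newton cOdd j (- ((- Z k) * (- Z k))))
        ≡⟨ cong (λ z → (- Z k) * (invFact (suc (double j)) * newton cOdd j (- z)))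
             (solve 1 (λ z → (:- z) :* (:- z) := z :* z) refl (Z k)) ⟩
      (- Z k) * (invFact (suc (double j)) * newton cOdd j (sOdd k))
        ≡⟨ ℚₚ.neg-distribˡ-* (Z k) _ ⟨
      - (Z k * (invFact (suc (double j)) * newton cOdd j (sOdd k)))
        ≡⟨ cong -_ (oddCol-newton j k) ⟨
      - oddCol j k ∎
      where
      k′ = centre ℤ.- k
      Z : ℤ → ℚ
      Z k = zOf k + 1ℚ
      flip : Z k′ ≡ - Z k
      flip = trans
        (cong (λ u → (ι x - u) + 1ℚ) (trans (ι-sub centre k)
          (cong (λ u → u - ι k) (trans (ι-+ (x ℤ.+ ℤ.+ 1) (x ℤ.+ ℤ.+ 1)) (cong₂ _+_ (ι-suc x) (ι-suc x))))))
        (solve 2 (λ x k → (x :- (((x :+ con 1ℚ) :+ (x :+ con 1ℚ)) :- k)) :+ con 1ℚ :=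
                          :- ((x :- k) :+ con 1ℚ)) refl (ι x) (ι k))

    detEven detOdd detBack : ℕ → LFun
    detEven m = det m evenCol
    detOdd m = det m oddCol
    detBack m = det m evenColBack

    diffAll-detBack : ∀ m v → diffAll (detBack m) v ≡ detOdd m v
    diffAll-detBack m v = trans (diffAll-det m evenColBack v) (det-cong m diff-evenColBack v)

    diffAll-detOdd : ∀ m v → diffAll (detOdd m) v ≡ sgn m * detEven m v
    diffAll-detOdd m v = begin
      diffAll (detOdd m) v                        ≡⟨ diffAll-det m oddCol v ⟩
      det m (λ j → diff (oddCol j)) v             ≡⟨ det-cong m (λ j k → trans (diff-oddCol j k) (neg≡ (evenCol j k))) v ⟩
      det m (λ j k → (- 1ℚ) * evenCol j k) v      ≡⟨ det-scale m (λ _ → - 1ℚ) evenCol v ⟩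
      prodTo-ℚ m (λ _ → - 1ℚ) * detEven m v       ≡⟨ cong (_* detEven m v) (powers m) ⟩
      sgn m * detEven m v                         ∎
      where
      neg≡ : ∀ a → - a ≡ (- 1ℚ) * a
      neg≡ = solve 1 (λ a → :- a := (:- con 1ℚ) :* a) refl
      powers : ∀ m → prodTo-ℚ m (λ _ → - 1ℚ) ≡ sgn m
      powers zero    = refl
      powers (suc m) = trans (cong ((- 1ℚ) *_) (powers m)) (sym (neg≡ (sgn m)))

    det-mapSuc : ∀ m φ v → det m φ (mapSuc v) ≡ det m (λ j k → φ j (k ℤ.+ ℤ.+ 1)) v
    det-mapSuc zero    φ []      = refl
    det-mapSuc zero    φ (a ∷ v) = refl
    det-mapSuc (suc m) φ v = go (φ 0) v (det m (φ ∘ suc)) (det m (λ j k → φ (suc j) (k ℤ.+ ℤ.+ 1)))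
                               (det-mapSuc m (φ ∘ suc))
      where
      go : ∀ ψ v G H → (∀ w → G (mapSuc w) ≡ H w) →
           wedge ψ G (mapSuc v) ≡ wedge (ψ ∘ (ℤ._+ ℤ.+ 1)) H v
      go ψ []      G H e = refl
      go ψ (a ∷ v) G H e = cong₂ (λ p q → ψ (a ℤ.+ ℤ.+ 1) * p - q) (e v)
        (go ψ v (G ∘ (a ℤ.+ ℤ.+ 1 ∷_)) (H ∘ (a ∷_)) (e ∘ (a ∷_)))

    detEven-suc : ∀ m v → detEven (suc m) v ≡ wedge (λ _ → 1ℚ) (detBack m ∘ mapSuc) v
    detEven-suc m v = wedge-cong (λ _ → refl) (λ w → sym (trans (det-mapSuc m evenColBack w)
      (det-cong m (λ j k → cong (evenCol (suc j))
        (trans (ℤₚ.+-assoc k (ℤ.+ 1) -[1+ 0 ]) (ℤₚ.+-identityʳ k))) w))) v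

    detEven-product : ∀ m v → length v ≡ m →
      detEven m v ≡ prodTo-ℚ m (invFact ∘ double) * vandermonde sEven v
    detEven-product m v l = begin
      det m evenCol v
        ≡⟨ det-cong m evenCol-newton v ⟩
      det m (λ j k → invFact (double j) * newton cEven j (sEven k)) v
        ≡⟨ det-scale m (invFact ∘ double) (λ j k → newton cEven j (sEven k)) v ⟩
      prodTo-ℚ m (invFact ∘ double) * det m (λ j k → newton cEven j (sEven k)) v
        ≡⟨ cong (prodTo-ℚ m (invFact ∘ double) *_) (det-newton m cEven sEven v l) ⟩
      prodTo-ℚ m (invFact ∘ double) * vandermonde sEven v ∎

    detOdd-product : ∀ m v → length v ≡ m →
      detOdd m v ≡ prodOver (λ k → zOf k + 1ℚ) v * (prodTo-ℚ m (invFact ∘ suc ∘ double) * vandermonde sOdd v)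
    detOdd-product m v l = begin
      det m oddCol v
        ≡⟨ det-cong m oddCol-newton v ⟩
      det m (λ j k → (zOf k + 1ℚ) * (invFact (suc (double j)) * newton cOdd j (sOdd k))) v
        ≡⟨ det-rows m (λ k → zOf k + 1ℚ) (λ j k → invFact (suc (double j)) * newton cOdd j (sOdd k)) v ⟩
      Π * det m (λ j k → invFact (suc (double j)) * newton cOdd j (sOdd k)) v
        ≡⟨ cong (Π *_) (trans (det-scale m (invFact ∘ suc ∘ double) (λ j k → newton cOdd j (sOdd k)) v)
             (cong (prodTo-ℚ m (invFact ∘ suc ∘ double) *_) (det-newton m cOdd sOdd v l))) ⟩
      Π * (prodTo-ℚ m (invFact ∘ suc ∘ double) * vandermonde sOdd v) ∎
      where Π = prodOver (λ k → zOf k + 1ℚ) v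

-- The product formulas as determinants.

module ProductFormulas where

  open ShiftOperators
  open OperatorProduct
  open Determinants
  open RowSums
  open ColumnFunctions
  open import Data.Rational using (ℚ; 1ℚ; _+_; _-_; _*_; -_; _/_)
  open +-*-Solver using (solve; _:+_; _:*_; _:-_; :-_; _:=_; con)
  open ≡-Reasoning

  allFin-suc : ∀ m → allFin (suc m) ≡ Fin.zero ∷ map Fin.suc (allFin m)
  allFin-suc m = cong (Fin.zero ∷_) (sym (Listₚ.map-tabulate id Fin.suc))

  fromZero : ∀ {m} → Fin m → Fin (suc m) × Fin (suc m)
  fromZero q = Fin.zero , Fin.suc q

  sucs : ∀ {m} → Fin m × Fin m → Fin (suc m) × Fin (suc m)
  sucs (p , q) = Fin.suc p , Fin.suc q

  concatMap-[-] : ∀ {A B : Set} (f : A → B) xs → concatMap (λ x → f x ∷ []) xs ≡ map f xs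
  concatMap-[-] f []       = refl
  concatMap-[-] f (x ∷ xs) = cong (f x ∷_) (concatMap-[-] f xs)

  pairs-suc : ∀ m → pairs (suc m) ≡ map fromZero (allFin m) ++ map sucs (pairs m)
  pairs-suc m = begin
    concatMap row′ (allFin (suc m))
      ≡⟨ cong (concatMap row′) (allFin-suc m) ⟩
    row′ Fin.zero ++ concatMap row′ (map Fin.suc (allFin m))
      ≡⟨ cong₂ _++_ first rest ⟩
    map fromZero (allFin m) ++ map sucs (pairs m) ∎
    where
    cell : ∀ {m} → Fin m → Fin m → List (Fin m × Fin m)
    cell p q = if toℕ p ℕ.<ᵇ toℕ q then (p , q) ∷ [] else []
    row′ : ∀ {m} → Fin m → List (Fin m × Fin m)
    row′ {m} p = concatMap (cell p) (allFin m)
    first : row′ {suc m} Fin.zero ≡ map fromZero (allFin m)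
    first = begin
      concatMap (cell Fin.zero) (allFin (suc m))           ≡⟨ cong (concatMap (cell Fin.zero)) (allFin-suc m) ⟩
      concatMap (cell Fin.zero) (map Fin.suc (allFin m))   ≡⟨ Listₚ.concatMap-map (cell Fin.zero) Fin.suc (allFin m) ⟩
      concatMap (cell Fin.zero ∘ Fin.suc) (allFin m)       ≡⟨ concatMap-[-] fromZero (allFin m) ⟩
      map fromZero (allFin m)                              ∎
    cell-suc : ∀ p q → cell (Fin.suc p) (Fin.suc q) ≡ map sucs (cell {m} p q)
    cell-suc p q with toℕ p ℕ.<ᵇ toℕ q
    ... | true  = refl
    ... | false = refl
    row-suc : ∀ p → row′ (Fin.suc p) ≡ map sucs (row′ p)
    row-suc p = begin
      concatMap (cell (Fin.suc p)) (allFin (suc m))          ≡⟨ cong (concatMap (cell (Fin.suc p))) (allFin-suc m) ⟩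
      concatMap (cell (Fin.suc p)) (map Fin.suc (allFin m))  ≡⟨ Listₚ.concatMap-map (cell (Fin.suc p)) Fin.suc (allFin m) ⟩
      concatMap (cell (Fin.suc p) ∘ Fin.suc) (allFin m)      ≡⟨ Listₚ.concatMap-cong (cell-suc p) (allFin m) ⟩
      concatMap (map sucs ∘ cell p) (allFin m)               ≡⟨ Listₚ.map-concatMap sucs (cell p) (allFin m) ⟨
      map sucs (row′ p)                                      ∎
    rest : concatMap row′ (map Fin.suc (allFin m)) ≡ map sucs (pairs m)
    rest = begin
      concatMap row′ (map Fin.suc (allFin m))   ≡⟨ Listₚ.concatMap-map row′ Fin.suc (allFin m) ⟩
      concatMap (row′ ∘ Fin.suc) (allFin m)     ≡⟨ Listₚ.concatMap-cong row-suc (allFin m) ⟩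
      concatMap (map sucs ∘ row′) (allFin m)    ≡⟨ Listₚ.map-concatMap sucs row′ (allFin m) ⟨
      map sucs (pairs m)                        ∎

  module _ {A : Set} where

    prodℚ-++ : ∀ (g : A → ℚ) xs ys → prodℚ g (xs ++ ys) ≡ prodℚ g xs * prodℚ g ys
    prodℚ-++ g []       ys = sym (ℚₚ.*-identityˡ _)
    prodℚ-++ g (x ∷ xs) ys = trans (cong (g x *_) (prodℚ-++ g xs ys)) (sym (ℚₚ.*-assoc (g x) _ _))

    prodℚ-map : ∀ {B : Set} (g : A → ℚ) (h : B → A) xs → prodℚ g (map h xs) ≡ prodℚ (g ∘ h) xs
    prodℚ-map g h []       = refl
    prodℚ-map g h (x ∷ xs) = cong (g (h x) *_) (prodℚ-map g h xs)

    prodℚ-cong : ∀ {g h : A → ℚ} → g ≗ h → ∀ xs → prodℚ g xs ≡ prodℚ h xs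
    prodℚ-cong e []       = refl
    prodℚ-cong e (x ∷ xs) = cong₂ _*_ (e x) (prodℚ-cong e xs)

    prodℚ-* : ∀ (g h : A → ℚ) xs → prodℚ (λ x → g x * h x) xs ≡ prodℚ g xs * prodℚ h xs
    prodℚ-* g h []       = refl
    prodℚ-* g h (x ∷ xs) = trans (cong (g x * h x *_) (prodℚ-* g h xs))
      (solve 4 (λ a b c d → (a :* b) :* (c :* d) := (a :* c) :* (b :* d)) refl
        (g x) (h x) (prodℚ g xs) (prodℚ h xs))

  prodℚ-pairs-suc : ∀ m (g : Fin (suc m) × Fin (suc m) → ℚ) →
    prodℚ g (pairs (suc m)) ≡ prodℚ (g ∘ fromZero) (allFin m) * prodℚ (g ∘ sucs) (pairs m)
  prodℚ-pairs-suc m g = begin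
    prodℚ g (pairs (suc m))
      ≡⟨ cong (prodℚ g) (pairs-suc m) ⟩
    prodℚ g (map fromZero (allFin m) ++ map sucs (pairs m))
      ≡⟨ prodℚ-++ g (map fromZero (allFin m)) (map sucs (pairs m)) ⟩
    prodℚ g (map fromZero (allFin m)) * prodℚ g (map sucs (pairs m))
      ≡⟨ cong₂ _*_ (prodℚ-map g fromZero (allFin m)) (prodℚ-map g sucs (pairs m)) ⟩
    prodℚ (g ∘ fromZero) (allFin m) * prodℚ (g ∘ sucs) (pairs m) ∎

  prodℚ-allFin-suc : ∀ m (f : Fin (suc m) → ℚ) →
    prodℚ f (allFin (suc m)) ≡ f Fin.zero * prodℚ (f ∘ Fin.suc) (allFin m)
  prodℚ-allFin-suc m f = trans (cong (prodℚ f) (allFin-suc m))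
    (cong (f Fin.zero *_) (prodℚ-map f Fin.suc (allFin m)))

  prodℚ-toℕ : ∀ m f → prodℚ (f ∘ toℕ) (allFin m) ≡ prodTo-ℚ m f
  prodℚ-toℕ zero    f = refl
  prodℚ-toℕ (suc m) f = trans (prodℚ-allFin-suc m (f ∘ toℕ)) (cong (f 0 *_) (prodℚ-toℕ m (f ∘ suc)))

  prodℚ-toList : ∀ m (χ : ℤ → ℚ) (k : Vector ℤ m) → prodℚ (χ ∘ k) (allFin m) ≡ prodOver χ (toList k)
  prodℚ-toList zero    χ k = refl
  prodℚ-toList (suc m) χ k = trans (prodℚ-allFin-suc m (χ ∘ k))
    (cong (χ (k Fin.zero) *_) (prodℚ-toList m χ (k ∘ Fin.suc)))

  gap : ∀ {m} → (ℤ → ℚ) → Vector ℤ m → Fin m × Fin m → ℚ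
  gap s k (i , j) = s (k j) - s (k i)

  prodℚ-vandermonde : ∀ m (s : ℤ → ℚ) (k : Vector ℤ m) →
    prodℚ (gap s k) (pairs m) ≡ vandermonde s (toList k)
  prodℚ-vandermonde zero    s k = refl
  prodℚ-vandermonde (suc m) s k = trans (prodℚ-pairs-suc m (gap s k))
    (cong₂ _*_ (prodℚ-toList m (λ b → s b - s (k Fin.zero)) (k ∘ Fin.suc))
               (prodℚ-vandermonde m s (k ∘ Fin.suc)))

  prodTo-ℚ-cong : ∀ m {f g : ℕ → ℚ} → f ≗ g → prodTo-ℚ m f ≡ prodTo-ℚ m g
  prodTo-ℚ-cong zero    e = refl
  prodTo-ℚ-cong (suc m) e = cong₂ _*_ (e 0) (prodTo-ℚ-cong m (e ∘ suc))

  prodTo-ℚ-* : ∀ m (f g : ℕ → ℚ) → prodTo-ℚ m (λ j → f j * g j) ≡ prodTo-ℚ m f * prodTo-ℚ m g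
  prodTo-ℚ-* zero    f g = refl
  prodTo-ℚ-* (suc m) f g = trans (cong (f 0 * g 0 *_) (prodTo-ℚ-* m (f ∘ suc) (g ∘ suc)))
    (solve 4 (λ a b c d → (a :* b) :* (c :* d) := (a :* c) :* (b :* d)) refl
      (f 0) (g 0) (prodTo-ℚ m (f ∘ suc)) (prodTo-ℚ m (g ∘ suc)))

  -- 1 / ∏_{i<j} (j − i)(i + j + 1 + σ); unlike the product itself, the shifted family
  -- is closed under removing the first index.
  weight : ℕ → ℕ → ℚ
  weight σ zero    = 1ℚ
  weight σ (suc j) = (inv j * inv (σ ℕ.+ suc j)) * weight (suc (suc σ)) j

  pairWeight : ∀ {m} → ℕ → Fin m × Fin m → ℚ
  pairWeight σ (i , j) = inv (toℕ j ℕ.∸ toℕ i ℕ.∸ 1) * inv (σ ℕ.+ (toℕ i ℕ.+ toℕ j))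

  prodℚ-weight : ∀ m σ → prodℚ (pairWeight σ) (pairs m) ≡ prodTo-ℚ m (weight σ)
  prodℚ-weight zero    σ = refl
  prodℚ-weight (suc m) σ = begin
    prodℚ w (pairs (suc m))
      ≡⟨ prodℚ-pairs-suc m w ⟩
    prodℚ (λ q → inv (toℕ q) * inv (σ ℕ.+ suc (toℕ q))) (allFin m) * prodℚ (w ∘ sucs) (pairs m)
      ≡⟨ cong₂ _*_ (prodℚ-toℕ m (λ j → inv j * inv (σ ℕ.+ suc j)))
           (trans (prodℚ-cong shift-σ (pairs m)) (prodℚ-weight m (suc (suc σ)))) ⟩
    prodTo-ℚ m (λ j → inv j * inv (σ ℕ.+ suc j)) * prodTo-ℚ m (weight (suc (suc σ)))
      ≡⟨ prodTo-ℚ-* m (λ j → inv j * inv (σ ℕ.+ suc j)) (weight (suc (suc σ))) ⟨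
    prodTo-ℚ m (weight σ ∘ suc)
      ≡⟨ ℚₚ.*-identityˡ _ ⟨
    prodTo-ℚ (suc m) (weight σ) ∎
    where
    w : Fin (suc m) × Fin (suc m) → ℚ
    w = pairWeight σ
    shift-σ : ∀ ij → w (sucs ij) ≡ pairWeight (suc (suc σ)) ij
    shift-σ (i , j) = cong (λ n → inv (toℕ j ℕ.∸ toℕ i ℕ.∸ 1) * inv n) (begin
      σ ℕ.+ suc (toℕ i ℕ.+ suc (toℕ j))        ≡⟨ ℕₚ.+-suc σ _ ⟩
      suc (σ ℕ.+ (toℕ i ℕ.+ suc (toℕ j)))      ≡⟨ cong (λ n → suc (σ ℕ.+ n)) (ℕₚ.+-suc (toℕ i) (toℕ j)) ⟩
      suc (σ ℕ.+ suc (toℕ i ℕ.+ toℕ j))        ≡⟨ cong suc (ℕₚ.+-suc σ _) ⟩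
      suc (suc (σ ℕ.+ (toℕ i ℕ.+ toℕ j)))      ∎)

  module Matching (x : ℤ) where
    open Columns x

    -- In closed form `weight σ j` is (σ + j)! / (j! (σ + 2j)!). Only inverse factorials appear in
    -- this arrangement, and raising σ by 2 matches the recursion of `weight`.
    weight-invFact : ∀ σ j → weight σ j * invFact (σ ℕ.+ j) ≡ invFact j * invFact (σ ℕ.+ double j)
    weight-invFact σ zero    = refl
    weight-invFact σ (suc j) = begin
      (inv j * inv (σ ℕ.+ suc j)) * weight σ₂ j * invFact (σ ℕ.+ suc j)
        ≡⟨ solve 4 (λ a b c d → ((a :* b) :* c) :* d := a :* (c :* (d :* b))) refl
             (inv j) (inv (σ ℕ.+ suc j)) (weight σ₂ j) (invFact (σ ℕ.+ suc j)) ⟩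
      inv j * (weight σ₂ j * invFact (suc (σ ℕ.+ suc j)))
        ≡⟨ cong (λ n → inv j * (weight σ₂ j * invFact (suc n))) (ℕₚ.+-suc σ j) ⟩
      inv j * (weight σ₂ j * invFact (σ₂ ℕ.+ j))
        ≡⟨ cong (inv j *_) (weight-invFact σ₂ j) ⟩
      inv j * (invFact j * invFact (σ₂ ℕ.+ double j))
        ≡⟨ solve 3 (λ a b c → a :* (b :* c) := (b :* a) :* c) refl (inv j) (invFact j) _ ⟩
      invFact (suc j) * invFact (σ₂ ℕ.+ double j)
        ≡⟨ cong (λ n → invFact (suc j) * invFact n)
             (trans (cong suc (sym (ℕₚ.+-suc σ (double j)))) (sym (ℕₚ.+-suc σ (suc (double j))))) ⟩
      invFact (suc j) * invFact (σ ℕ.+ double (suc j)) ∎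
      where σ₂ = suc (suc σ)

    fact : ℕ → ℚ
    fact zero    = 1ℚ
    fact (suc n) = qℕ (suc n) * fact n

    fact*invFact : ∀ n → fact n * invFact n ≡ 1ℚ
    fact*invFact zero    = refl
    fact*invFact (suc n) = begin
      (qℕ (suc n) * fact n) * (invFact n * inv n)
        ≡⟨ solve 4 (λ a b c d → (a :* b) :* (c :* d) := (b :* c) :* (a :* d)) refl
             (qℕ (suc n)) (fact n) (invFact n) (inv n) ⟩
      (fact n * invFact n) * (qℕ (suc n) * inv n)
        ≡⟨ cong₂ _*_ (fact*invFact n) (suc*inv n) ⟩
      1ℚ ∎

    invFact-cancel : ∀ n {a b} → a * invFact n ≡ invFact n * b → a ≡ b
    invFact-cancel n {a} {b} e = begin
      a                           ≡⟨ ℚₚ.*-identityʳ a ⟨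
      a * 1ℚ                      ≡⟨ cong (a *_) (fact*invFact n) ⟨
      a * (fact n * invFact n)    ≡⟨ solve 3 (λ a f i → a :* (f :* i) := f :* (a :* i)) refl a (fact n) (invFact n) ⟩
      fact n * (a * invFact n)    ≡⟨ cong (fact n *_) e ⟩
      fact n * (invFact n * b)    ≡⟨ ℚₚ.*-assoc (fact n) (invFact n) b ⟨
      (fact n * invFact n) * b    ≡⟨ cong (_* b) (fact*invFact n) ⟩
      1ℚ * b                      ≡⟨ ℚₚ.*-identityˡ b ⟩
      b                           ∎

    weight-0 : ∀ j → weight 0 j ≡ invFact (double j)
    weight-0 j = invFact-cancel j (weight-invFact 0 j)

    -- The closed form of `weight 1 j` is (j + 1) / (2j + 1)!; the factor j + 1 is cancelled by the
    -- single product of the 1 / i in the even formula.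
    weight-1 : ∀ j → weight 1 j * inv j ≡ invFact (suc (double j))
    weight-1 j = invFact-cancel j (begin
      weight 1 j * inv j * invFact j
        ≡⟨ solve 3 (λ a b c → a :* b :* c := a :* (c :* b)) refl (weight 1 j) (inv j) (invFact j) ⟩
      weight 1 j * invFact (suc j)
        ≡⟨ weight-invFact 1 j ⟩
      invFact j * invFact (suc (double j)) ∎)

    -- The parities cross: `Fodd` is named after the number of rows, `detEven` after the symmetry of
    -- its columns.
    Fodd≡detEven : ∀ m (k : Vector ℤ m) → Fodd m x k ≡ detEven m (toList k)
    Fodd≡detEven m k = begin
      Fodd m x k
        ≡⟨ prodℚ-cong entry≡ (pairs m) ⟩
      prodℚ (λ ij → num ij * den ij) (pairs m)
        ≡⟨ prodℚ-* num den (pairs m) ⟩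
      prodℚ num (pairs m) * prodℚ den (pairs m)
        ≡⟨ cong₂ _*_ (prodℚ-vandermonde m sEven k)
             (trans (prodℚ-weight m 0) (prodTo-ℚ-cong m weight-0)) ⟩
      vandermonde sEven (toList k) * prodTo-ℚ m (invFact ∘ double)
        ≡⟨ ℚₚ.*-comm _ (prodTo-ℚ m (invFact ∘ double)) ⟩
      prodTo-ℚ m (invFact ∘ double) * vandermonde sEven (toList k)
        ≡⟨ detEven-product m (toList k) (Listₚ.length-tabulate k) ⟨
      detEven m (toList k) ∎
      where
      num den : Fin m × Fin m → ℚ
      num = gap sEven k
      den = pairWeight 0
      entry≡ : ∀ (ij : Fin m × Fin m) → _ ≡ num ij * den ij
      entry≡ (i , j) = begin
        (b ℤ.- a) / suc d * ((ℤ.+ 2 ℤ.* x ℤ.+ ℤ.+ 1 ℤ.- a ℤ.- b) / suc e)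
          ≡⟨ cong₂ _*_ (/≡*inv (b ℤ.- a) d) (/≡*inv (ℤ.+ 2 ℤ.* x ℤ.+ ℤ.+ 1 ℤ.- a ℤ.- b) e) ⟩
        (ι (b ℤ.- a) * inv d) * (ι (ℤ.+ 2 ℤ.* x ℤ.+ ℤ.+ 1 ℤ.- a ℤ.- b) * inv e)
          ≡⟨ cong₂ (λ u v → (u * inv d) * (v * inv e)) (ι-sub b a)
               (trans (ι-sub (ℤ.+ 2 ℤ.* x ℤ.+ ℤ.+ 1 ℤ.- a) b)
                 (cong (λ u → u - ι b) (trans (ι-sub (ℤ.+ 2 ℤ.* x ℤ.+ ℤ.+ 1) a)
                   (cong (λ u → u - ι a) (trans (ι-suc (ℤ.+ 2 ℤ.* x)) (cong (_+ 1ℚ) ι-double)))))) ⟩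
        ((ι b - ι a) * inv d) * ((((ι x + ι x) + 1ℚ) - ι a - ι b) * inv e)
          ≡⟨ solve 5 (λ x a b d e → ((b :- a) :* d) :* ((((x :+ x) :+ con 1ℚ) :- a :- b) :* e) :=
               ((:- ((x :- b) :* ((x :- b) :+ con 1ℚ))) :- (:- ((x :- a) :* ((x :- a) :+ con 1ℚ)))) :* (d :* e))
               refl (ι x) (ι a) (ι b) (inv d) (inv e) ⟩
        (sEven b - sEven a) * (inv d * inv e) ∎
        where
        a = k i
        b = k j
        d = toℕ j ℕ.∸ toℕ i ℕ.∸ 1
        e = toℕ i ℕ.+ toℕ j
        ι-double : ι (ℤ.+ 2 ℤ.* x) ≡ ι x + ι x
        ι-double = trans (cong ι (trans (ℤₚ.*-distribʳ-+ x (ℤ.+ 1) (ℤ.+ 1))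
          (cong₂ ℤ._+_ (ℤₚ.*-identityˡ x) (ℤₚ.*-identityˡ x)))) (ι-+ x x)

    Feven≡detOdd : ∀ m (k : Vector ℤ m) → Feven m x k ≡ detOdd m (toList k)
    Feven≡detOdd m k = begin
      Feven m x k
        ≡⟨ cong₂ _*_ (trans (prodℚ-cong entry≡ (pairs m)) (prodℚ-* num den (pairs m)))
             (trans (prodℚ-cong single≡ (allFin m)) (prodℚ-* (λ i → zOf (k i) + 1ℚ) (inv ∘ toℕ) (allFin m))) ⟩
      (prodℚ num (pairs m) * prodℚ den (pairs m))
        * (prodℚ (λ i → zOf (k i) + 1ℚ) (allFin m) * prodℚ (inv ∘ toℕ) (allFin m))
        ≡⟨ cong₂ _*_ (cong₂ _*_ (prodℚ-vandermonde m sOdd k) (prodℚ-weight m 1))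
             (cong₂ _*_ (prodℚ-toList m (λ a → zOf a + 1ℚ) k) (prodℚ-toℕ m inv)) ⟩
      (vandermonde sOdd v * prodTo-ℚ m (weight 1)) * (Π * prodTo-ℚ m inv)
        ≡⟨ solve 4 (λ a b c d → (a :* b) :* (c :* d) := c :* ((b :* d) :* a)) refl
             (vandermonde sOdd v) (prodTo-ℚ m (weight 1)) Π (prodTo-ℚ m inv) ⟩
      Π * ((prodTo-ℚ m (weight 1) * prodTo-ℚ m inv) * vandermonde sOdd v)
        ≡⟨ cong (λ c → Π * (c * vandermonde sOdd v))
             (trans (sym (prodTo-ℚ-* m (weight 1) inv)) (prodTo-ℚ-cong m weight-1)) ⟩
      Π * (prodTo-ℚ m (invFact ∘ suc ∘ double) * vandermonde sOdd v)
        ≡⟨ detOdd-product m v (Listₚ.length-tabulate k) ⟨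
      detOdd m v ∎
      where
      v = toList k
      Π = prodOver (λ a → zOf a + 1ℚ) v
      num den : Fin m × Fin m → ℚ
      num = gap sOdd k
      den = pairWeight 1
      single≡ : ∀ i → (x ℤ.+ ℤ.+ 1 ℤ.- k i) / suc (toℕ i) ≡ (zOf (k i) + 1ℚ) * inv (toℕ i)
      single≡ i = trans (/≡*inv (x ℤ.+ ℤ.+ 1 ℤ.- k i) (toℕ i)) (cong (_* inv (toℕ i))
        (trans (ι-sub (x ℤ.+ ℤ.+ 1) (k i)) (trans (cong (λ u → u - ι (k i)) (ι-suc x))
          (solve 2 (λ x a → (x :+ con 1ℚ) :- a := (x :- a) :+ con 1ℚ) refl (ι x) (ι (k i))))))
      entry≡ : ∀ (ij : Fin m × Fin m) → _ ≡ num ij * den ij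
      entry≡ (i , j) = begin
        (b ℤ.- a) / suc d * ((ℤ.+ 2 ℤ.* x ℤ.+ ℤ.+ 2 ℤ.- a ℤ.- b) / suc e)
          ≡⟨ cong₂ _*_ (/≡*inv (b ℤ.- a) d) (/≡*inv (ℤ.+ 2 ℤ.* x ℤ.+ ℤ.+ 2 ℤ.- a ℤ.- b) e) ⟩
        (ι (b ℤ.- a) * inv d) * (ι (ℤ.+ 2 ℤ.* x ℤ.+ ℤ.+ 2 ℤ.- a ℤ.- b) * inv e)
          ≡⟨ cong₂ (λ u v → (u * inv d) * (v * inv e)) (ι-sub b a)
               (trans (ι-sub (ℤ.+ 2 ℤ.* x ℤ.+ ℤ.+ 2 ℤ.- a) b)
                 (cong (λ u → u - ι b) (trans (ι-sub (ℤ.+ 2 ℤ.* x ℤ.+ ℤ.+ 2) a)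
                   (cong (λ u → u - ι a) (trans (ι-+ (ℤ.+ 2 ℤ.* x) (ℤ.+ 2)) (cong₂ _+_ ι-double ι-2)))))) ⟩
        ((ι b - ι a) * inv d) * ((((ι x + ι x) + (1ℚ + 1ℚ)) - ι a - ι b) * inv e)
          ≡⟨ solve 5 (λ x a b d e → ((b :- a) :* d) :* ((((x :+ x) :+ (con 1ℚ :+ con 1ℚ)) :- a :- b) :* e) :=
               ((:- (((x :- b) :+ con 1ℚ) :* ((x :- b) :+ con 1ℚ)))
                 :- (:- (((x :- a) :+ con 1ℚ) :* ((x :- a) :+ con 1ℚ)))) :* (d :* e))
               refl (ι x) (ι a) (ι b) (inv d) (inv e) ⟩
        (sOdd b - sOdd a) * (inv d * inv e) ∎
        where
        a = k i
        b = k j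
        d = toℕ j ℕ.∸ toℕ i ℕ.∸ 1
        e = suc (toℕ i ℕ.+ toℕ j)
        ι-2 : ι (ℤ.+ 2) ≡ 1ℚ + 1ℚ
        ι-2 = trans (ι-suc (ℤ.+ 1)) (cong (_+ 1ℚ) ι-1)
        ι-double : ι (ℤ.+ 2 ℤ.* x) ≡ ι x + ι x
        ι-double = trans (cong ι (trans (ℤₚ.*-distribʳ-+ x (ℤ.+ 1) (ℤ.+ 1))
          (cong₂ ℤ._+_ (ℤₚ.*-identityˡ x) (ℤₚ.*-identityˡ x)))) (ι-+ x x)

  -- Transfer of the operators from vectors to lists.

  toList-updateAt : ∀ {m} (k : Vector ℤ m) (j : Fin m) d →
                    toList (updateAt k j (ℤ._+ d)) ≡ sh (toℕ j) d (toList k)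
  toList-updateAt {suc m} k Fin.zero    d = refl
  toList-updateAt {suc m} k (Fin.suc j) d = cong (k Fin.zero ∷_) (toList-updateAt (k ∘ Fin.suc) j d)

  infix 4 _⊢_
  -- `T` and `P` agree along `toList`. Asking for this whenever `F` and `f` agree pointwise takes
  -- the place of function extensionality and makes the relation compose.
  record _⊢_ {m : ℕ} (T : Fun m → Fun m) (P : Op) : Set where
    constructor mk⊢
    field act : ∀ F f → (∀ k → F k ≡ f (toList k)) → ∀ k → T F k ≡ ⟦ P ⟧ f (toList k)
  open _⊢_

  module _ {m : ℕ} where

    shift-⊢ : ∀ (j : Fin m) d → shift j d ⊢ X (toℕ j) d
    shift-⊢ j d = mk⊢ λ F f e k → trans (e _) (cong f (toList-updateAt k j d))

    ∘-⊢ : ∀ {T U : Fun m → Fun m} {P Q} → T ⊢ P → U ⊢ Q → T ∘ U ⊢ P ⊗ Q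
    ∘-⊢ {U = U} {Q = Q} t u = mk⊢ λ F f e → act t (U F) (⟦ Q ⟧ f) (act u F f e)

    Δ-⊢ : ∀ (j : Fin m) → Δ j ⊢ D (toℕ j)
    Δ-⊢ j = mk⊢ λ F f e k → cong₂ _-_ (act (shift-⊢ j (ℤ.+ 1)) F f e k) (e k)

    geom-⊢ : ∀ N {T : Fun m → Fun m} {P} → T ⊢ P → geom N T ⊢ geomO N P
    geom-⊢ zero    t = mk⊢ λ F f e → e
    geom-⊢ (suc N) {T} {P} t = mk⊢ λ F f e k →
      cong₂ _-_ (e k) (act t (geom N T F) (⟦ geomO N P ⟧ f) (act (geom-⊢ N t) F f e) k)

  module Bridge (N : ℕ) where
    open Truncated N

    factor-⊢ : ∀ {m} (p q : Fin m) → factor N (p , q) ⊢ fac (toℕ p) (toℕ q)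
    factor-⊢ p q = ∘-⊢ {T = geom N (E q ∘ Δ p)} (geom-⊢ N (∘-⊢ {T = E q} (shift-⊢ q (ℤ.+ 1)) (Δ-⊢ p)))
      (∘-⊢ {T = E p} (shift-⊢ p (ℤ.+ 1)) (geom-⊢ N (∘-⊢ {T = Einv q} (shift-⊢ q -[1+ 0 ]) (Δ-⊢ p))))

    facs : ∀ {m} → List (Fin m × Fin m) → Op
    facs = foldr (λ pq P → fac (toℕ (proj₁ pq)) (toℕ (proj₂ pq)) ⊗ P) I

    facs-⊢ : ∀ {m} (ps : List (Fin m × Fin m)) →
             foldr (λ pq g → factor N pq ∘ g) id ps ⊢ facs ps
    facs-⊢ []             = mk⊢ λ F f e → e
    facs-⊢ ((p , q) ∷ ps) = ∘-⊢ {T = factor N (p , q)} (factor-⊢ p q) (facs-⊢ ps)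

    facs-++ : ∀ {m} (ps qs : List (Fin m × Fin m)) f v → ⟦ facs (ps ++ qs) ⟧ f v ≡ ⟦ facs ps ⟧ (⟦ facs qs ⟧ f) v
    facs-++ []             qs f v = refl
    facs-++ ((p , q) ∷ ps) qs f v = ⟦⟧-cong (fac (toℕ p) (toℕ q)) (facs-++ ps qs f) v

    facs-sucs : ∀ {m} (ps : List (Fin m × Fin m)) → facs (map sucs ps) ≡ lift (facs ps)
    facs-sucs []             = refl
    facs-sucs ((p , q) ∷ ps) = cong₂ _⊗_ (sym (rename-fac suc (toℕ p) (toℕ q))) (facs-sucs ps)

    facs-allFin : ∀ n m g (h : Fin m → Fin n × Fin n) →
      (∀ q → fac (toℕ (proj₁ (h q))) (toℕ (proj₂ (h q))) ≡ g (toℕ q)) →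
      facs (map h (allFin m)) ≡ prodTo m g
    facs-allFin n zero    g h e = refl
    facs-allFin n (suc m) g h e = begin
      facs (map h (allFin (suc m)))
        ≡⟨ cong (facs ∘ map h) (allFin-suc m) ⟩
      facs (h Fin.zero ∷ map h (map Fin.suc (allFin m)))
        ≡⟨ cong₂ _⊗_ (e Fin.zero) (trans (cong facs (sym (Listₚ.map-∘ (allFin m))))
             (facs-allFin n m (g ∘ suc) (h ∘ Fin.suc) (e ∘ Fin.suc))) ⟩
      prodTo (suc m) g ∎

    facs-pairs : ∀ m f v → ⟦ facs (pairs m) ⟧ f v ≡ ⟦ opP m ⟧ f v
    facs-pairs zero    f v = refl
    facs-pairs (suc m) f v = begin
      ⟦ facs (pairs (suc m)) ⟧ f v
        ≡⟨ cong (λ ps → ⟦ facs ps ⟧ f v) (pairs-suc m) ⟩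
      ⟦ facs (map fromZero (allFin m) ++ map sucs (pairs m)) ⟧ f v
        ≡⟨ facs-++ (map fromZero (allFin m)) (map sucs (pairs m)) f v ⟩
      ⟦ facs (map fromZero (allFin m)) ⟧ (⟦ facs (map sucs (pairs m)) ⟧ f) v
        ≡⟨ cong₂ (λ P Q → ⟦ P ⟧ (⟦ Q ⟧ f) v)
             (facs-allFin (suc m) m (λ q → fac 0 (suc q)) fromZero (λ _ → refl)) (facs-sucs (pairs m)) ⟩
      ⟦ row m ⟧ (⟦ lift (facs (pairs m)) ⟧ f) v
        ≡⟨ ⟦⟧-cong (row m) lifted v ⟩
      ⟦ opP (suc m) ⟧ f v ∎
      where
      lifted : ∀ w → ⟦ lift (facs (pairs m)) ⟧ f w ≡ ⟦ lift (opP m) ⟧ f w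
      lifted []      = trans (⟦lift⟧-[] (facs (pairs m)) f)
        (trans (facs-pairs m f []) (sym (⟦lift⟧-[] (opP m) f)))
      lifted (a ∷ w) = trans (⟦lift⟧ (facs (pairs m)) f a w)
        (trans (facs-pairs m (f ∘ (a ∷_)) w) (sym (⟦lift⟧ (opP m) f a w)))

    opProd≡opP : ∀ m F f → (∀ k → F k ≡ f (toList k)) → ∀ k → opProd m N F k ≡ ⟦ opP m ⟧ f (toList k)
    opProd≡opP m F f e k = trans (act (facs-⊢ (pairs m)) F f e k) (facs-pairs m f (toList k))

-- Enumeration of interlacing rows without repetition.

module Enumeration where

  open RowSums

  +1≤⇒< : ∀ {a b} → a ℤ.+ ℤ.+ 1 ℤ.≤ b → a ℤ.< b
  +1≤⇒< {a} {b} l = ℤₚ.suc[i]≤j⇒i<j (subst (ℤ._≤ b) (ℤₚ.+-comm a (ℤ.+ 1)) l)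

  <⇒+1≤ : ∀ {a b} → a ℤ.< b → a ℤ.+ ℤ.+ 1 ℤ.≤ b
  <⇒+1≤ {a} {b} l = subst (ℤ._≤ b) (ℤₚ.+-comm (ℤ.+ 1) a) (ℤₚ.i<j⇒suc[i]≤j l)

  module _ {A B : Set} where

    ∈-concatMap-intro : ∀ (f : A → List B) {xs x y} → x ∈ xs → y ∈ f x → y ∈ concatMap f xs
    ∈-concatMap-intro f (here refl) y∈ = ∈-++⁺ˡ y∈
    ∈-concatMap-intro f {x′ ∷ xs} (there x∈) y∈ = ∈-++⁺ʳ (f x′) (∈-concatMap-intro f x∈ y∈)

    ∈-concatMap-elim : ∀ (f : A → List B) xs {y} → y ∈ concatMap f xs → ∃ λ x → x ∈ xs × y ∈ f x
    ∈-concatMap-elim f (x ∷ xs) y∈ with ∈-++⁻ (f x) y∈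
    ... | inj₁ y∈fx = x , here refl , y∈fx
    ... | inj₂ y∈rest with ∈-concatMap-elim f xs y∈rest
    ...   | x′ , x′∈ , y∈fx′ = x′ , there x′∈ , y∈fx′

    Unique-concatMap : ∀ (f : A → List B) {xs} → Unique xs → (∀ x → x ∈ xs → Unique (f x)) →
      (∀ x x′ y → x ∈ xs → x′ ∈ xs → y ∈ f x → y ∈ f x′ → x ≡ x′) → Unique (concatMap f xs)
    Unique-concatMap f {[]}     u uf sep = []
    Unique-concatMap f {x ∷ xs} (x∉ ∷ u) uf sep = Uniqueₚ.++⁺ (uf x (here refl))
      (Unique-concatMap f u (λ x′ x′∈ → uf x′ (there x′∈))
        (λ a b y a∈ b∈ → sep a b y (there a∈) (there b∈)))
      (λ { (y∈ , y∈′) → disjoint y∈ (∈-concatMap-elim f xs y∈′) })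
      where
      disjoint : ∀ {y} → y ∈ f x → ¬ (∃ λ x′ → x′ ∈ xs × y ∈ f x′)
      disjoint y∈ (x′ , x′∈ , y∈′) =
        All.lookup x∉ x′∈ (sep x x′ _ (here refl) (there x′∈) y∈ y∈′)

  ∈-from⁻ : ∀ a n {l} → l ∈ from a n → a ℤ.≤ l × l ℤ.< a ℤ.+ ℤ.+ n
  ∈-from⁻ a (suc n) (here refl) = ℤₚ.≤-refl ,
    subst (ℤ._< a ℤ.+ ℤ.+ suc n) (ℤₚ.+-identityʳ a) (ℤₚ.+-monoʳ-< a (ℤ.+<+ (ℕ.s≤s ℕ.z≤n)))
  ∈-from⁻ a (suc n) {l} (there l∈) with ∈-from⁻ (a ℤ.+ ℤ.+ 1) n l∈
  ... | a+1≤l , l<a+n = ℤₚ.≤-trans (≤-suc a) a+1≤l , subst (l ℤ.<_) (ℤₚ.+-assoc a (ℤ.+ 1) (ℤ.+ n)) l<a+n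

  ∈-from⁺ : ∀ a n {l} → a ℤ.≤ l → l ℤ.< a ℤ.+ ℤ.+ n → l ∈ from a n
  ∈-from⁺ a zero    {l} a≤l l<a = ⊥-elim (ℤₚ.<-irrefl refl
    (ℤₚ.≤-<-trans a≤l (subst (l ℤ.<_) (ℤₚ.+-identityʳ a) l<a)))
  ∈-from⁺ a (suc n) {l} a≤l l<a+n with a ℤₚ.≟ l
  ... | yes refl = here refl
  ... | no a≢l = there (∈-from⁺ (a ℤ.+ ℤ.+ 1) n (<⇒+1≤ (ℤₚ.≤∧≢⇒< a≤l a≢l))
    (subst (l ℤ.<_) (sym (ℤₚ.+-assoc a (ℤ.+ 1) (ℤ.+ n))) l<a+n))

  Unique-from : ∀ a n → Unique (from a n)
  Unique-from a zero    = []
  Unique-from a (suc n) = All.tabulate (λ { {l} l∈ refl →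
    ℤₚ.<-irrefl refl (+1≤⇒< (proj₁ (∈-from⁻ (a ℤ.+ ℤ.+ 1) n l∈))) }) ∷ Unique-from (a ℤ.+ ℤ.+ 1) n

  ∈-interval⁻ : ∀ {a b l} → a ℤ.≤ b → l ∈ interval a b → a ℤ.≤ l × l ℤ.< b
  ∈-interval⁻ {a} {b} {l} a≤b l∈ with ∈-from⁻ a _ l∈
  ... | a≤l , l<b = a≤l , subst (l ℤ.<_) (a+∣b-a∣≡b a≤b) l<b

  ∈-interval⁺ : ∀ {a b l} → a ℤ.≤ b → a ℤ.≤ l → l ℤ.< b → l ∈ interval a b
  ∈-interval⁺ {a} {b} {l} a≤b a≤l l<b = ∈-from⁺ a _ a≤l (subst (l ℤ.<_) (sym (a+∣b-a∣≡b a≤b)) l<b)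

  HeadAtLeast : ℤ → List ℤ → Set
  HeadAtLeast lo []      = ⊤
  HeadAtLeast lo (a ∷ l) = lo ℤ.≤ a

  -- l₁ ≤ k₁ ≤ l₂ ≤ k₂ ≤ …, with e entries of l after the last k.
  Between : ℕ → List ℤ → List ℤ → Set
  Between e []       l       = length l ≡ e
  Between e (k ∷ ks) []      = ⊥
  Between e (k ∷ ks) (a ∷ l) = a ℤ.≤ k × HeadAtLeast k l × Between e ks l

  Between-length : ∀ e ks l → Between e ks l → length l ≡ length ks ℕ.+ e
  Between-length e []       l       b = b
  Between-length e (k ∷ ks) (a ∷ l) (_ , _ , b) = cong suc (Between-length e ks l b)

  Increasing-bound : ∀ {b} lo l → Increasing b lo l → lo ℤ.≤ b
  Increasing-bound lo []      inc = inc
  Increasing-bound lo (a ∷ l) (lo≤a , inc) =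
    ℤₚ.≤-trans lo≤a (ℤₚ.≤-trans (≤-suc a) (Increasing-bound _ l inc))

  Increasing-head : ∀ {b} lo l → Increasing b lo l → HeadAtLeast lo l
  Increasing-head lo []      inc = tt
  Increasing-head lo (a ∷ l) (lo≤a , _) = lo≤a

  Increasing-raise : ∀ {b lo lo′} l → Increasing b lo l → HeadAtLeast lo′ l → lo′ ℤ.≤ b → Increasing b lo′ l
  Increasing-raise []      inc       h lo′≤b = lo′≤b
  Increasing-raise (a ∷ l) (_ , inc) h lo′≤b = h , inc

  -- The number of entries after the last k is 0 or 1, whence the hypothesis e ≤ 1 in the lemmas on
  -- rows.
  ends : ℤ → ℕ → ℤ → List (List ℤ)
  ends b zero    = endOdd
  ends b (suc _) = endEven b

  module _ (b : ℤ) where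

    ∈-ends⁻ : ∀ e lo {l} → e ℕ.≤ 1 → lo ℤ.≤ b → l ∈ ends b e lo → length l ≡ e × Increasing b lo l
    ∈-ends⁻ zero       lo _ lo≤b (here refl) = refl , lo≤b
    ∈-ends⁻ (suc zero) lo _ lo≤b l∈ with ∈-map⁻ (_∷ []) l∈
    ... | a , a∈ , refl with ∈-interval⁻ lo≤b a∈
    ...   | lo≤a , a<b = refl , lo≤a , <⇒+1≤ a<b
    ∈-ends⁻ (suc (suc e)) lo (ℕ.s≤s ()) _ _

    ∈-ends⁺ : ∀ e lo {l} → e ℕ.≤ 1 → lo ℤ.≤ b → length l ≡ e → Increasing b lo l → l ∈ ends b e lo
    ∈-ends⁺ zero       lo {[]}     _ lo≤b len inc = here refl
    ∈-ends⁺ (suc zero) lo {a ∷ []} _ lo≤b len (lo≤a , a+1≤b) =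
      ∈-map⁺ (_∷ []) (∈-interval⁺ lo≤b lo≤a (+1≤⇒< a+1≤b))
    ∈-ends⁺ (suc (suc e)) lo (ℕ.s≤s ()) _ _ _

    ∈-rows⁻ : ∀ e lo ks {l} → e ℕ.≤ 1 → Increasing b lo ks → l ∈ rows (ends b e) lo ks →
              Between e ks l × Increasing b lo l
    ∈-rows⁻ e lo []       e≤1 inc l∈ = ∈-ends⁻ e lo e≤1 inc l∈
    ∈-rows⁻ e lo (k ∷ ks) e≤1 (lo≤k , inc) l∈
      with ∈-++⁻ (concatMap (λ a → map (a ∷_) (rows (ends b e) k ks)) (interval lo k)) l∈
    ... | inj₁ l∈₁ with ∈-concatMap-elim (λ a → map (a ∷_) (rows (ends b e) k ks)) (interval lo k) l∈₁
    ...   | a , a∈ , l∈a with ∈-map⁻ (a ∷_) l∈a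
    ...     | l′ , l′∈ , refl with ∈-interval⁻ lo≤k a∈ | ∈-rows⁻ e k ks e≤1 (Increasing-weaken ks (≤-suc k) inc) l′∈
    ...       | lo≤a , a<k | bet , inc′ = (ℤₚ.<⇒≤ a<k , Increasing-head k l′ inc′ , bet)
                                       , (lo≤a , Increasing-weaken l′ (<⇒+1≤ a<k) inc′)
    ∈-rows⁻ e lo (k ∷ ks) e≤1 (lo≤k , inc) l∈ | inj₂ l∈₂ with ∈-map⁻ (k ∷_) l∈₂
    ... | l′ , l′∈ , refl with ∈-rows⁻ e (k ℤ.+ ℤ.+ 1) ks e≤1 inc l′∈
    ...   | bet , inc′ = (ℤₚ.≤-refl , Increasing-head k l′ (Increasing-weaken l′ (≤-suc k) inc′) , bet)
                       , (lo≤k , inc′)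

    ∈-rows⁺ : ∀ e lo ks {l} → e ℕ.≤ 1 → Increasing b lo ks → Between e ks l → Increasing b lo l →
              l ∈ rows (ends b e) lo ks
    ∈-rows⁺ e lo []       e≤1 inc len inc′ = ∈-ends⁺ e lo e≤1 inc len inc′
    ∈-rows⁺ e lo (k ∷ ks) {a ∷ l} e≤1 (lo≤k , inc) (a≤k , h , bet) (lo≤a , inc′) with a ℤₚ.≟ k
    ... | yes refl = ∈-++⁺ʳ (concatMap (λ c → map (c ∷_) (rows (ends b e) k ks)) (interval lo k))
      (∈-map⁺ (k ∷_) (∈-rows⁺ e (k ℤ.+ ℤ.+ 1) ks e≤1 inc bet inc′))
    ... | no a≢k = ∈-++⁺ˡ (∈-concatMap-intro (λ c → map (c ∷_) (rows (ends b e) k ks))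
      (∈-interval⁺ lo≤k lo≤a (ℤₚ.≤∧≢⇒< a≤k a≢k))
      (∈-map⁺ (a ∷_) (∈-rows⁺ e k ks e≤1 inc₀ bet
        (Increasing-raise l inc′ h (Increasing-bound k ks inc₀)))))
      where inc₀ = Increasing-weaken ks (≤-suc k) inc

    -- The head of a row tells the pieces apart: it is less than `k` throughout the first part and
    -- equal to `k` in the second.
    Unique-rows : ∀ e lo ks → e ℕ.≤ 1 → Increasing b lo ks → Unique (rows (ends b e) lo ks)
    Unique-rows zero       lo []  _ inc = [] ∷ []
    Unique-rows (suc zero) lo []  _ inc = Uniqueₚ.map⁺ (λ { refl → refl }) (Unique-from lo _)
    Unique-rows (suc (suc e)) lo [] (ℕ.s≤s ()) inc
    Unique-rows e lo (k ∷ ks) e≤1 (lo≤k , inc) = Uniqueₚ.++⁺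
      (Unique-concatMap f (Unique-from lo ℤ.∣ k ℤ.- lo ∣)
        (λ a _ → Uniqueₚ.map⁺ Listₚ.∷-injectiveʳ
          (Unique-rows e k ks e≤1 (Increasing-weaken ks (≤-suc k) inc)))
        (λ a a′ l _ _ l∈ l∈′ → Listₚ.∷-injectiveˡ (trans (sym (starts a l∈)) (starts a′ l∈′))))
      (Uniqueₚ.map⁺ Listₚ.∷-injectiveʳ (Unique-rows e (k ℤ.+ ℤ.+ 1) ks e≤1 inc))
      (λ { (l∈ , l∈′) → disjoint (∈-concatMap-elim f (interval lo k) l∈) (∈-map⁻ (k ∷_) l∈′) })
      where
      f : ℤ → List (List ℤ)
      f a = map (a ∷_) (rows (ends b e) k ks)
      tail′ : List ℤ → List ℤ
      tail′ []      = []
      tail′ (_ ∷ l) = l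
      starts : ∀ a {l} → l ∈ f a → l ≡ a ∷ tail′ l
      starts a l∈ with ∈-map⁻ (a ∷_) l∈
      ... | _ , _ , refl = refl
      disjoint : ∀ {l} → (∃ λ a → a ∈ interval lo k × l ∈ f a) →
                 (∃ λ l′ → l′ ∈ rows (ends b e) (k ℤ.+ ℤ.+ 1) ks × l ≡ k ∷ l′) → ⊥
      disjoint (a , a∈ , l∈) (l′ , _ , refl) with ∈-map⁻ (a ∷_) l∈
      ... | _ , _ , refl = ℤₚ.<-irrefl refl (proj₂ (∈-interval⁻ lo≤k a∈))

  Strict : List ℤ → Set
  Strict r = ∀ j a b → nth r j ≡ just a → nth r (suc j) ≡ just b → a ℤ.< b

  Interlaced : List ℤ → List ℤ → Set
  Interlaced l r = (∀ j a b → nth l j ≡ just a → nth r j ≡ just b → b ℤ.≤ a)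
                 × (∀ j a b → nth l j ≡ just a → nth r (suc j) ≡ just b → a ℤ.≤ b)

  Interlaced⇒Between : ∀ e k ks l → length l ≡ length ks ℕ.+ e → Interlaced l (k ∷ ks) →
                       HeadAtLeast k l × Between e ks l
  Interlaced⇒Between e k []        []      len (c₁ , c₂) = tt , len
  Interlaced⇒Between e k []        (a ∷ l) len (c₁ , c₂) = c₁ 0 a k refl refl , len
  Interlaced⇒Between e k (k′ ∷ ks) (a ∷ l) len (c₁ , c₂) =
    c₁ 0 a k refl refl , c₂ 0 a k′ refl refl ,
    Interlaced⇒Between e k′ ks l (ℕₚ.suc-injective len) ((λ j → c₁ (suc j)) , (λ j → c₂ (suc j)))

  Between⇒Interlaced : ∀ e k ks l → HeadAtLeast k l → Between e ks l → Interlaced l (k ∷ ks)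
  Between⇒Interlaced e k ks l h bet = below k ks l h bet , above′ k ks l bet
    where
    below : ∀ k ks l → HeadAtLeast k l → Between e ks l →
            ∀ j a b → nth l j ≡ just a → nth (k ∷ ks) j ≡ just b → b ℤ.≤ a
    below k ks        (a ∷ l) h bet zero _ _ refl refl = h
    below k (k′ ∷ ks) (a ∷ l) h (_ , h′ , bet) (suc j) = below k′ ks l h′ bet j
    above′ : ∀ k ks l → Between e ks l →
             ∀ j a b → nth l j ≡ just a → nth (k ∷ ks) (suc j) ≡ just b → a ℤ.≤ b
    above′ k (k′ ∷ ks) (a ∷ l) (a≤k′ , _ , _)  zero _ _ refl refl = a≤k′
    above′ k (k′ ∷ ks) (a ∷ l) (_ , _ , bet) (suc j) = above′ k′ ks l bet j

  Increasing⇒Strict : ∀ {b} lo r → Increasing b lo r → Strict r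
  Increasing⇒Strict lo (k ∷ k′ ∷ r) (_ , k+1≤k′ , _) zero _ _ refl refl = +1≤⇒< k+1≤k′
  Increasing⇒Strict lo (k ∷ r)      (_ , inc) (suc j) = Increasing⇒Strict _ r inc j

  Increasing⇒All : ∀ {x} lo r → Increasing (x ℤ.+ ℤ.+ 1) lo r → All (ℤ._≤ x) r
  Increasing⇒All lo []      inc = []
  Increasing⇒All {x} lo (k ∷ r) (_ , inc) =
    cancel (Increasing-bound _ r inc) ∷ Increasing⇒All (k ℤ.+ ℤ.+ 1) r inc
    where
    cancel : k ℤ.+ ℤ.+ 1 ℤ.≤ x ℤ.+ ℤ.+ 1 → k ℤ.≤ x
    cancel l = subst₂ ℤ._≤_ (drop k) (drop x) (ℤₚ.+-monoˡ-≤ -[1+ 0 ] l)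
      where
      drop : ∀ a → a ℤ.+ ℤ.+ 1 ℤ.+ -[1+ 0 ] ≡ a
      drop a = trans (ℤₚ.+-assoc a (ℤ.+ 1) -[1+ 0 ]) (ℤₚ.+-identityʳ a)

  Strict⇒Increasing : ∀ {x} lo r → Strict r → All (ℤ._≤ x) r → HeadAtLeast lo r →
                      lo ℤ.≤ x ℤ.+ ℤ.+ 1 → Increasing (x ℤ.+ ℤ.+ 1) lo r
  Strict⇒Increasing lo []      s all h lo≤ = lo≤
  Strict⇒Increasing {x} lo (k ∷ r) s (k≤x ∷ all) h lo≤ =
    h , Strict⇒Increasing (k ℤ.+ ℤ.+ 1) r (s ∘ suc) all (next r s) (ℤₚ.+-monoˡ-≤ (ℤ.+ 1) k≤x)
    where
    next : ∀ r → Strict (k ∷ r) → HeadAtLeast (k ℤ.+ ℤ.+ 1) r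
    next []       s = tt
    next (k′ ∷ r) s = <⇒+1≤ (s 0 k k′ refl refl)

  module _ {A : Set} where

    nth-∷ʳ-last : ∀ (xs : List A) y → nth (xs ∷ʳ y) (length xs) ≡ just y
    nth-∷ʳ-last []       y = refl
    nth-∷ʳ-last (x ∷ xs) y = nth-∷ʳ-last xs y

    nth-∷ʳ⁺ : ∀ (xs : List A) y i {a} → nth xs i ≡ just a → nth (xs ∷ʳ y) i ≡ just a
    nth-∷ʳ⁺ (x ∷ xs) y zero    e = e
    nth-∷ʳ⁺ (x ∷ xs) y (suc i) e = nth-∷ʳ⁺ xs y i e

    nth-∷ʳ⁻ : ∀ (xs : List A) y i {a} → nth (xs ∷ʳ y) i ≡ just a →
              (nth xs i ≡ just a × i ℕ.< length xs) ⊎ (i ≡ length xs × y ≡ a)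
    nth-∷ʳ⁻ []       y zero    e = inj₂ (refl , just-injective e)
    nth-∷ʳ⁻ (x ∷ xs) y zero    e = inj₁ (e , ℕ.s≤s ℕ.z≤n)
    nth-∷ʳ⁻ (x ∷ xs) y (suc i) e with nth-∷ʳ⁻ xs y i e
    ... | inj₁ (e′ , l) = inj₁ (e′ , ℕ.s≤s l)
    ... | inj₂ (e′ , l) = inj₂ (cong suc e′ , l)

  entry⁻ : ∀ t i j {a} → entry t i j ≡ just a → ∃ λ r → nth t i ≡ just r × nth r j ≡ just a
  entry⁻ t i j e with nth t i
  ... | just r = r , refl , e

  entry⁺ : ∀ t i j {a r} → nth t i ≡ just r → nth r j ≡ just a → entry t i j ≡ just a
  entry⁺ t i j e e′ with nth t i
  entry⁺ t i j refl e′ | just _ = e′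

  entry-∷ʳ⁺ : ∀ t r i j {a} → entry t i j ≡ just a → entry (t ∷ʳ r) i j ≡ just a
  entry-∷ʳ⁺ t r i j e with entry⁻ t i j e
  ... | r′ , e₁ , e₂ = entry⁺ (t ∷ʳ r) i j (nth-∷ʳ⁺ t r i e₁) e₂

  entry-∷ʳ⁻ : ∀ t r i j {a} → entry (t ∷ʳ r) i j ≡ just a →
              (entry t i j ≡ just a × i ℕ.< length t) ⊎ (i ≡ length t × nth r j ≡ just a)
  entry-∷ʳ⁻ t r i j e with entry⁻ (t ∷ʳ r) i j e
  ... | r′ , e₁ , e₂ with nth-∷ʳ⁻ t r i e₁
  ...   | inj₁ (e₃ , l)    = inj₁ (entry⁺ t i j e₃ e₂ , l)
  ...   | inj₂ (e₃ , refl) = inj₂ (e₃ , e₂)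

  -- Triangles as chains of interlacing rows.

  module Triangles (x : ℤ) where

    -- The exclusive upper bound for the entries, which is also the point about which the odd
    -- columns are antisymmetric.
    top : ℤ
    top = x ℤ.+ ℤ.+ 1

    Row : ℕ → List ℤ → Set
    Row n r = length r ≡ ⌈ suc n /2⌉ × All (ℤ._≤ x) r × Strict r

    -- Unfolds to `IsHMT` when `r` is `toList k`. The bottom row is a list so that the induction on
    -- the number of rows can pass to an enumerated row above.
    Triangle : ℕ → List ℤ → List (List ℤ) → Set
    Triangle n r t =
        map length t ≡ map (λ i → ⌈ suc i /2⌉) (upTo n)
      × nth t (n ℕ.∸ 1) ≡ just r
      × All (All (ℤ._≤ x)) t
      × (∀ i j a b → entry t i j ≡ just a → entry t (suc i) j ≡ just b → b ℤ.≤ a)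
      × (∀ i j a b → entry t i j ≡ just a → entry t (suc i) (suc j) ≡ just b → a ℤ.≤ b)
      × (∀ i j a b → entry t i j ≡ just a → entry t i (suc j) ≡ just b → a ℤ.< b)

    private
      heights : ℕ → List ℕ
      heights n = map (λ i → ⌈ suc i /2⌉) (upTo n)

      heights-suc : ∀ n → heights (suc n) ≡ heights n ∷ʳ ⌈ suc n /2⌉
      heights-suc n = trans (cong (map (λ i → ⌈ suc i /2⌉)) (sym (Listₚ.upTo-∷ʳ n)))
                            (Listₚ.map-++ _ (upTo n) (n ∷ []))

      length-heights : ∀ n (t : List (List ℤ)) → map length t ≡ heights n → length t ≡ n
      length-heights n t e = trans (sym (Listₚ.length-map length t)) (trans (cong length e)
        (trans (Listₚ.length-map _ (upTo n)) (Listₚ.length-upTo n)))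

      last-row : ∀ n (t : List (List ℤ)) r → map length t ≡ heights (suc n) → nth t n ≡ just r →
        ∃ λ t′ → t ≡ t′ ∷ʳ r × map length t′ ≡ heights n × length r ≡ ⌈ suc n /2⌉
      last-row n t r e e′ with initLast t
      last-row n .[] r e () | []
      last-row n .(t′ ∷ʳ r′) r e e′ | t′ ∷ʳ′ r′
        with Listₚ.∷ʳ-injective (map length t′) (heights n)
               (trans (sym (Listₚ.map-++ length t′ (r′ ∷ []))) (trans e (heights-suc n)))
      ... | e₁ , e₂ with just-injective (trans (sym (nth-∷ʳ-last t′ r′))
                           (trans (cong (nth (t′ ∷ʳ r′)) (length-heights n t′ e₁)) e′))
      ...   | refl = t′ , refl , e₁ , e₂

    Triangle-row : ∀ n r t → Triangle (suc n) r t → Row n r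
    Triangle-row n r t (lens , last , all , _ , _ , c₃) with last-row n t r lens last
    ... | t′ , refl , lens′ , len = len , proj₂ (Allₚ.∷ʳ⁻ all) ,
      λ j a b e e′ → c₃ n j a b (entry⁺ t n j last e) (entry⁺ t n (suc j) last e′)

    Triangle-single⁺ : ∀ r → Row 0 r → Triangle 1 r (r ∷ [])
    Triangle-single⁺ r (len , all , strict) = cong (_∷ []) len , refl , all ∷ [] ,
      (λ { zero j a b e () ; (suc i) j a b () e′ }) ,
      (λ { zero j a b e () ; (suc i) j a b () e′ }) ,
      (λ { zero j a b e e′ → strict j a b e e′ ; (suc i) j a b () e′ })

    Triangle-single⁻ : ∀ r t → Triangle 1 r t → t ≡ r ∷ []
    Triangle-single⁻ r t (lens , last , _) with last-row 0 t r lens last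
    ... | [] , refl , _ = refl

    Triangle-∷ʳ⁺ : ∀ n l r t → Triangle (suc n) l t → Row (suc n) r → Interlaced l r →
                   Triangle (suc (suc n)) r (t ∷ʳ r)
    Triangle-∷ʳ⁺ n l r t (lens , last , all , c₁ , c₂ , c₃) (len , all-r , strict) (i₁ , i₂) =
      trans (Listₚ.map-++ length t (r ∷ [])) (trans (cong₂ _∷ʳ_ lens len) (sym (heights-suc (suc n)))) ,
      trans (cong (nth (t ∷ʳ r)) (sym length-t)) (nth-∷ʳ-last t r) ,
      Allₚ.∷ʳ⁺ all all-r ,
      (λ i j a b e e′ → vertical j j (λ i → c₁ i j) (i₁ j) i a b (entry-∷ʳ⁻ t r i j e) (entry-∷ʳ⁻ t r (suc i) j e′)) ,
      (λ i j a b e e′ → vertical j (suc j) (λ i a b p q → c₂ i j a b p q) (i₂ j) i a b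
         (entry-∷ʳ⁻ t r i j e) (entry-∷ʳ⁻ t r (suc i) (suc j) e′)) ,
      (λ i j a b e e′ → horizontal i j a b (entry-∷ʳ⁻ t r i j e) (entry-∷ʳ⁻ t r i (suc j) e′))
      where
      length-t : length t ≡ suc n
      length-t = length-heights (suc n) t lens
      in-l : ∀ i j {a} → suc i ≡ length t → entry t i j ≡ just a → nth l j ≡ just a
      in-l i j {a} e p with entry⁻ t i j p
      ... | r′ , p₁ , p₂ with ℕₚ.suc-injective (trans e length-t)
      ...   | refl = subst (λ r → nth r j ≡ just a) (just-injective (trans (sym p₁) last)) p₂
      -- One argument for both interlacing inequalities: the lower entry lies either in the old
      -- triangle or in the appended row, and in the latter case the upper entry lies in the old
      -- bottom row `l`.
      vertical : ∀ j j′ {R : ℤ → ℤ → Set} →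
        (∀ i a b → entry t i j ≡ just a → entry t (suc i) j′ ≡ just b → R a b) →
        (∀ a b → nth l j ≡ just a → nth r j′ ≡ just b → R a b) →
        ∀ i a b → (entry t i j ≡ just a × i ℕ.< length t) ⊎ (i ≡ length t × nth r j ≡ just a) →
        (entry t (suc i) j′ ≡ just b × suc i ℕ.< length t) ⊎ (suc i ≡ length t × nth r j′ ≡ just b) →
        R a b
      vertical j j′ old new i a b (inj₁ (p , _)) (inj₁ (q , _)) = old i a b p q
      vertical j j′ old new i a b (inj₁ (p , _)) (inj₂ (e , q)) = new a b (in-l i j e p) q
      vertical j j′ old new i a b (inj₂ (refl , p)) (inj₁ (q , lt)) = ⊥-elim (ℕₚ.<-asym lt (ℕₚ.n<1+n _))
      vertical j j′ old new i a b (inj₂ (refl , p)) (inj₂ (e , q)) = ⊥-elim (ℕₚ.1+n≢n e)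
      horizontal : ∀ i j a b →
        (entry t i j ≡ just a × i ℕ.< length t) ⊎ (i ≡ length t × nth r j ≡ just a) →
        (entry t i (suc j) ≡ just b × i ℕ.< length t) ⊎ (i ≡ length t × nth r (suc j) ≡ just b) →
        a ℤ.< b
      horizontal i j a b (inj₁ (p , _)) (inj₁ (q , _)) = c₃ i j a b p q
      horizontal i j a b (inj₂ (_ , p)) (inj₂ (_ , q)) = strict j a b p q
      horizontal i j a b (inj₁ (_ , lt)) (inj₂ (refl , _)) = ⊥-elim (ℕₚ.<-irrefl refl lt)
      horizontal i j a b (inj₂ (refl , _)) (inj₁ (_ , lt)) = ⊥-elim (ℕₚ.<-irrefl refl lt)

    Triangle-∷ʳ⁻ : ∀ n r t → Triangle (suc (suc n)) r t →
      ∃ λ l → ∃ λ t′ → t ≡ t′ ∷ʳ r × Triangle (suc n) l t′ × Interlaced l r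
    Triangle-∷ʳ⁻ n r t (lens , last , all , c₁ , c₂ , c₃) with last-row (suc n) t r lens last
    ... | t′ , refl , lens′ , len with initLast t′
    ...   | [] = ⊥-elim (ℕₚ.0≢1+n (length-heights (suc n) [] lens′))
    ...   | t″ ∷ʳ′ l = l , t″ ∷ʳ l , refl ,
      (lens′ , last′ , proj₁ (Allₚ.∷ʳ⁻ all) ,
        (λ i j a b e e′ → c₁ i j a b (up i j e) (up (suc i) j e′)) ,
        (λ i j a b e e′ → c₂ i j a b (up i j e) (up (suc i) (suc j) e′)) ,
        (λ i j a b e e′ → c₃ i j a b (up i j e) (up i (suc j) e′))) ,
      (λ j a b e e′ → c₁ n j a b (up n j (entry⁺ (t″ ∷ʳ l) n j last′ e)) (entry⁺ (t″ ∷ʳ l ∷ʳ r) (suc n) j last e′)) ,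
      (λ j a b e e′ → c₂ n j a b (up n j (entry⁺ (t″ ∷ʳ l) n j last′ e)) (entry⁺ (t″ ∷ʳ l ∷ʳ r) (suc n) (suc j) last e′))
      where
      up : ∀ i j {a} → entry (t″ ∷ʳ l) i j ≡ just a → entry (t″ ∷ʳ l ∷ʳ r) i j ≡ just a
      up i j = entry-∷ʳ⁺ (t″ ∷ʳ l) r i j
      length-t″ : length t″ ≡ n
      length-t″ = ℕₚ.suc-injective (trans (sym (trans (Listₚ.length-++ t″) (ℕₚ.+-comm (length t″) 1)))
        (length-heights (suc n) (t″ ∷ʳ l) lens′))
      last′ : nth (t″ ∷ʳ l) n ≡ just l
      last′ = trans (cong (nth (t″ ∷ʳ l)) (sym length-t″)) (nth-∷ʳ-last t″ l)

    -- If `k ∷ ks` is a row of index n + 2, the row above it has `extra n` more entries than `ks`.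
    extra : ℕ → ℕ
    extra zero          = 1
    extra (suc zero)    = 0
    extra (suc (suc n)) = extra n

    extra≤1 : ∀ n → extra n ℕ.≤ 1
    extra≤1 zero          = ℕₚ.≤-refl
    extra≤1 (suc zero)    = ℕ.z≤n
    extra≤1 (suc (suc n)) = extra≤1 n

    half-extra : ∀ n → ⌈ n /2⌉ ℕ.+ extra n ≡ ⌈ suc n /2⌉
    half-extra zero          = refl
    half-extra (suc zero)    = refl
    half-extra (suc (suc n)) = cong suc (half-extra n)

    -- The first entry of the bottom row only bounds the row above from below, so it serves as `lo`.
    -- The empty list is a default value, since no row is empty.
    above : ℕ → List ℤ → List (List ℤ)
    above n []       = []
    above n (k ∷ ks) = rows (ends top (extra n)) k ks

    -- Entry n lists the triangles with n + 1 rows.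
    triangles : ℕ → List ℤ → List (List (List ℤ))
    triangles zero    r = (r ∷ []) ∷ []
    triangles (suc n) r = concatMap (λ l → map (_∷ʳ r) (triangles n l)) (above n r)

    Row⇒Increasing : ∀ n k ks → Row n (k ∷ ks) → Increasing top k (k ∷ ks)
    Row⇒Increasing n k ks (_ , all@(k≤x ∷ _) , strict) =
      Strict⇒Increasing k (k ∷ ks) strict all ℤₚ.≤-refl (ℤₚ.≤-trans k≤x (≤-suc x))

    Row⇒Increasing′ : ∀ n k ks → Row n (k ∷ ks) → Increasing top k ks
    Row⇒Increasing′ n k ks row = Increasing-weaken ks (≤-suc k) (proj₂ (Row⇒Increasing n k ks row))

    ∈-above⁻ : ∀ n r {l} → Row (suc n) r → l ∈ above n r → Row n l × Interlaced l r
    ∈-above⁻ n (k ∷ ks) {l} row@(len , _) l∈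
      with ∈-rows⁻ top (extra n) k ks (extra≤1 n) (Row⇒Increasing′ (suc n) k ks row) l∈
    ... | bet , inc =
      ( trans (Between-length (extra n) ks l bet)
          (trans (cong (ℕ._+ extra n) (ℕₚ.suc-injective len)) (half-extra n))
      , Increasing⇒All k l inc , Increasing⇒Strict k l inc)
      , Between⇒Interlaced (extra n) k ks l (Increasing-head k l inc) bet

    ∈-above⁺ : ∀ n r {l} → Row (suc n) r → Row n l → Interlaced l r → l ∈ above n r
    ∈-above⁺ n (k ∷ ks) {l} row@(len , _) (len-l , all , strict) inter =
      ∈-rows⁺ top (extra n) k ks (extra≤1 n) inc-ks (proj₂ bet)
        (Strict⇒Increasing k l strict all (proj₁ bet) (Increasing-bound k ks inc-ks))
      where
      inc-ks = Row⇒Increasing′ (suc n) k ks row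
      bet = Interlaced⇒Between (extra n) k ks l
        (trans len-l (trans (sym (half-extra n)) (cong (ℕ._+ extra n) (sym (ℕₚ.suc-injective len))))) inter

    ∈-triangles⁻ : ∀ n r {t} → Row n r → t ∈ triangles n r → Triangle (suc n) r t
    ∈-triangles⁻ zero    r row (here refl) = Triangle-single⁺ r row
    ∈-triangles⁻ (suc n) r row t∈ with ∈-concatMap-elim (λ l → map (_∷ʳ r) (triangles n l)) (above n r) t∈
    ... | l , l∈ , t∈l with ∈-map⁻ (_∷ʳ r) t∈l | ∈-above⁻ n r row l∈
    ...   | t′ , t′∈ , refl | row-l , inter =
      Triangle-∷ʳ⁺ n l r t′ (∈-triangles⁻ n l row-l t′∈) row inter

    ∈-triangles⁺ : ∀ n r {t} → Triangle (suc n) r t → t ∈ triangles n r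
    ∈-triangles⁺ zero    r {t} tri = here (Triangle-single⁻ r t tri)
    ∈-triangles⁺ (suc n) r {t} tri with Triangle-∷ʳ⁻ n r t tri
    ... | l , t′ , refl , tri′ , inter = ∈-concatMap-intro (λ l → map (_∷ʳ r) (triangles n l))
      (∈-above⁺ n r (Triangle-row (suc n) r t tri) (Triangle-row n l t′ tri′) inter)
      (∈-map⁺ (_∷ʳ r) (∈-triangles⁺ n l tri′))

    Unique-triangles : ∀ n r → Row n r → Unique (triangles n r)
    Unique-triangles zero    r row = [] ∷ []
    Unique-triangles (suc n) r row = Unique-concatMap (λ l → map (_∷ʳ r) (triangles n l))
      (Unique-above r row)
      (λ l l∈ → Uniqueₚ.map⁺ (Listₚ.∷ʳ-injectiveˡ _ _) (Unique-triangles n l (proj₁ (∈-above⁻ n r row l∈))))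
      separate
      where
      Unique-above : ∀ r → Row (suc n) r → Unique (above n r)
      Unique-above (k ∷ ks) row =
        Unique-rows top (extra n) k ks (extra≤1 n) (Row⇒Increasing′ (suc n) k ks row)
      separate : ∀ l l′ t → l ∈ above n r → l′ ∈ above n r →
        t ∈ map (_∷ʳ r) (triangles n l) → t ∈ map (_∷ʳ r) (triangles n l′) → l ≡ l′
      separate l l′ t l∈ l′∈ t∈ t∈′ with ∈-map⁻ (_∷ʳ r) t∈ | ∈-map⁻ (_∷ʳ r) t∈′
      ... | u , u∈ , refl | u′ , u′∈ , e with Listₚ.∷ʳ-injectiveˡ u u′ e
      -- A triangle determines its bottom row, so equal triangles come from the same row above.
      ...   | refl = just-injective (trans
        (sym (proj₁ (proj₂ (∈-triangles⁻ n l (proj₁ (∈-above⁻ n r row l∈)) u∈))))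
        (proj₁ (proj₂ (∈-triangles⁻ n l′ (proj₁ (∈-above⁻ n r row l′∈)) u′∈))))

-- The induction on the number of rows.

module CountingFormula where

  open ShiftOperators
  open OperatorProduct
  open Determinants
  open RowSums
  open ColumnFunctions
  open ProductFormulas
  open Enumeration
  open import Data.Rational using (ℚ; 1ℚ; _+_; _*_; -_; _/_)
  open +-*-Solver using (solve; _:*_; :-_; _:=_; con)
  open ≡-Reasoning

  sumOver-cong-∈ : {A : Set} {f g : A → ℚ} (ls : List A) → (∀ l → l ∈ ls → f l ≡ g l) →
                   sumOver f ls ≡ sumOver g ls
  sumOver-cong-∈ []       e = refl
  sumOver-cong-∈ (l ∷ ls) e = cong₂ _+_ (e l (here refl)) (sumOver-cong-∈ ls (λ l′ l∈ → e l′ (there l∈)))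

  sumOver-* : {A : Set} (c : ℚ) (f : A → ℚ) (ls : List A) → sumOver (λ l → c * f l) ls ≡ c * sumOver f ls
  sumOver-* c f []       = sym (ℚₚ.*-zeroʳ c)
  sumOver-* c f (l ∷ ls) = trans (cong (c * f l +_) (sumOver-* c f ls)) (sym (ℚₚ.*-distribˡ-+ c _ _))

  length-concatMap : {A B : Set} (f : A → List B) (ls : List A) →
                     qℕ (length (concatMap f ls)) ≡ sumOver (qℕ ∘ length ∘ f) ls
  length-concatMap f []       = ι-0
  length-concatMap f (l ∷ ls) = begin
    qℕ (length (f l ++ concatMap f ls))            ≡⟨ cong qℕ (Listₚ.length-++ (f l)) ⟩
    qℕ (length (f l) ℕ.+ length (concatMap f ls))  ≡⟨ ι-+ (ℤ.+ length (f l)) (ℤ.+ length (concatMap f ls)) ⟩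
    qℕ (length (f l)) + qℕ (length (concatMap f ls)) ≡⟨ cong (qℕ (length (f l)) +_) (length-concatMap f ls) ⟩
    sumOver (qℕ ∘ length ∘ f) (l ∷ ls)             ∎

  sgn-square : ∀ n a → sgn n * (sgn n * a) ≡ a
  sgn-square zero    a = solve 1 (λ a → con 1ℚ :* (con 1ℚ :* a) := a) refl a
  sgn-square (suc n) a = trans
    (solve 2 (λ s a → (:- s) :* ((:- s) :* a) := s :* (s :* a)) refl (sgn n) a) (sgn-square n a)

  double-mono-< : ∀ {i j} → i ℕ.< j → suc (suc (double i)) ℕ.≤ double j
  double-mono-< {zero}  {suc j} (ℕ.s≤s l) = ℕ.s≤s (ℕ.s≤s ℕ.z≤n)
  double-mono-< {suc i} {suc j} (ℕ.s≤s l) = ℕ.s≤s (ℕ.s≤s (double-mono-< l))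

  module Counting (x : ℤ) (N : ℕ) where
    open Truncated N
    open Products N
    open Columns x
    open Triangles x

    -- The right-hand sides for 2m - 1 and for 2m rows, named after the parity of the number of
    -- rows.
    valueOdd valueEven : ℕ → LFun
    valueOdd m = ⟦ opP m ⟧ (detEven m)
    valueEven m = ⟦ opP m ⟧ (detOdd m)

    det-Antisymmetric : ∀ m φ → Antisymmetric m (det m φ)
    det-Antisymmetric m φ i v len l = det-antisymmetric m φ i v (subst (suc i ℕ.<_) (sym len) l)

    sum-valueOdd : ∀ k ks → suc (double (length ks)) ℕ.≤ N → Increasing top k ks →
      sumOver (valueOdd (suc (length ks))) (rows (endEven top) k ks) ≡ valueEven (suc (length ks)) (k ∷ ks)
    sum-valueOdd k ks small inc = begin
      sumOver (valueOdd m) (rows (endEven top) k ks)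
        ≡⟨ sumOver-cong unsigned (rows (endEven top) k ks) ⟩
      sumOver (λ l → sgn m * diffAll (valueEven m) l) (rows (endEven top) k ks)
        ≡⟨ sumOver-* (sgn m) (diffAll (valueEven m)) (rows (endEven top) k ks) ⟩
      sgn m * sumOver (diffAll (valueEven m)) (rows (endEven top) k ks)
        ≡⟨ cong (sgn m *_) (sum-rows-even top k ks (valueEven m) inc
             (opP-Adjacent m (detOdd m) V-detOdd (det-Antisymmetric m oddCol)) vanishes) ⟩
      sgn m * (sgn m * valueEven m (k ∷ ks))
        ≡⟨ sgn-square m _ ⟩
      valueEven m (k ∷ ks) ∎
      where
      m = suc (length ks)
      V-detOdd : V (detOdd m)
      -- The last column `oddCol (length ks)` has degree twice `length ks` plus 1, which is what
      -- `small` bounds by `N`.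
      V-detOdd = det-V N m oddCol (λ j j<m → Nilpotent-mono {φ = oddCol j}
        (ℕ.s≤s (ℕₚ.≤-trans (ℕ.s≤s⁻¹ (double-mono-< j<m)) small)) (oddCol-nilpotent j))
      unsigned : ∀ l → valueOdd m l ≡ sgn m * diffAll (valueEven m) l
      unsigned l = sym (begin
        sgn m * diffAll (valueEven m) l                       ≡⟨ cong (sgn m *_) (diffAll-comm (opP m) (detOdd m) l) ⟩
        sgn m * ⟦ opP m ⟧ (diffAll (detOdd m)) l              ≡⟨ cong (sgn m *_) (⟦⟧-cong (opP m) (diffAll-detOdd m) l) ⟩
        sgn m * ⟦ opP m ⟧ (λ w → sgn m * detEven m w) l       ≡⟨ cong (sgn m *_) (⟦⟧-* (opP m) (sgn m) (detEven m) l) ⟩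
        sgn m * (sgn m * valueOdd m l)                        ≡⟨ sgn-square m _ ⟩
        valueOdd m l                                          ∎)
      fixed : centre ℤ.- top ≡ top
      fixed = ℤ-Solver.solve 1 (λ t → (t ℤ-Solver.:+ t) ℤ-Solver.:- t ℤ-Solver.:= t) refl top
      vanishes : VanishesAtEnd top m (valueEven m)
      vanishes v len = opP-vanishes N centre top (length ks) (detOdd m) V-detOdd
        (det-odd centre m oddCol oddCol-odd) fixed v (ℕₚ.suc-injective len)

    sum-valueEven : ∀ k ks → double (length ks) ℕ.≤ N → Increasing top k ks →
      sumOver (valueEven (length ks)) (rows endOdd k ks) ≡ valueOdd (suc (length ks)) (k ∷ ks)
    sum-valueEven k ks small inc = begin
      sumOver (valueEven m) (rows endOdd k ks)
        ≡⟨ sumOver-cong (λ l → sym (trans (diffAll-comm (opP m) (detBack m) l)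
             (⟦⟧-cong (opP m) (diffAll-detBack m) l))) (rows endOdd k ks) ⟩
      sumOver (diffAll C) (rows endOdd k ks)
        ≡⟨ sum-rows-odd top k ks C inc (opP-Adjacent m (detBack m) V-detBack (det-Antisymmetric m evenColBack)) ⟩
      -- With `k` as the initial lower limit, the right-hand side of `sum-rows-odd` is the unfolded
      -- alternating sum over the whole row.
      alternate C (k ∷ ks)
        ≡⟨ opP-wedge-1 N m (detBack m) V-detBack (k ∷ ks) refl ⟨
      ⟦ opP (suc m) ⟧ (wedge (λ _ → 1ℚ) (detBack m ∘ mapSuc)) (k ∷ ks)
        ≡⟨ ⟦⟧-cong (opP (suc m)) (detEven-suc m) (k ∷ ks) ⟨
      valueOdd (suc m) (k ∷ ks) ∎
      where
      m = length ks
      C = ⟦ opP m ⟧ (detBack m)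
      V-detBack : V (detBack m)
      -- `evenColBack j` has degree 2j + 2, one more than its difference `oddCol j`, and j < m keeps
      -- this within 2m.
      V-detBack = det-V N m evenColBack (λ j j<m → Nilpotent-mono {suc (suc (suc (double j)))} {suc N} {evenColBack j}
        (ℕ.s≤s (ℕₚ.≤-trans (double-mono-< j<m) small))
        (Nilpotent-cong (suc (suc (double j))) (λ a → sym (diff-evenColBack j a)) (oddCol-nilpotent j)))

    extra-double : ∀ h → extra (double h) ≡ 1
    extra-double zero    = refl
    extra-double (suc h) = extra-double h

    extra-suc-double : ∀ h → extra (suc (double h)) ≡ 0
    extra-suc-double zero    = refl
    extra-suc-double (suc h) = extra-suc-double h

    half-double : ∀ h → ⌈ double h /2⌉ ≡ h
    half-double zero    = refl
    half-double (suc h) = cong suc (half-double h)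

    half-suc-double : ∀ h → ⌈ suc (double h) /2⌉ ≡ suc h
    half-suc-double zero    = refl
    half-suc-double (suc h) = cong suc (half-suc-double h)

    count-step : ∀ n r → qℕ (length (triangles (suc n) r)) ≡
                 sumOver (λ l → qℕ (length (triangles n l))) (above n r)
    count-step n r = trans (length-concatMap (λ l → map (_∷ʳ r) (triangles n l)) (above n r))
      (sumOver-cong (λ l → cong qℕ (Listₚ.length-map (_∷ʳ r) (triangles n l))) (above n r))

    -- One truncation `N` serves the whole mutual induction: the degrees needed drop with the number
    -- of rows, so each bound implies the one before it.
    countOdd : ∀ h r → double h ℕ.≤ N → Row (double h) r →
               qℕ (length (triangles (double h) r)) ≡ valueOdd (suc h) r
    countEven : ∀ h r → suc (double h) ℕ.≤ N → Row (suc (double h)) r →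
                qℕ (length (triangles (suc (double h)) r)) ≡ valueEven (suc h) r

    countOdd zero    (k ∷ []) small row = ι-1
    countOdd (suc h) (k ∷ ks) small row@(len , _) = begin
      qℕ (length (triangles (suc n) (k ∷ ks)))
        ≡⟨ count-step n (k ∷ ks) ⟩
      sumOver (λ l → qℕ (length (triangles n l))) (above n (k ∷ ks))
        ≡⟨ sumOver-cong-∈ (above n (k ∷ ks)) (λ l l∈ →
             countEven h l (ℕₚ.<⇒≤ small) (proj₁ (∈-above⁻ n (k ∷ ks) row l∈))) ⟩
      sumOver (valueEven (suc h)) (rows (ends top (extra n)) k ks)
        ≡⟨ cong₂ (λ e m → sumOver (valueEven m) (rows (ends top e) k ks)) (extra-suc-double h) length-ks ⟩
      sumOver (valueEven (length ks)) (rows endOdd k ks)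
        ≡⟨ sum-valueEven k ks (subst (λ m → double m ℕ.≤ N) length-ks small)
             (Row⇒Increasing′ (suc n) k ks row) ⟩
      valueOdd (suc (length ks)) (k ∷ ks)
        ≡⟨ cong (λ m → valueOdd (suc m) (k ∷ ks)) length-ks ⟨
      valueOdd (suc (suc h)) (k ∷ ks) ∎
      where
      n = suc (double h)
      length-ks : suc h ≡ length ks
      length-ks = sym (ℕₚ.suc-injective (trans len (half-suc-double (suc h))))
    countEven h (k ∷ ks) small row@(len , _) = begin
      qℕ (length (triangles (suc n) (k ∷ ks)))
        ≡⟨ count-step n (k ∷ ks) ⟩
      sumOver (λ l → qℕ (length (triangles n l))) (above n (k ∷ ks))
        ≡⟨ sumOver-cong-∈ (above n (k ∷ ks)) (λ l l∈ →
             countOdd h l (ℕₚ.<⇒≤ small) (proj₁ (∈-above⁻ n (k ∷ ks) row l∈))) ⟩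
      sumOver (valueOdd (suc h)) (rows (ends top (extra n)) k ks)
        ≡⟨ cong₂ (λ e m → sumOver (valueOdd (suc m)) (rows (ends top e) k ks)) (extra-double h) length-ks ⟩
      sumOver (valueOdd (suc (length ks))) (rows (endEven top) k ks)
        ≡⟨ sum-valueOdd k ks (subst (λ m → suc (double m) ℕ.≤ N) length-ks small)
             (Row⇒Increasing′ (suc n) k ks row) ⟩
      valueEven (suc (length ks)) (k ∷ ks)
        ≡⟨ cong (λ m → valueEven (suc m) (k ∷ ks)) length-ks ⟨
      valueEven (suc h) (k ∷ ks) ∎
      where
      n = double h
      length-ks : h ≡ length ks
      length-ks = sym (ℕₚ.suc-injective (trans len (half-double (suc h))))

  double≡2* : ∀ h → double h ≡ 2 ℕ.* h
  double≡2* zero    = refl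
  double≡2* (suc h) = cong suc (trans (cong suc (double≡2* h)) (sym (ℕₚ.+-suc h (h ℕ.+ 0))))

  Strict-toList : ∀ {m} (k : Vector ℤ m) → (∀ i j → i Fin.< j → k i ℤ.< k j) → Strict (toList k)
  Strict-toList {suc (suc m)} k mono zero _ _ refl refl = mono Fin.zero (Fin.suc Fin.zero) (ℕ.s≤s ℕ.z≤n)
  Strict-toList {suc m} k mono (suc j) =
    Strict-toList (k ∘ Fin.suc) (λ i j i<j → mono (Fin.suc i) (Fin.suc j) (ℕ.s≤s i<j)) j
  Strict-toList {suc zero} k mono zero a b e ()

  module _ (x : ℤ) where
    open Columns x
    open Matching x
    open Triangles x

    theorem2-suc : ∀ n (k : Vector ℤ ⌈ suc n /2⌉) →
      (∀ i j → i Fin.< j → k i ℤ.< k j) → (∀ i → k i ℤ.≤ x) →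
      Σ ℕ (λ γ → HasCount (IsHMT (suc n) x k) γ
        × ((h : ℕ) → suc n ≡ suc (2 ℕ.* h) → OpValue ⌈ suc n /2⌉ (Fodd ⌈ suc n /2⌉ x) k ((ℤ.+ γ) / 1))
        × ((h : ℕ) → suc n ≡ 2 ℕ.* h → OpValue ⌈ suc n /2⌉ (Feven ⌈ suc n /2⌉ x) k ((ℤ.+ γ) / 1)))
    theorem2-suc n k mono bound = length (triangles n r) ,
      (triangles n r , Unique-triangles n r row , (λ t → ∈-triangles⁻ n r row , ∈-triangles⁺ n r) , refl) ,
      -- Truncating at `n` is enough: for n + 1 rows no column has degree above n, the last one
      -- having degree 2h for n = 2h and 2h + 1 for n = 2h + 1.
      (λ h e → n , λ N n≤N → odd h N n≤N (ℕₚ.suc-injective (trans e (cong suc (sym (double≡2* h)))))) ,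
      even
      where
      r = toList k
      row : Row n r
      row = Listₚ.length-tabulate k , Allₚ.tabulate⁺ bound , Strict-toList k mono
      odd : ∀ h N → n ℕ.≤ N → n ≡ double h →
            opProd ⌈ suc n /2⌉ N (Fodd ⌈ suc n /2⌉ x) k ≡ (ℤ.+ length (triangles n r)) / 1
      odd h N n≤N e = begin
        opProd ⌈ suc n /2⌉ N (Fodd ⌈ suc n /2⌉ x) k
          ≡⟨ opProd≡opP ⌈ suc n /2⌉ _ (detEven ⌈ suc n /2⌉) (Fodd≡detEven ⌈ suc n /2⌉) k ⟩
        valueOdd ⌈ suc n /2⌉ r
          ≡⟨ cong (λ m → valueOdd m r) (trans (cong (λ n → ⌈ suc n /2⌉) e) (half-suc-double h)) ⟩
        valueOdd (suc h) r
          ≡⟨ countOdd h r (subst (ℕ._≤ N) e n≤N) (subst (λ n → Row n r) e row) ⟨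
        qℕ (length (triangles (double h) r))
          ≡⟨ trans (cong (λ n → qℕ (length (triangles n r))) (sym e)) (ι-def _) ⟩
        (ℤ.+ length (triangles n r)) / 1 ∎
        where
        open Bridge N
        open Counting x N
      even′ : ∀ h N → n ℕ.≤ N → n ≡ suc (double h) →
            opProd ⌈ suc n /2⌉ N (Feven ⌈ suc n /2⌉ x) k ≡ (ℤ.+ length (triangles n r)) / 1
      even′ h N n≤N e = begin
        opProd ⌈ suc n /2⌉ N (Feven ⌈ suc n /2⌉ x) k
          ≡⟨ opProd≡opP ⌈ suc n /2⌉ _ (detOdd ⌈ suc n /2⌉) (Feven≡detOdd ⌈ suc n /2⌉) k ⟩
        valueEven ⌈ suc n /2⌉ r
          ≡⟨ cong (λ m → valueEven m r) (trans (cong (λ n → ⌈ suc n /2⌉) e) (half-double (suc h))) ⟩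
        valueEven (suc h) r
          ≡⟨ countEven h r (subst (ℕ._≤ N) e n≤N) (subst (λ n → Row n r) e row) ⟨
        qℕ (length (triangles (suc (double h)) r))
          ≡⟨ trans (cong (λ n → qℕ (length (triangles n r))) (sym e)) (ι-def _) ⟩
        (ℤ.+ length (triangles n r)) / 1 ∎
        where
        open Bridge N
        open Counting x N
      even : (h : ℕ) → suc n ≡ 2 ℕ.* h → OpValue ⌈ suc n /2⌉ (Feven ⌈ suc n /2⌉ x) k ((ℤ.+ length (triangles n r)) / 1)
      even (suc h) e = n , λ N n≤N → even′ h N n≤N
        (ℕₚ.suc-injective (trans e (sym (double≡2* (suc h)))))

open import Data.Nat using (ℕ; suc; _*_; _≤_; ⌈_/2⌉)
open import Data.Integer as ℤ using (ℤ; +_)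
open import Data.Rational using (_/_)
open import Data.Fin as Fin using (Fin)
open import Data.Product using (Σ; _×_)
open import Data.Vec.Functional using (Vector)
open import Relation.Binary.PropositionalEquality using (_≡_)

theorem2 : (n : ℕ) → 1 ≤ n → (x : ℤ) → (k : Vector ℤ ⌈ n /2⌉) →
    (∀ (i j : Fin ⌈ n /2⌉) → i Fin.< j → k i ℤ.< k j) →
    (∀ (i : Fin ⌈ n /2⌉) → k i ℤ.≤ x) →
    Σ ℕ (λ γ → HasCount (IsHMT n x k) γ
    × ((h : ℕ) → n ≡ suc (2 * h) → OpValue ⌈ n /2⌉ (Fodd ⌈ n /2⌉ x) k ((+ γ) / 1))
    × ((h : ℕ) → n ≡ 2 * h → OpValue ⌈ n /2⌉ (Feven ⌈ n /2⌉ x) k ((+ γ) / 1)))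
theorem2 (suc n) _ x k mono bound = CountingFormula.theorem2-suc x n k mono bound
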